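{- For every integer $r>0$ there exists an asymmetric shape datum $b^{\mathrm A}$ for $(\mathbf{Y},\leftharpoondown_r,\leftharpoonup_r,\{0,1\}^r)$ such that whenever $(a,\lambda)=b^{\mathrm A}_{\mu,\nu}(\kappa)$, one has $$\mathrm{spin}^{\mathrm t}(\kappa/\mu)+\mathrm{spin}(\kappa/\nu)=\mathrm{spin}(\mu/\lambda)+\mathrm{spin}^{\mathrm t}(\nu/\lambda)+\mathrm{n}(a).$$ Hence, in $\mathrm{End}(\mathbb{Z}[q^{1/2}]\mathbf{Y})[[X,Y]]$, $$\widetilde D^r_{q^{1/2},Y}\circ U^r_{q^{1/2},X}=\bigl(U^r_{q^{1/2},X}\circ\widetilde D^r_{q^{1/2},Y}\bigr)\prod_{i=0}^{r-1}(1+q^iXY),$$ where $U^r_{q^{1/2},X}(\lambda)=\sum_{\mu:\,\lambda\leftharpoondown_r\mu}q^{\mathrm{spin}(\mu/\lambda)}X^{|\mu/\lambda|_r}\mu$ and $\widetilde D^r_{q^{1/2},Y}(\lambda)=\sum_{\mu:\,\mu\leftharpoonup_r\lambda}q^{\mathrm{spin}^{\mathrm t}(\lambda/\mu)}Y^{|\lambda/\mu|_r}\mu$ for all $\lambda\in\mathbf{Y}$.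
   Context: $\mathbf{Y}$ is the set of all partitions, identified with their Young diagrams (square $(i,j)$ in row $i$, column $j$, both numbered from $0$; rows numbered downwards); $|\lambda|$ is the number of squares of $\lambda$, and $|\lambda|_r=\lfloor|\lambda|/r\rfloor$. Diagonal $d_k$ is $\{(i,j):j-i=k\}$. For $\lambda\subset\mu$, $\mu/\lambda$ is an $r$-ribbon (written $\lambda\prec_r\mu$) if the skew diagram consists of exactly one square on each of $r$ consecutive diagonals; its head is its top-rightmost square, and its height is one less than the number of rows it meets. $\mu/\lambda$ is a horizontal (respectively vertical) $r$-ribbon strip, written $\lambda\leftharpoondown_r\mu$ (respectively $\lambda\leftharpoonup_r\mu$), if there is a (possibly trivial) chain $\lambda=\lambda^{(0)}\prec_r\cdots\prec_r\lambda^{(p)}=\mu$ such that, with $d_{k_t}$ the diagonal containing the head of $\lambda^{(t)}/\lambda^{(t-1)}$, one has $k_1<k_2<\cdots<k_p$ (respectively $k_1>k_2>\cdots>k_p$). (Equivalently for the vertical case: the transposed shapes form a horizontal $r$-ribbon strip.) Such a chain is unique and called the standardisation of $\mu/\lambda$ as a horizontal (respectively vertical) $r$-ribbon strip. In either case $|\mu/\lambda|_r=p$, and $\mathrm{spin}(\mu/\lambda)$ (respectively $\mathrm{spin}^{\mathrm t}(\mu/\lambda)$) is half the sum of the heights of the ribbons $\lambda^{(t)}/\lambda^{(t-1)}$ in that standardisation. For $a=(a_0,\dots,a_{r-1})\in\{0,1\}^r$ put $|a|=\sum_{i=0}^{r-1}a_i$ and $\mathrm{n}(a)=\sum_{i=0}^{r-1}i\,a_i$.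 An (asymmetric) shape datum for $(\mathbf{Y},\leftharpoondown_r,\leftharpoonup_r,\{0,1\}^r)$ is a family of bijections, one for each pair $\mu,\nu\in\mathbf{Y}$, $$b_{\mu,\nu}:\{\kappa\in\mathbf{Y}:\mu\leftharpoonup_r\kappa,\ \nu\leftharpoondown_r\kappa\}\to\{(a,\lambda)\in\{0,1\}^r\times\mathbf{Y}:\lambda\leftharpoondown_r\mu,\ \lambda\leftharpoonup_r\nu\},$$ such that $|\kappa|_r-|\nu|_r-|\mu|_r+|\lambda|_r=|a|$ whenever $(a,\lambda)=b_{\mu,\nu}(\kappa)$. $\mathbb{Z}[q^{1/2}]\mathbf{Y}$ is the free $\mathbb{Z}[q^{1/2}]$-module on the set $\mathbf{Y}$, and $q^{1/2},X,Y$ are indeterminates; elements of $\mathrm{End}(\mathbb{Z}[q^{1/2}]\mathbf{Y})[[X,Y]]$ act on (power series with coefficients in) $\mathbb{Z}[q^{1/2}]\mathbf{Y}$, and are composed accordingly. -}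

module Defs where

open import Data.Empty using (⊥-elim)
open import Data.Fin using (Fin; toℕ)
open import Data.Integer as ℤ using (ℤ; +_; _⊖_)
import Data.Integer.Properties as ℤ
open import Data.List as List
  using (List; []; _∷_; _++_; upTo; foldr; concatMap; mapMaybe; filter; length)
import Data.List.Properties as List
open import Data.List.Membership.Propositional using () renaming (_∈_ to _∈ˡ_)
import Data.List.Membership.Propositional.Properties as Mem
open import Data.List.Relation.Unary.All as All using (All; []; _∷_)
import Data.List.Relation.Unary.All.Properties as All
open import Data.List.Relation.Unary.AllPairs as AllPairs using ([]; _∷_)
import Data.List.Relation.Unary.AllPairs.Properties as AllPairs
open import Data.List.Relation.Binary.Disjoint.Propositional using (Disjoint)
open import Data.List.Relation.Unary.Any as Any using (here; there)
open import Data.List.Relation.Unary.Linked as Linked using (Linked; []; [-]; _∷_)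
open import Data.List.Relation.Unary.Unique.Propositional using (Unique)
import Data.List.Relation.Unary.Unique.Propositional.Properties as Unique
open import Data.Maybe using (Maybe; just; nothing)
open import Data.Nat using (ℕ; zero; suc; _+_; _*_; _∸_; _/_; _≤_; _<_; _≥_; _≟_; _<?_;
  z≤n; s≤s; NonZero; >-nonZero⁻¹)
open import Data.Nat.ListAction using (sum)
import Data.Nat.Properties as ℕ
open import Data.Product using (Σ; ∃!; ∃-syntax; Σ-syntax; _×_; _,_; proj₁; proj₂)
open import Data.Rational as ℚ using (ℚ; ½)
open import Data.Unit using (⊤; tt)
open import Data.Vec as Vec using (Vec)
open import Function using (_∘_)
open import Function.Bundles using (Bijection)
open import Level using (0ℓ)
open import Relation.Binary using (Rel; Setoid; Decidable; DecidableEquality)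
import Relation.Binary.Construct.On as On
open import Relation.Binary.Construct.Closure.ReflexiveTransitive using (Star; ε; _◅_)
open import Relation.Binary.PropositionalEquality
  using (_≡_; refl; sym; trans; cong; cong₂; subst; setoid)
open import Relation.Nullary using (¬_; Dec; yes; no)
open import Relation.Nullary.Decidable using (map′; _×-dec_; _→-dec_; ¬?)

record Partition : Set where
  constructor mkPartition
  field
    parts      : List ℕ
    decreasing : Linked _≥_ parts
    positive   : All (0 <_) parts

open Partition public

partition-≡ : ∀ {λ′ μ} → parts λ′ ≡ parts μ → λ′ ≡ μ
partition-≡ {mkPartition _ d p} {mkPartition _ d′ p′} refl =
  cong₂ (mkPartition _) (Linked.irrelevant ℕ.≤-irrelevant d d′)
                        (All.irrelevant ℕ.≤-irrelevant p p′)

infix 4 _≟ᴾ_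

_≟ᴾ_ : DecidableEquality Partition
λ′ ≟ᴾ μ = map′ partition-≡ (cong parts) (List.≡-dec _≟_ (parts λ′) (parts μ))

-- The i-th entry, taken to be 0 beyond the end of the list.
entry : List ℕ → ℕ → ℕ
entry []       _       = 0
entry (x ∷ _)  zero    = x
entry (_ ∷ xs) (suc i) = entry xs i

rowLength : Partition → ℕ → ℕ
rowLength = entry ∘ parts

size : Partition → ℕ
size = sum ∘ parts

size/ : (r : ℕ) .{{_ : NonZero r}} → Partition → ℕ
size/ r λ′ = size λ′ / r

-- |μ/λ|_r, for λ contained in μ.
skewSize/ : (r : ℕ) .{{_ : NonZero r}} (μ λ′ : Partition) → ℕ
skewSize/ r μ λ′ = (size μ ∸ size λ′) / r

Square : Set
Square = ℕ × ℕ

row col : Square → ℕ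
row = proj₁
col = proj₂

diagonal : Square → ℤ
diagonal s = col s ⊖ row s

infix 4 _∈_ _∈_∖_ _⊆_

_∈_ : Square → Partition → Set
s ∈ λ′ = col s < rowLength λ′ (row s)

_⊆_ : Rel Partition 0ℓ
λ′ ⊆ μ = ∀ s → s ∈ λ′ → s ∈ μ

_∈_∖_ : Square → Partition → Partition → Set
s ∈ μ ∖ λ′ = s ∈ μ × ¬ s ∈ λ′

record IsHead (λ′ μ : Partition) (h : Square) : Set where
  field
    inSkew    : h ∈ μ ∖ λ′
    topmost   : ∀ s → s ∈ μ ∖ λ′ → row h ≤ row s
    rightmost : ∀ s → s ∈ μ ∖ λ′ → col s ≤ col h

open IsHead public

-- The diagonals occupied are those numbered lowest, …, lowest + r - 1.
-- For r > 0 the other fields imply that a head exists, and it is unique.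
record Ribbon (r : ℕ) (λ′ μ : Partition) : Set where
  field
    contained    : λ′ ⊆ μ
    lowest       : ℤ
    onDiagonals  : ∀ s → s ∈ μ ∖ λ′ → ∃[ t ] t < r × diagonal s ≡ lowest ℤ.+ + t
    oneOnEach    : ∀ {t} → t < r →
                   ∃! _≡_ λ s → s ∈ μ ∖ λ′ × diagonal s ≡ lowest ℤ.+ + t
    head         : Square
    isHead       : IsHead λ′ μ head

open Ribbon public

-- For λ ⊆ μ, row i meets μ/λ precisely when λ_i < μ_i.
rowsMet : (λ′ μ : Partition) → ℕ
rowsMet λ′ μ =
  length (filter (λ i → rowLength λ′ i <? rowLength μ i) (upTo (length (parts μ))))

headDiagonal : ∀ {r λ′ μ} → Ribbon r λ′ μ → ℤ
headDiagonal ρ = diagonal (head ρ)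

height : ∀ {r λ′ μ} → Ribbon r λ′ μ → ℕ
height {λ′ = λ′} {μ} _ = rowsMet λ′ μ ∸ 1

headDiagonals : ∀ {r λ′ μ} → Star (Ribbon r) λ′ μ → List ℤ
headDiagonals ε       = []
headDiagonals (ρ ◅ c) = headDiagonal ρ ∷ headDiagonals c

heightSum : ∀ {r λ′ μ} → Star (Ribbon r) λ′ μ → ℕ
heightSum ε       = 0
heightSum (ρ ◅ c) = height ρ + heightSum c

Strip : Rel ℤ 0ℓ → ℕ → Rel Partition 0ℓ
Strip _∼_ r λ′ μ = Σ[ c ∈ Star (Ribbon r) λ′ μ ] Linked _∼_ (headDiagonals c)

HStrip VStrip : ℕ → Rel Partition 0ℓ
HStrip = Strip ℤ._<_
VStrip = Strip ℤ._>_

ℕ→ℚ : ℕ → ℚ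
ℕ→ℚ n = + n ℚ./ 1

spin : ∀ {r λ′ μ} → HStrip r λ′ μ → ℚ
spin (c , _) = ½ ℚ.* ℕ→ℚ (heightSum c)

spinᵗ : ∀ {r λ′ μ} → VStrip r λ′ μ → ℚ
spinᵗ (c , _) = ½ ℚ.* ℕ→ℚ (heightSum c)

Bits : ℕ → Set
Bits = Vec (Fin 2)

∣_∣ᵇ : ∀ {r} → Bits r → ℕ
∣ a ∣ᵇ = Vec.sum (Vec.map toℕ a)

n⟨_⟩ : ∀ {r} → Bits r → ℕ
n⟨ a ⟩ = Vec.sum (Vec.tabulate λ i → toℕ i * toℕ (Vec.lookup a i))

-- These setoids represent sets of partitions κ, respectively of pairs (a, λ):
-- the strips witnessing membership are ignored by the equality.
Above : ℕ → (μ ν : Partition) → Setoid 0ℓ 0ℓ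
Above r μ ν = record
  { Carrier       = Σ[ κ ∈ Partition ] VStrip r μ κ × HStrip r ν κ
  ; _≈_           = λ x y → proj₁ x ≡ proj₁ y
  ; isEquivalence = On.isEquivalence proj₁ (Setoid.isEquivalence (setoid _))
  }

Below : ℕ → (μ ν : Partition) → Setoid 0ℓ 0ℓ
Below r μ ν = record
  { Carrier       = Σ[ (_ , λ′) ∈ Bits r × Partition ] HStrip r λ′ μ × VStrip r λ′ ν
  ; _≈_           = λ x y → proj₁ x ≡ proj₁ y
  ; isEquivalence = On.isEquivalence proj₁ (Setoid.isEquivalence (setoid _))
  }

record AsymmetricShapeDatum (r : ℕ) .{{_ : NonZero r}} : Set where
  field
    bijection : ∀ μ ν → Bijection (Above r μ ν) (Below r μ ν)

  b : ∀ {μ ν} → Setoid.Carrier (Above r μ ν) → Setoid.Carrier (Below r μ ν)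
  b {μ} {ν} = Bijection.to (bijection μ ν)

  field
    weight-preserving : ∀ {μ ν} (x : Setoid.Carrier (Above r μ ν)) →
      let (κ , _) = x ; ((a , λ′) , _) = b x in
      + size/ r κ ℤ.- + size/ r ν ℤ.- + size/ r μ ℤ.+ + size/ r λ′ ≡ + ∣ a ∣ᵇ

SpinPreserving : ∀ {r} .{{_ : NonZero r}} → AsymmetricShapeDatum r → Set
SpinPreserving {r} d = ∀ {μ ν} (x : Setoid.Carrier (Above r μ ν)) →
  let (κ , κ/μ , κ/ν)          = x
      ((a , λ′) , μ/λ , ν/λ) = AsymmetricShapeDatum.b d x
  in spinᵗ κ/μ ℚ.+ spin κ/ν ≡ spin μ/λ ℚ.+ spinᵗ ν/λ ℚ.+ ℕ→ℚ n⟨ a ⟩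

-- Weakly decreasing lists of length at most m, with entries in {1, …, n}.
lists : (m n : ℕ) → List (List ℕ)
lists zero    n = [] ∷ []
lists (suc m) n =
  [] ∷ concatMap (λ k → List.map (suc k ∷_) (lists m (suc k))) (upTo n)

isPartition? : ∀ xs → Dec (Linked _≥_ xs × All (0 <_) xs)
isPartition? xs = Linked.linked? ℕ._≥?_ xs ×-dec All.all? (0 <?_) xs

fromList : List ℕ → Maybe Partition
fromList xs with isPartition? xs
... | yes (d , p) = just (mkPartition xs d p)
... | no _        = nothing

-- The partitions with diagram contained in an n × n square.
partitionsIn : ℕ → List Partition
partitionsIn n = mapMaybe fromList (lists n n)

lists-complete : ∀ {m n} xs → Linked _≥_ xs → All (0 <_) xs →
                 length xs ≤ m → entry xs 0 ≤ n → xs ∈ˡ lists m n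
lists-complete {zero}  []       _ _ _ _ = here refl
lists-complete {suc m} []       _ _ _ _ = here refl
lists-complete {suc m} {n} (suc x ∷ xs) d (_ ∷ p) (s≤s l≤m) x<n =
  there (Mem.∈-concatMap⁺ (λ k → List.map (suc k ∷_) (lists m (suc k)))
    (Any.map (λ { refl → Mem.∈-map⁺ (suc x ∷_)
                            (lists-complete xs (Linked.tail d) p l≤m (first d)) })
             (Mem.∈-upTo⁺ x<n)))
  where
  first : ∀ {x xs} → Linked _≥_ (x ∷ xs) → entry xs 0 ≤ x
  first [-]       = z≤n
  first (x≥y ∷ _) = x≥y

fromList-parts : ∀ λ′ → fromList (parts λ′) ≡ just λ′
fromList-parts λ′ with isPartition? (parts λ′)
... | yes _ = cong just (partition-≡ refl)
... | no ¬p = ⊥-elim (¬p (decreasing λ′ , positive λ′))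

length≤sum : ∀ xs → All (0 <_) xs → length xs ≤ sum xs
length≤sum []       []       = z≤n
length≤sum (_ ∷ xs) (p ∷ ps) = ℕ.+-mono-≤ p (length≤sum xs ps)

entry0≤sum : ∀ xs → entry xs 0 ≤ sum xs
entry0≤sum []       = z≤n
entry0≤sum (x ∷ xs) = ℕ.m≤m+n x _

∈-mapMaybe : ∀ {A B : Set} (f : A → Maybe B) {x y xs} →
             x ∈ˡ xs → f x ≡ just y → y ∈ˡ mapMaybe f xs
∈-mapMaybe f {xs = x ∷ xs} (here refl) eq rewrite eq = here refl
∈-mapMaybe f {xs = x ∷ xs} (there x∈) eq with f x
... | just _  = there (∈-mapMaybe f x∈ eq)
... | nothing = ∈-mapMaybe f x∈ eq

partitionsIn-complete : ∀ {n} λ′ → size λ′ ≤ n → λ′ ∈ˡ partitionsIn n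
partitionsIn-complete λ′ ≤n =
  ∈-mapMaybe fromList
    (lists-complete (parts λ′) (decreasing λ′) (positive λ′)
      (ℕ.≤-trans (length≤sum _ (positive λ′)) ≤n)
      (ℕ.≤-trans (entry0≤sum (parts λ′)) ≤n))
    (fromList-parts λ′)

lists-unique : ∀ m n → Unique (lists m n)
lists-unique zero    n = [] ∷ []
lists-unique (suc m) n =
  All.tabulate (λ {xs} xs∈ → λ { refl → []∉ xs∈ })
  ∷ Unique.concat⁺
      (All.map⁺ (All.universal
        (λ k → Unique.map⁺ List.∷-injectiveʳ (lists-unique m (suc k))) (upTo n)))
      (AllPairs.map⁺ (AllPairs.map disjoint (Unique.upTo⁺ n)))
  where
  block : ℕ → List (List ℕ)
  block k = List.map (suc k ∷_) (lists m (suc k))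

  []∉ : ¬ [] ∈ˡ concatMap block (upTo n)
  []∉ p with Any.satisfied (Mem.∈-concatMap⁻ block {xs = upTo n} p)
  ... | k , q with Mem.∈-map⁻ (suc k ∷_) q
  ... | _ , _ , ()

  disjoint : ∀ {k l} → ¬ k ≡ l → Disjoint (block k) (block l)
  disjoint {k} {l} k≢l (p , q) with Mem.∈-map⁻ (suc k ∷_) p | Mem.∈-map⁻ (suc l ∷_) q
  ... | _ , _ , refl | _ , _ , refl = k≢l refl

fromList-just : ∀ xs {λ′} → fromList xs ≡ just λ′ → parts λ′ ≡ xs
fromList-just xs eq with isPartition? xs
fromList-just xs refl | yes _ = refl

∈-mapMaybe-fromList : ∀ {λ′ xss} → λ′ ∈ˡ mapMaybe fromList xss → parts λ′ ∈ˡ xss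
∈-mapMaybe-fromList {xss = xs ∷ xss} p with fromList xs in eq
∈-mapMaybe-fromList (here refl) | just _ = here (fromList-just _ eq)
∈-mapMaybe-fromList (there p)   | just _ = there (∈-mapMaybe-fromList p)
... | nothing = there (∈-mapMaybe-fromList p)

mapMaybe-fromList-unique : ∀ {xss} → Unique xss → Unique (mapMaybe fromList xss)
mapMaybe-fromList-unique []                    = []
mapMaybe-fromList-unique {xs ∷ xss} (xs∉ ∷ u) with fromList xs in eq
... | nothing = mapMaybe-fromList-unique u
... | just _  =
  All.tabulate (λ p → λ { refl →
    All.lookup xs∉ (∈-mapMaybe-fromList p) (sym (fromList-just xs eq)) })
  ∷ mapMaybe-fromList-unique u

partitionsIn-unique : ∀ n → Unique (partitionsIn n)
partitionsIn-unique n = mapMaybe-fromList-unique (lists-unique n n)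

row<length : ∀ xs {i j} → j < entry xs i → i < length xs
row<length (x ∷ xs) {zero}  _ = s≤s z≤n
row<length (x ∷ xs) {suc i} p = s≤s (row<length xs p)

∀-squares? : ∀ μ {Q : Square → Set} → (∀ s → Dec (Q s)) → Dec (∀ s → s ∈ μ → Q s)
∀-squares? μ Q? = map′
  (λ f s s∈ → f (row<length (parts μ) s∈) s∈) (λ f {i} _ {j} j< → f (i , j) j<)
  (ℕ.allUpTo? (λ i → ℕ.allUpTo? (λ j → Q? (i , j)) (rowLength μ i)) (length (parts μ)))

∃-squares? : ∀ μ {Q : Square → Set} → (∀ s → Dec (Q s)) → Dec (∃[ s ] s ∈ μ × Q s)
∃-squares? μ Q? = map′
  (λ { (i , _ , j , j< , q) → (i , j) , j< , q })
  (λ { ((i , j) , j< , q) → i , row<length (parts μ) j< , j , j< , q })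
  (ℕ.anyUpTo? (λ i → ℕ.anyUpTo? (λ j → Q? (i , j)) (rowLength μ i)) (length (parts μ)))

_∈?_ : ∀ s λ′ → Dec (s ∈ λ′)
s ∈? λ′ = col s <? rowLength λ′ (row s)

module _ (λ′ μ : Partition) where

  ∀-skew? : ∀ {Q : Square → Set} → (∀ s → Dec (Q s)) → Dec (∀ s → s ∈ μ ∖ λ′ → Q s)
  ∀-skew? Q? = map′ (λ f s (s∈ , s∉) → f s s∈ s∉) (λ f s s∈ s∉ → f s (s∈ , s∉))
    (∀-squares? μ λ s → ¬? (s ∈? λ′) →-dec Q? s)

  ∃-skew? : ∀ {Q : Square → Set} → (∀ s → Dec (Q s)) → Dec (∃[ s ] s ∈ μ ∖ λ′ × Q s)
  ∃-skew? Q? = map′ (λ { (s , s∈ , s∉ , q) → s , (s∈ , s∉) , q })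
                    (λ { (s , (s∈ , s∉) , q) → s , s∈ , s∉ , q })
    (∃-squares? μ λ s → ¬? (s ∈? λ′) ×-dec Q? s)

  ∃!-skew? : ∀ {Q : Square → Set} → (∀ s → Dec (Q s)) →
             Dec (∃! _≡_ λ s → s ∈ μ ∖ λ′ × Q s)
  ∃!-skew? Q? = map′
    (λ { (s , s∈ , q , u) → s , (s∈ , q) , λ { {s₁} (s₁∈ , q₁) → u s₁ s₁∈ q₁ } })
    (λ { (s , (s∈ , q) , u) → s , s∈ , q , λ s₁ s₁∈ q₁ → u (s₁∈ , q₁) })
    (∃-skew? λ s → Q? s ×-dec ∀-skew? λ s₁ → Q? s₁ →-dec s ≟ˢ s₁)
    where
    _≟ˢ_ : DecidableEquality Square
    (i , j) ≟ˢ (i₁ , j₁) = map′ (λ { (refl , refl) → refl }) (λ { refl → refl , refl })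
                             (i ≟ i₁ ×-dec j ≟ j₁)

  ribbon? : ∀ r .{{_ : NonZero r}} → Dec (Ribbon r λ′ μ)
  ribbon? r = map′ from to
    (∀-squares? λ′ (_∈? μ)
     ×-dec (∃-skew? λ s₀ →
              (∀-skew? λ s → ℕ.anyUpTo? (λ t → diagonal s ℤ.≟ diagonal s₀ ℤ.+ + t) r)
              ×-dec ℕ.allUpTo? (λ t → ∃!-skew? λ s → diagonal s ℤ.≟ diagonal s₀ ℤ.+ + t) r)
     ×-dec (∃-skew? λ h → ∀-skew? (λ s → row h ℕ.≤? row s)
                          ×-dec ∀-skew? (λ s → col s ℕ.≤? col h)))
    where
    Occupied : ℤ → Set
    Occupied k = (∀ s → s ∈ μ ∖ λ′ → ∃[ t ] t < r × diagonal s ≡ k ℤ.+ + t)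
               × (∀ {t} → t < r → ∃! _≡_ λ s → s ∈ μ ∖ λ′ × diagonal s ≡ k ℤ.+ + t)

    Criterion : Set
    Criterion = λ′ ⊆ μ
              × (∃[ s ] s ∈ μ ∖ λ′ × Occupied (diagonal s))
              × (∃[ h ] h ∈ μ ∖ λ′ × (∀ s → s ∈ μ ∖ λ′ → row h ≤ row s)
                                   × (∀ s → s ∈ μ ∖ λ′ → col s ≤ col h))

    from : Criterion → Ribbon r λ′ μ
    from (c , (s , _ , on , one) , (h , h∈ , t , rt)) = record
      { contained = c ; lowest = diagonal s ; onDiagonals = on ; oneOnEach = one
      ; head = h ; isHead = record { inSkew = h∈ ; topmost = t ; rightmost = rt } }

    to : Ribbon r λ′ μ → Criterion
    to ρ with oneOnEach ρ (>-nonZero⁻¹ r)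
    ... | s , (s∈ , eq) , _ =
      contained ρ
      , (s , s∈ , subst Occupied {x = lowest ρ} (sym (trans eq (ℤ.+-identityʳ _)))
                                 (onDiagonals ρ , oneOnEach ρ))
      , (head ρ , inSkew (isHead ρ) , topmost (isHead ρ) , rightmost (isHead ρ))

headDiagonal-unique : ∀ {r λ′ μ} (ρ σ : Ribbon r λ′ μ) → headDiagonal ρ ≡ headDiagonal σ
headDiagonal-unique ρ σ = cong diagonal (cong₂ _,_
  (ℕ.≤-antisym (topmost (isHead ρ) _ (inSkew (isHead σ)))
               (topmost (isHead σ) _ (inSkew (isHead ρ))))
  (ℕ.≤-antisym (rightmost (isHead σ) _ (inSkew (isHead ρ)))
               (rightmost (isHead ρ) _ (inSkew (isHead σ)))))

sum-mono : ∀ xs ys → (∀ i → entry xs i ≤ entry ys i) → sum xs ≤ sum ys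
sum-mono []       ys       _ = z≤n
sum-mono (x ∷ xs) []       f = ℕ.+-mono-≤ (f 0) (sum-mono xs [] (f ∘ suc))
sum-mono (x ∷ xs) (y ∷ ys) f = ℕ.+-mono-≤ (f 0) (sum-mono xs ys (f ∘ suc))

sum-mono-< : ∀ xs ys → (∀ i → entry xs i ≤ entry ys i) →
             ∀ i → entry xs i < entry ys i → sum xs < sum ys
sum-mono-< []       (y ∷ ys) f zero    p = ℕ.≤-trans p (ℕ.m≤m+n y _)
sum-mono-< []       (y ∷ ys) f (suc i) p =
  ℕ.≤-trans (sum-mono-< [] ys (f ∘ suc) i p) (ℕ.m≤n+m _ y)
sum-mono-< (x ∷ xs) (y ∷ ys) f zero    p = ℕ.+-mono-<-≤ p (sum-mono xs ys (f ∘ suc))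
sum-mono-< (x ∷ xs) (y ∷ ys) f (suc i) p =
  ℕ.+-mono-≤-< (f 0) (sum-mono-< xs ys (f ∘ suc) i p)

ribbon-size : ∀ {r λ′ μ} → Ribbon r λ′ μ → size λ′ < size μ
ribbon-size {λ′ = λ′} {μ} ρ with inSkew (isHead ρ)
... | h∈ , h∉ = sum-mono-< (parts λ′) (parts μ)
  (λ i → ℕ.≮⇒≥ λ μᵢ<λᵢ → ℕ.<-irrefl refl (contained ρ (i , rowLength μ i) μᵢ<λᵢ))
  (row (head ρ)) (ℕ.≤-<-trans (ℕ.≮⇒≥ h∉) h∈)

chain-size : ∀ {r λ′ μ} → Star (Ribbon r) λ′ μ → size λ′ ≤ size μ
chain-size ε       = ℕ.≤-refl
chain-size (ρ ◅ c) = ℕ.≤-trans (ℕ.<⇒≤ (ribbon-size ρ)) (chain-size c)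

module _ {_∼_ : Rel ℤ 0ℓ} (_∼?_ : Decidable _∼_) (r : ℕ) .{{_ : NonZero r}} where

  StripFrom : ℤ → Rel Partition 0ℓ
  StripFrom k λ′ μ = Σ[ c ∈ Star (Ribbon r) λ′ μ ] Linked _∼_ (k ∷ headDiagonals c)

  NonTrivial : (ℤ → Set) → Rel Partition 0ℓ
  NonTrivial Q λ′ μ = ∃[ λ₁ ] Σ[ ρ ∈ Ribbon r λ′ λ₁ ]
    Q (headDiagonal ρ) × StripFrom (headDiagonal ρ) λ₁ μ

  nonTrivial? : ∀ {Q} → (∀ k → Dec (Q k)) → ∀ λ′ μ →
                (∀ {λ₁} (ρ : Ribbon r λ′ λ₁) → Dec (StripFrom (headDiagonal ρ) λ₁ μ)) →
                Dec (NonTrivial Q λ′ μ)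
  nonTrivial? {Q} Q? λ′ μ rest? = map′ Any.satisfied
    (λ { (λ₁ , ρ , q , c , l) →
         Any.map (λ { refl → ρ , q , c , l }) (partitionsIn-complete λ₁ (chain-size c)) })
    (Any.any? first? (partitionsIn (size μ)))
    where
    first? : ∀ λ₁ → Dec (Σ[ ρ ∈ Ribbon r λ′ λ₁ ]
                           Q (headDiagonal ρ) × StripFrom (headDiagonal ρ) λ₁ μ)
    first? λ₁ with ribbon? λ′ λ₁ r
    ... | no ¬ρ = no (¬ρ ∘ proj₁)
    ... | yes ρ = map′ (ρ ,_)
      (λ { (σ , x) → subst (λ k → Q k × StripFrom k λ₁ μ) (headDiagonal-unique σ ρ) x })
      (Q? (headDiagonal ρ) ×-dec rest? ρ)

  stripFrom? : ∀ fuel k λ′ μ → size μ < fuel + size λ′ → Dec (StripFrom k λ′ μ)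
  stripFrom? zero k λ′ μ bound = no λ { (c , _) → ℕ.<⇒≱ bound (chain-size c) }
  stripFrom? (suc f) k λ′ μ bound with λ′ ≟ᴾ μ
  ... | yes refl = yes (ε , [-])
  ... | no λ≢μ = map′
    (λ { (_ , ρ , q , c , l) → ρ ◅ c , q ∷ l })
    (λ { (ε , _) → ⊥-elim (λ≢μ refl) ; (ρ ◅ c , q ∷ l) → _ , ρ , q , c , l })
    (nonTrivial? (k ∼?_) λ′ μ λ {λ₁} ρ → stripFrom? f (headDiagonal ρ) λ₁ μ
      (ℕ.<-≤-trans bound (ℕ.≤-trans (ℕ.≤-reflexive (sym (ℕ.+-suc f _)))
                                     (ℕ.+-monoʳ-≤ f (ribbon-size ρ)))))

  strip? : Decidable (Strip _∼_ r)
  strip? λ′ μ with λ′ ≟ᴾ μ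
  ... | yes refl = yes (ε , [])
  ... | no λ≢μ = map′
    (λ { (_ , ρ , _ , c , l) → ρ ◅ c , l })
    (λ { (ε , _) → ⊥-elim (λ≢μ refl) ; (ρ ◅ c , l) → _ , ρ , tt , c , l })
    (nonTrivial? {Q = λ _ → ⊤} (λ _ → yes tt) λ′ μ λ {λ₁} ρ → stripFrom? (suc (size μ)) (headDiagonal ρ) λ₁ μ (s≤s (ℕ.m≤m+n _ _)))

hstrip? : ∀ r .{{_ : NonZero r}} → Decidable (HStrip r)
hstrip? = strip? ℤ._<?_

vstrip? : ∀ r .{{_ : NonZero r}} → Decidable (VStrip r)
vstrip? = strip? (λ i j → j ℤ.<? i)

-- Coefficient lists in the variable q^½, constant term first; trailing zeros
-- are allowed, so equality is that of coefficients.
Poly : Set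
Poly = List ℤ

coeff : Poly → ℕ → ℤ
coeff []      _       = + 0
coeff (a ∷ _) zero    = a
coeff (_ ∷ p) (suc n) = coeff p n

infix 4 _≈ᴾ_

_≈ᴾ_ : Rel Poly 0ℓ
p ≈ᴾ p′ = ∀ n → coeff p n ≡ coeff p′ n

infixl 6 _+ᴾ_
infixl 7 _*ᴾ_

_+ᴾ_ : Poly → Poly → Poly
[]      +ᴾ p′       = p′
(a ∷ p) +ᴾ []       = a ∷ p
(a ∷ p) +ᴾ (b ∷ p′) = a ℤ.+ b ∷ p +ᴾ p′

_*ᴾ_ : Poly → Poly → Poly
[]      *ᴾ p′ = []
(a ∷ p) *ᴾ p′ = List.map (a ℤ.*_) p′ +ᴾ (+ 0 ∷ p *ᴾ p′)

0ᴾ 1ᴾ : Poly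
0ᴾ = []
1ᴾ = + 1 ∷ []

q½^_ : ℕ → Poly
q½^ zero  = 1ᴾ
q½^ suc n = + 0 ∷ q½^ n

-- Formal linear combinations of partitions; a partition may occur repeatedly,
-- so equality is that of total coefficients.
Module : Set
Module = List (Poly × Partition)

coefficient : Partition → Module → Poly
coefficient μ []            = 0ᴾ
coefficient μ ((p , ν) ∷ v) with μ ≟ᴾ ν
... | yes _ = p +ᴾ coefficient μ v
... | no  _ = coefficient μ v

infix 4 _≈ᴹ_

_≈ᴹ_ : Rel Module 0ℓ
v ≈ᴹ w = ∀ μ → coefficient μ v ≈ᴾ coefficient μ w

infixr 7 _•_

_•_ : Poly → Module → Module
p • v = List.map (λ (p′ , μ) → p *ᴾ p′ , μ) v

-- An endomorphism of a free module amounts to an arbitrary choice of images of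
-- the basis vectors; extend is the linear map that such a choice determines.
End : Set
End = Partition → Module

extend : End → Module → Module
extend f = concatMap λ (p , μ) → p • f μ

_∘ᴱ_ _+ᴱ_ : End → End → End
(f ∘ᴱ g) μ = extend f (g μ)
(f +ᴱ g) μ = f μ ++ g μ

0ᴱ : End
0ᴱ _ = []

_•ᴱ_ : Poly → End → End
(p •ᴱ f) μ = p • f μ

-- F m n is the coefficient of X^m Y^n.
Series : Set → Set
Series A = ℕ → ℕ → A

module _ {A B C : Set} (_+_ : C → C → C) (0# : C) (_*_ : A → B → C) where

  convolve : Series A → Series B → Series C
  convolve F G m n =
    foldr _+_ 0# (concatMap (λ i → List.map (λ j → F i j * G (m ∸ i) (n ∸ j))
                                            (upTo (suc n)))
                            (upTo (suc m)))

infix  4 _≈ˢ_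
infixl 7 _·ˢ_
infixr 9 _∘ˢ_

_∘ˢ_ : Series End → Series End → Series End
_∘ˢ_ = convolve _+ᴱ_ 0ᴱ _∘ᴱ_

_*ˢ_ : Series Poly → Series Poly → Series Poly
_*ˢ_ = convolve _+ᴾ_ 0ᴾ _*ᴾ_

_·ˢ_ : Series End → Series Poly → Series End
_·ˢ_ = convolve _+ᴱ_ 0ᴱ (λ f p → p •ᴱ f)

_≈ˢ_ : Rel (Series End) 0ℓ
F ≈ˢ G = ∀ m n μ → F m n μ ≈ᴹ G m n μ

1ˢ : Series Poly
1ˢ zero zero = 1ᴾ
1ˢ _    _    = 0ᴾ

1+q^_XY : ℕ → Series Poly
(1+q^ i XY) zero       zero       = 1ᴾ
(1+q^ i XY) (suc zero) (suc zero) = q½^ (2 * i)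
(1+q^ i XY) _          _          = 0ᴾ

∏[i<_]1+q^iXY : ℕ → Series Poly
∏[i< r ]1+q^iXY = foldr _*ˢ_ 1ˢ (List.map 1+q^_XY (upTo r))

-- As spin is half of heightSum, q^spin is (q^½)^heightSum.  The chain defining a
-- strip (its standardisation) is unique, so it does not matter which is found.
q^spin : ∀ {_∼_ r λ′ μ} → Dec (Strip _∼_ r λ′ μ) → Poly
q^spin (yes (c , _)) = q½^ heightSum c
q^spin (no _)        = 0ᴾ

-- If λ ⇀ μ is a strip of m ribbons then |μ| = |λ| + r m, so the enumerations
-- below contain every partition that contributes to the sums.
U : (r : ℕ) .{{_ : NonZero r}} → Series End
U r m (suc _) λ′ = []
U r m zero    λ′ =
  List.map (λ μ → q^spin (hstrip? r λ′ μ) , μ)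
           (filter (λ μ → skewSize/ r μ λ′ ≟ m) (partitionsIn (size λ′ + r * m)))

D̃ : (r : ℕ) .{{_ : NonZero r}} → Series End
D̃ r (suc _) n λ′ = []
D̃ r zero    n λ′ =
  List.map (λ μ → q^spin (vstrip? r μ λ′) , μ)
           (filter (λ μ → skewSize/ r λ′ μ ≟ n) (partitionsIn (size λ′)))

{-# OPTIONS --safe #-}

-- Read a partition as its edge sequence, with a bead at every vertical edge.  Adding
-- an r-ribbon moves a bead from some p to p + r, and the height is the number of
-- beads jumped over.  Let M and N be the edge sequences of μ and ν, and suppose that
-- the vertical strip κ/μ moves beads from the positions in S, and the horizontal
-- strip κ/ν from those in T.  Then v = M - S + T is again an edge sequence, it depends
-- on μ and ν only, and the sum of all heights is the sum over S and over T of
-- h(p) = v(p + 1) + … + v(p + r - 1); the same v and h serve for the strips ν/λ, μ/λ.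
-- For given μ and ν just S ∩ T is free: it is an arbitrary subset of the descents
-- (v(p) = 1, v(p + r) = 0) for κ, and of the ascents (v(p) = 0, v(p + r) = 1) for λ.
-- The number of beads of v in r consecutive positions falls from r to 0; it goes down
-- from h(p) + 1 to h(p) at descents and up from h(p) to h(p) + 1 at ascents.  Matching
-- each ascent with the next descent between the same two levels leaves over the first
-- descent to each of the levels 0, …, r - 1, and the bits there form a.

module Submission where

import Algebra.Properties.CommutativeSemigroup as CommutativeSemigroup
open import Defs
open import Data.Empty using (⊥-elim)
open import Data.Fin using (Fin; toℕ) renaming (zero to 0F; suc to sucF)
import Data.Fin.Properties as Fin
open import Data.Integer as ℤ using (ℤ; _⊖_) renaming (+_ to pos)
import Data.Integer.Properties as ℤ
open import Data.Integer.Tactic.RingSolver using () renaming (solve-∀ to ℤ-solve-∀)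
open import Data.List as List
  using (List; []; _∷_; _++_; length; foldr; concatMap; map; filter; upTo; applyUpTo; cartesianProduct)
import Data.List.Properties as List
open import Data.List.Membership.Propositional using () renaming (_∈_ to _∈ˡ_; _∉_ to _∉ˡ_)
import Data.List.Membership.Propositional.Properties as Mem
open import Data.List.Relation.Unary.All as All using (All; []; _∷_)
import Data.List.Relation.Unary.All.Properties as All
open import Data.List.Relation.Unary.AllPairs using ([]; _∷_)
open import Data.List.Relation.Unary.Any using (here; there)
open import Data.List.Relation.Unary.Linked as Linked using (Linked; []; [-]; _∷_)
open import Data.List.Relation.Unary.Unique.Propositional using (Unique)
import Data.List.Relation.Unary.Unique.Propositional.Properties as Unique
open import Data.Nat
open import Data.Nat.Divisibility using (m∣m*n)
open import Data.Nat.DivMod using (+-distrib-/-∣ʳ; m*n/n≡m)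
open import Data.Nat.Induction using (<-rec)
open import Data.Nat.ListAction using (sum)
open import Data.Nat.Properties
open import Data.Nat.Tactic.RingSolver using (solve-∀)
open import Data.Product as Product using (_×_; _,_; proj₁; proj₂; ∃-syntax; Σ-syntax)
open import Data.Rational as ℚ using (½)
import Data.Rational.Properties as ℚ
open import Data.Rational.Unnormalised as ℚᵘ using (mkℚᵘ; *≡*)
import Data.Rational.Unnormalised.Properties as ℚᵘ
open import Data.Sum as Sum using (_⊎_; inj₁; inj₂)
open import Data.Vec as Vec using ([]; _∷_)
import Data.Vec.Properties as Vec
open import Function using (_∘_)
open import Level using (0ℓ)
open import Relation.Binary using (Rel; Setoid; DecidableEquality; tri<; tri≈; tri>)
open import Relation.Binary.Construct.Closure.ReflexiveTransitive using (Star; ε; _◅_)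
open import Relation.Binary.PropositionalEquality hiding ([_])
open import Relation.Nullary using (¬_; Dec; yes; no)

open CommutativeSemigroup +-commutativeSemigroup
  using (interchange; x∙yz≈xz∙y; x∙yz≈yx∙z; x∙yz≈zy∙x; xy∙z≈x∙zy; xy∙z≈xz∙y; xy∙z≈zy∙x)
module ℤ+ = CommutativeSemigroup ℤ.+-commutativeSemigroup

-- With D = S - T one has M = v + D, and tracing the beads back to ν gives N = v + (D translated by
-- r). So M - N is D minus its translate, which determines D because 1 - x^r is not a zero divisor.
-- For the heights, the vertical strip jumps over the beads of v - T, the horizontal one over those
-- of v plus the translate of S; the two corrections to v count the same pairs of positions and
-- cancel. A bit at a descent p puts p into both S and T, so it adds 2h(p) to the heights and h(p)
-- to the spin; a bit left over at level i thus accounts for the summand i of n(a). The matching is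
-- never constructed. A scan carries one register per level, and its rule at a position is symmetric
-- under exchanging left with right and κ with λ. Hence one local analysis serves both maps,
-- determinism of the scan in both directions makes them inverse, and any weight that depends on the
-- level only is conserved. Sequences take values in ℕ, so identities are written without
-- subtraction wherever possible. Positions start at 0, so enough beads are needed for the first r
-- positions to be beads of v.

-- Reduces a linear consequence of equations in ℕ to a semiring identity.
cancel : ∀ {a b} x y → a ≡ b → x + b ≡ y + a → x ≡ y
cancel {a} x y refl e = +-cancelʳ-≡ a x y e

+-absorb : ∀ m {n} → n ≡ 0 → m + n ≡ m
+-absorb m refl = +-identityʳ m

-- Finite sums, shifts and windows of sequences

∑ : ℕ → (ℕ → ℕ) → ℕ
∑ zero    f = 0
∑ (suc n) f = ∑ n f + f n

∑-cong : ∀ n {f g} → (∀ i → i < n → f i ≡ g i) → ∑ n f ≡ ∑ n g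
∑-cong zero    e = refl
∑-cong (suc n) e = cong₂ _+_ (∑-cong n λ i i<n → e i (m<n⇒m<1+n i<n)) (e n ≤-refl)

∑-zero : ∀ n {f} → (∀ i → i < n → f i ≡ 0) → ∑ n f ≡ 0
∑-zero zero    e = refl
∑-zero (suc n) e rewrite ∑-zero n (λ i i<n → e i (m<n⇒m<1+n i<n)) = e n ≤-refl

∑-+ : ∀ n f g → ∑ n (λ i → f i + g i) ≡ ∑ n f + ∑ n g
∑-+ zero    f g = refl
∑-+ (suc n) f g rewrite ∑-+ n f g = interchange (∑ n f) (∑ n g) (f n) (g n)

∑-const : ∀ n c → ∑ n (λ _ → c) ≡ n * c
∑-const zero    c = refl
∑-const (suc n) c rewrite ∑-const n c = +-comm (n * c) c

∑-*ˡ : ∀ n k f → ∑ n (λ i → k * f i) ≡ k * ∑ n f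
∑-*ˡ zero    k f = sym (*-zeroʳ k)
∑-*ˡ (suc n) k f rewrite ∑-*ˡ n k f = sym (*-distribˡ-+ k (∑ n f) (f n))

∑-*ʳ : ∀ n k f → ∑ n (λ i → f i * k) ≡ ∑ n f * k
∑-*ʳ zero    k f = refl
∑-*ʳ (suc n) k f rewrite ∑-*ʳ n k f = sym (*-distribʳ-+ k (∑ n f) (f n))

∑-front : ∀ n f → ∑ (suc n) f ≡ f 0 + ∑ n (f ∘ suc)
∑-front zero    f = sym (+-identityʳ (f 0))
∑-front (suc n) f rewrite ∑-front n f = +-assoc (f 0) _ _

∑-swap : ∀ m n (f : ℕ → ℕ → ℕ) → ∑ m (λ i → ∑ n (f i)) ≡ ∑ n (λ j → ∑ m (λ i → f i j))
∑-swap zero    n f = sym (∑-zero n λ _ _ → refl)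
∑-swap (suc m) n f rewrite ∑-swap m n f = sym (∑-+ n _ _)

-- Reflection of the index; the relation suc (i + j) ≡ n between an index and its mirror image
-- avoids truncated subtraction.
∑-reverse : ∀ n f g → (∀ i j → suc (i + j) ≡ n → f i ≡ g j) → ∑ n f ≡ ∑ n g
∑-reverse zero    f g e = refl
∑-reverse (suc n) f g e = begin
  ∑ n f + f n              ≡⟨ cong₂ _+_ (∑-reverse n f (g ∘ suc) λ i j p → e i (suc j) (cong suc (trans (+-suc i j) p)))
                                        (e n 0 (cong suc (+-identityʳ n))) ⟩
  ∑ n (g ∘ suc) + g 0      ≡⟨ +-comm _ (g 0) ⟩
  g 0 + ∑ n (g ∘ suc)      ≡⟨ ∑-front n g ⟨
  ∑ (suc n) g              ∎
  where open ≡-Reasoning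

∑-split : ∀ m k f → ∑ (k + m) f ≡ ∑ m f + ∑ k (λ i → f (i + m))
∑-split m zero    f = sym (+-identityʳ _)
∑-split m (suc k) f rewrite ∑-split m k f = +-assoc (∑ m f) _ _

∑-mono : ∀ f {m n} → m ≤ n → ∑ m f ≤ ∑ n f
∑-mono f {m} {n} m≤n = begin
  ∑ m f                                ≤⟨ m≤m+n _ _ ⟩
  ∑ m f + ∑ (n ∸ m) (λ i → f (i + m))  ≡⟨ ∑-split m (n ∸ m) f ⟨
  ∑ (n ∸ m + m) f                      ≡⟨ cong (λ x → ∑ x f) (m∸n+n≡m m≤n) ⟩
  ∑ n f                                ∎
  where open ≤-Reasoning

VanishesFrom : ℕ → (ℕ → ℕ) → Set
VanishesFrom P f = ∀ p → P ≤ p → f p ≡ 0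

vanishesFrom-≤ : ∀ {P Q f} → P ≤ Q → VanishesFrom P f → VanishesFrom Q f
vanishesFrom-≤ P≤Q z p Q≤p = z p (≤-trans P≤Q Q≤p)

∑-extend : ∀ {P f} k → VanishesFrom P f → ∑ (k + P) f ≡ ∑ P f
∑-extend {P} {f} k z rewrite ∑-split P k f | ∑-zero k {λ i → f (i + P)} (λ i _ → z (i + P) (m≤n+m P i)) = +-identityʳ _

Bit : ℕ → Set
Bit b = b ≤ 1

δ : ℕ → ℕ → ℕ
δ zero    zero    = 1
δ zero    (suc _) = 0
δ (suc _) zero    = 0
δ (suc p) (suc q) = δ p q

δ-refl : ∀ p → δ p p ≡ 1
δ-refl zero    = refl
δ-refl (suc p) = δ-refl p

δ-≢ : ∀ {p q} → p ≢ q → δ p q ≡ 0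
δ-≢ {zero}  {zero}  p≢q = ⊥-elim (p≢q refl)
δ-≢ {zero}  {suc q} p≢q = refl
δ-≢ {suc p} {zero}  p≢q = refl
δ-≢ {suc p} {suc q} p≢q = δ-≢ (p≢q ∘ cong suc)

δ-bit : ∀ p q → Bit (δ p q)
δ-bit zero    zero    = ≤-refl
δ-bit zero    (suc q) = z≤n
δ-bit (suc p) zero    = z≤n
δ-bit (suc p) (suc q) = δ-bit p q

∑-δ-≤ : ∀ {p} Q → Q ≤ p → (f : ℕ → ℕ) → ∑ Q (λ q → δ p q * f q) ≡ 0
∑-δ-≤ {p} Q Q≤p f = ∑-zero Q λ q q<Q → cong (_* f q) (δ-≢ {p} {q} λ { refl → <-irrefl refl (<-≤-trans q<Q Q≤p) })

∑-δ : ∀ {p} Q → p < Q → (f : ℕ → ℕ) → ∑ Q (λ q → δ p q * f q) ≡ f p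
∑-δ {p} (suc Q) p<Q f with p ≟ Q
... | yes refl rewrite ∑-δ-≤ p ≤-refl f | δ-refl p = +-identityʳ (f p)
... | no p≢Q rewrite δ-≢ p≢Q | ∑-δ Q (≤∧≢⇒< (s≤s⁻¹ p<Q) p≢Q) f = +-identityʳ (f p)

∑δ-≤ : ∀ {p} Q → Q ≤ p → ∑ Q (δ p) ≡ 0
∑δ-≤ {p} Q Q≤p = trans (∑-cong Q λ q _ → sym (*-identityʳ (δ p q))) (∑-δ-≤ Q Q≤p λ _ → 1)

∑δ-> : ∀ {p} Q → p < Q → ∑ Q (δ p) ≡ 1
∑δ-> {p} Q p<Q = trans (∑-cong Q λ q _ → sym (*-identityʳ (δ p q))) (∑-δ Q p<Q λ _ → 1)

-- On generating functions this is multiplication by x^r: beads at `f` become beads r places further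
-- right.
shift : ℕ → (ℕ → ℕ) → ℕ → ℕ
shift zero    f p       = f p
shift (suc r) f zero    = 0
shift (suc r) f (suc p) = shift r f p

shift-below : ∀ r f {p} → p < r → shift r f p ≡ 0
shift-below (suc r) f {zero}  _   = refl
shift-below (suc r) f {suc p} p<r = shift-below r f (s≤s⁻¹ p<r)

shift-above : ∀ r f p → shift r f (r + p) ≡ f p
shift-above zero    f p = refl
shift-above (suc r) f p = shift-above r f p

shift-cancel : ∀ a b f p → shift (a + b) f (a + p) ≡ shift b f p
shift-cancel zero    b f p = refl
shift-cancel (suc a) b f p = shift-cancel a b f p

shift-δ : ∀ r p q → shift r (δ p) q ≡ δ (r + p) q
shift-δ zero    p q       = refl
shift-δ (suc r) p zero    = refl
shift-δ (suc r) p (suc q) = shift-δ r p q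

shift-+ : ∀ r f g p → shift r (λ q → f q + g q) p ≡ shift r f p + shift r g p
shift-+ zero    f g p       = refl
shift-+ (suc r) f g zero    = refl
shift-+ (suc r) f g (suc p) = shift-+ r f g p

shift-cong : ∀ r {f g} → (∀ p → f p ≡ g p) → ∀ p → shift r f p ≡ shift r g p
shift-cong zero    e p       = e p
shift-cong (suc r) e zero    = refl
shift-cong (suc r) e (suc p) = shift-cong r e p

shift-cong-< : ∀ r {f g} p → (∀ q → r + q ≤ p → f q ≡ g q) → shift r f p ≡ shift r g p
shift-cong-< zero    p       e = e p ≤-refl
shift-cong-< (suc r) zero    e = refl
shift-cong-< (suc r) (suc p) e = shift-cong-< r p λ q q≤p → e q (s≤s q≤p)

shift-elim : ∀ r f p {ℓ} (A : ℕ → Set ℓ) → (p < r → A 0) → (∀ q → r + q ≡ p → A (f q)) → A (shift r f p)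
shift-elim zero    f p       A z s = s p refl
shift-elim (suc r) f zero    A z s = z (s≤s z≤n)
shift-elim (suc r) f (suc p) A z s = shift-elim r f p A (z ∘ s≤s) (λ q e → s q (cong suc e))

∑-shift : ∀ r n f → ∑ (r + n) (shift r f) ≡ ∑ n f
∑-shift zero    n f = refl
∑-shift (suc r) n f = trans (∑-front (r + n) (shift (suc r) f)) (∑-shift r n f)

-- Shifting is adjoint to translating the other factor. Extending the range to k + P costs nothing
-- since `f` vanishes there, and peeling off the first k terms then leaves exactly P of them.
∑-*-shift : ∀ k P f g → VanishesFrom P f → ∑ P (λ p → f p * shift k g p) ≡ ∑ P (λ p → f (k + p) * g p)
∑-*-shift k P f g z = trans (sym (∑-extend k λ p P≤p → cong (_* shift k g p) (z p P≤p))) (go k f)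
  where
  go : ∀ k (f : ℕ → ℕ) → ∑ (k + P) (λ p → f p * shift k g p) ≡ ∑ P (λ p → f (k + p) * g p)
  go zero    f = refl
  go (suc k) f rewrite ∑-front (k + P) (λ p → f p * shift (suc k) g p) | *-zeroʳ (f 0) = go k (f ∘ suc)

-- The hypothesis says (1 - x^r)(f - g) = 0. Since r > 0, a shifted value depends on smaller
-- positions only, so strong induction applies.
shift-unique : ∀ r (f g : ℕ → ℕ) → 0 < r → (∀ p → f p + shift r g p ≡ g p + shift r f p) → ∀ p → f p ≡ g p
shift-unique r f g 0<r e = <-rec (λ p → f p ≡ g p) λ p rec →
  cancel (f p) (g p)
    (trans (e p) (cong (g p +_) (shift-cong-< r p λ q r+q≤p → rec (<-≤-trans (+-monoˡ-< q 0<r) r+q≤p))))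
    (trans (sym (+-assoc (f p) (g p) _)) (trans (cong (_+ shift r g p) (+-comm (f p) (g p))) (+-assoc (g p) _ _)))

-- With r = r′ + 1, the sum over the positions strictly between p and p + r.
window : ℕ → (ℕ → ℕ) → ℕ → ℕ
window r′ g p = ∑ r′ (λ j → g (suc j + p))

-- The total height when beads leave the positions `f`, each moving by r and jumping over the beads
-- counted by `g`.
pairing : ℕ → ℕ → (ℕ → ℕ) → (ℕ → ℕ) → ℕ
pairing r′ P f g = ∑ P (λ p → f p * window r′ g p)

window-cong : ∀ r′ {f g} p → (∀ q → p < q → q ≤ r′ + p → f q ≡ g q) → window r′ f p ≡ window r′ g p
window-cong r′ p e = ∑-cong r′ λ j j<r′ → e (suc j + p) (s≤s (m≤n+m p j)) (+-monoˡ-≤ p j<r′)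

window-+ : ∀ r′ f g p → window r′ (λ q → f q + g q) p ≡ window r′ f p + window r′ g p
window-+ r′ f g p = ∑-+ r′ (λ j → f (suc j + p)) (λ j → g (suc j + p))

-- Both sides sum over the r positions p + 1, ..., p + r. This governs how the level changes from
-- one position to the next.
window-shift : ∀ r′ f p → window r′ f p + f (suc r′ + p) ≡ f (suc p) + window r′ f (suc p)
window-shift r′ f p = trans (∑-front r′ (λ j → f (suc j + p)))
  (cong (f (suc p) +_) (∑-cong r′ λ j _ → cong f (sym (cong suc (+-suc j p)))))

window-bound : ∀ r′ f p → (∀ q → Bit (f q)) → window r′ f p ≤ r′
window-bound zero     f p b = z≤n
window-bound (suc r′) f p b =
  ≤-trans (+-mono-≤ (window-bound r′ f p b) (b (suc r′ + p))) (≤-reflexive (+-comm r′ 1))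

pairing-congʳ : ∀ r′ P {f g h} → (∀ p → g p ≡ h p) → pairing r′ P f g ≡ pairing r′ P f h
pairing-congʳ r′ P {f} e = ∑-cong P λ p _ → cong (f p *_) (window-cong r′ p λ q _ _ → e q)

pairing-+ʳ : ∀ r′ P f g h → pairing r′ P f (λ q → g q + h q) ≡ pairing r′ P f g + pairing r′ P f h
pairing-+ʳ r′ P f g h =
  trans (∑-cong P λ p _ → trans (cong (f p *_) (window-+ r′ g h p)) (*-distribˡ-+ (f p) (window r′ g p) (window r′ h p)))
        (∑-+ P (λ p → f p * window r′ g p) (λ p → f p * window r′ h p))

pairing-+ˡ : ∀ r′ P f g h → pairing r′ P (λ q → f q + g q) h ≡ pairing r′ P f h + pairing r′ P g h
pairing-+ˡ r′ P f g h =
  trans (∑-cong P λ p _ → *-distribʳ-+ (window r′ h p) (f p) (g p))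
        (∑-+ P (λ p → f p * window r′ h p) (λ p → g p * window r′ h p))

-- p + j - r and q + (r - j) describe the same pairs of positions.
pairing-shift : ∀ r′ P f g → VanishesFrom P f → pairing r′ P f (shift (suc r′) g) ≡ pairing r′ P g f
pairing-shift r′ P f g z = begin
  ∑ P (λ p → f p * window r′ (shift (suc r′) g) p)
    ≡⟨ ∑-cong P (λ p _ → sym (∑-*ˡ r′ (f p) (λ j → shift (suc r′) g (suc j + p)))) ⟩
  ∑ P (λ p → ∑ r′ (λ j → f p * shift (suc r′) g (suc j + p)))
    ≡⟨ ∑-swap P r′ (λ p j → f p * shift (suc r′) g (suc j + p)) ⟩
  ∑ r′ (λ j → ∑ P (λ p → f p * shift (suc r′) g (suc j + p)))
    ≡⟨ ∑-reverse r′ _ (λ j → ∑ P (λ p → f (suc j + p) * g p)) swapped ⟩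
  ∑ r′ (λ j → ∑ P (λ p → f (suc j + p) * g p))
    ≡⟨ ∑-swap r′ P (λ j p → f (suc j + p) * g p) ⟩
  ∑ P (λ p → ∑ r′ (λ j → f (suc j + p) * g p))
    ≡⟨ ∑-cong P (λ p _ → trans (∑-*ʳ r′ (g p) (λ j → f (suc j + p))) (*-comm _ (g p))) ⟩
  ∑ P (λ p → g p * window r′ f p) ∎
  where
  open ≡-Reasoning
  swapped : ∀ i j → suc (i + j) ≡ r′ →
            ∑ P (λ p → f p * shift (suc r′) g (suc i + p)) ≡ ∑ P (λ p → f (suc j + p) * g p)
  -- Here r = (i + 1) + (j + 1): the translation by i + 1 undoes that part of the shift by r, and
  -- the remaining shift by j + 1 passes to the other factor.
  swapped i j refl = trans
    (∑-cong P λ p _ → cong (f p *_)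
      (trans (cong (λ k → shift k g (suc i + p)) (cong suc (sym (+-suc i j)))) (shift-cancel (suc i) (suc j) g p)))
    (∑-*-shift (suc j) P f g z)

-- Counting the solutions of monotone predicates

⟦_⟧ : ∀ {A : Set} → Dec A → ℕ
⟦ yes _ ⟧ = 1
⟦ no  _ ⟧ = 0

⟦⟧-yes : ∀ {A : Set} (d : Dec A) → A → ⟦ d ⟧ ≡ 1
⟦⟧-yes (yes _) a = refl
⟦⟧-yes (no ¬a) a = ⊥-elim (¬a a)

⟦⟧-no : ∀ {A : Set} (d : Dec A) → ¬ A → ⟦ d ⟧ ≡ 0
⟦⟧-no (yes a) ¬a = ⊥-elim (¬a a)
⟦⟧-no (no _)  ¬a = refl

⟦⟧-bit : ∀ {A : Set} (d : Dec A) → Bit ⟦ d ⟧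
⟦⟧-bit (yes _) = ≤-refl
⟦⟧-bit (no _)  = z≤n

∑-bits-≤ : ∀ n f → (∀ i → Bit (f i)) → ∑ n f ≤ n
∑-bits-≤ zero    f b = z≤n
∑-bits-≤ (suc n) f b = ≤-trans (+-mono-≤ (∑-bits-≤ n f b) (b n)) (≤-reflexive (+-comm n 1))

module _ {A : ℕ → Set} (A? : ∀ i → Dec (A i)) where

  count : ℕ → ℕ
  count n = ∑ n (λ i → ⟦ A? i ⟧)

  module _ (up : ∀ i → A i → A (suc i)) where

    up-≤ : ∀ {i j} → i ≤ j → A i → A j
    up-≤ {i} {j} i≤j a with m≤n⇒m<n∨m≡n i≤j
    ... | inj₂ refl = a
    up-≤ {i} {suc j} i≤j a | inj₁ i<j = up j (up-≤ (s≤s⁻¹ i<j) a)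

    -- The solutions below n of an upward closed predicate form a final segment, which starts at n ∸
    -- `count n`. This lemma and `count-up⁻` are the two halves of that description.
    count-up : ∀ n i → i + count n < n → ¬ A i
    count-up (suc n) i h a with A? n
    ... | yes _ = count-up n i (s≤s⁻¹ (subst (_< suc n) (trans (cong (i +_) (+-comm _ 1)) (+-suc i _)) h)) a
    ... | no ¬a = ¬a (up-≤ (≤-trans (m≤m+n i _) (s≤s⁻¹ h)) a)

    count-up⁻ : ∀ n i → i < n → ¬ A i → i + count n < n
    count-up⁻ (suc n) i i<n ¬Ai with A? n
    ... | yes a = subst (_< suc n) (sym (trans (cong (i +_) (+-comm _ 1)) (+-suc i _)))
                    (s≤s (count-up⁻ n i (≤∧≢⇒< (s≤s⁻¹ i<n) λ { refl → ¬Ai a }) ¬Ai))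
    ... | no ¬a = subst (_< suc n) (sym (trans (cong (i +_) (trans (+-identityʳ _) zeroes)) (+-identityʳ i))) i<n
      where
      zeroes : count n ≡ 0
      zeroes = ∑-zero n λ j j<n → ⟦⟧-no (A? j) λ a → ¬a (up-≤ (<⇒≤ j<n) a)

  module _ (down : ∀ i → A (suc i) → A i) where

    down-≤ : ∀ {i j} → i ≤ j → A j → A i
    down-≤ {i} {j} i≤j a with m≤n⇒m<n∨m≡n i≤j
    ... | inj₂ refl = a
    down-≤ {i} {suc j} i≤j a | inj₁ i<j = down-≤ (s≤s⁻¹ i<j) (down j a)

    count-down : ∀ n i → i < count n → A i
    count-down (suc n) i h with A? n
    ... | yes a = down-≤ (s≤s⁻¹ (<-≤-trans h (≤-trans (+-monoˡ-≤ 1 (∑-bits-≤ n _ (λ i → ⟦⟧-bit (A? i))))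
                                                        (≤-reflexive (+-comm n 1))))) a
    ... | no _ = count-down n i (subst (i <_) (+-identityʳ _) h)

    count-down⁻ : ∀ n i → i < n → A i → i < count n
    count-down⁻ (suc n) i i<n a with A? n
    ... | yes an = <-≤-trans i<n (≤-reflexive (trans (+-comm 1 n) (cong (_+ 1) (sym ones))))
      where
      ones : count n ≡ n
      ones = trans (∑-cong n λ j j<n → ⟦⟧-yes (A? j) (down-≤ (<⇒≤ j<n) an)) (trans (∑-const n 1) (*-identityʳ n))
    ... | no ¬a = subst (i <_) (sym (+-identityʳ _))
                    (count-down⁻ n i (≤∧≢⇒< (s≤s⁻¹ i<n) λ { refl → ¬a a }) a)

-- Edge sequences of partitions

entry-antitone : ∀ {xs} → Linked _≥_ xs → ∀ i → entry xs (suc i) ≤ entry xs i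
entry-antitone []            i       = z≤n
entry-antitone [-]           i       = z≤n
entry-antitone (x≥y ∷ xs≥)   zero    = x≥y
entry-antitone (x≥y ∷ xs≥)   (suc i) = entry-antitone xs≥ i

entry-beyond : ∀ xs {i} → length xs ≤ i → entry xs i ≡ 0
entry-beyond []       _       = refl
entry-beyond (x ∷ xs) (s≤s l) = entry-beyond xs l

entry-ext : ∀ {xs ys} → All (0 <_) xs → All (0 <_) ys → (∀ i → entry xs i ≡ entry ys i) → xs ≡ ys
entry-ext []       []       e = refl
entry-ext []       (y ∷ ys) e = ⊥-elim (<-irrefl (e 0) y)
entry-ext (x ∷ xs) []       e = ⊥-elim (<-irrefl (sym (e 0)) x)
entry-ext (x ∷ xs) (y ∷ ys) e = cong₂ _∷_ (e 0) (entry-ext xs ys (e ∘ suc))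

entry-0⇒length : ∀ {xs} → All (0 <_) xs → ∀ i → entry xs i ≡ 0 → length xs ≤ i
entry-0⇒length []       i       e = z≤n
entry-0⇒length (x ∷ xs) zero    e = ⊥-elim (<-irrefl (sym e) x)
entry-0⇒length (x ∷ xs) (suc i) e = s≤s (entry-0⇒length xs i e)

sum-entries : ∀ xs n → length xs ≤ n → sum xs ≡ ∑ n (entry xs)
sum-entries []       n       l       = sym (∑-zero n λ _ _ → refl)
sum-entries (x ∷ xs) (suc n) (s≤s l) = trans (cong (x +_) (sum-entries xs n l)) (sym (∑-front n (entry (x ∷ xs))))

rowLength-antitone : ∀ λ′ {i j} → i ≤ j → rowLength λ′ j ≤ rowLength λ′ i
rowLength-antitone λ′ {i} {j} i≤j with m≤n⇒m<n∨m≡n i≤j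
... | inj₂ refl = ≤-refl
rowLength-antitone λ′ {i} {suc j} i≤j | inj₁ i<j =
  ≤-trans (entry-antitone (decreasing λ′) j) (rowLength-antitone λ′ (s≤s⁻¹ i<j))

fromRows : ∀ n (g : ℕ → ℕ) → (∀ i → g (suc i) ≤ g i) → g n ≡ 0 →
           ∃[ λ′ ] (∀ i → rowLength λ′ i ≡ g i)
fromRows n g anti gn≡0 = mkPartition (rows n g) (linked n g anti) (allPositive n g) , entries n g anti gn≡0
  where
  rows : ℕ → (ℕ → ℕ) → List ℕ
  rows zero    g = []
  rows (suc n) g with g 0
  ... | zero  = []
  ... | suc x = suc x ∷ rows n (g ∘ suc)

  allPositive : ∀ n g → All (0 <_) (rows n g)
  allPositive zero    g = []
  allPositive (suc n) g with g 0
  ... | zero  = []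
  ... | suc x = s≤s z≤n ∷ allPositive n (g ∘ suc)

  cons : ∀ x n g → g 0 ≤ x → Linked _≥_ (rows n g) → Linked _≥_ (x ∷ rows n g)
  cons x zero    g _ _ = [-]
  cons x (suc n) g h l with g 0
  ... | zero  = [-]
  ... | suc y = h ∷ l

  linked : ∀ n g → (∀ i → g (suc i) ≤ g i) → Linked _≥_ (rows n g)
  linked zero    g anti = []
  linked (suc n) g anti with g 0 in eq
  ... | zero  = []
  ... | suc x = cons (suc x) n (g ∘ suc) (≤-trans (anti 0) (≤-reflexive eq)) (linked n (g ∘ suc) (anti ∘ suc))

  zeroes : ∀ (g : ℕ → ℕ) → (∀ i → g (suc i) ≤ g i) → g 0 ≡ 0 → ∀ i → 0 ≡ g i
  zeroes g anti e zero    = sym e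
  zeroes g anti e (suc i) = sym (n≤0⇒n≡0 (≤-trans (anti i) (≤-reflexive (sym (zeroes g anti e i)))))

  entries : ∀ n g → (∀ i → g (suc i) ≤ g i) → g n ≡ 0 → ∀ i → entry (rows n g) i ≡ g i
  entries zero    g anti e i = zeroes g anti e i
  entries (suc n) g anti e i with g 0 in eq
  entries (suc n) g anti e i       | zero  = zeroes g anti eq i
  entries (suc n) g anti e zero    | suc x = sym eq
  entries (suc n) g anti e (suc i) | suc x = entries n (g ∘ suc) (anti ∘ suc) e i

-- β is the edge sequence of λ, read from bottom left to top right, with a 1 for
-- each vertical edge; position p lies between the diagonals p - n and p + 1 - n,
-- and the edge sequence starts at the bottom of row n - 1.
record Encodes (n : ℕ) (λ′ : Partition) (β : ℕ → ℕ) : Set where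
  field
    bit   : ∀ p → Bit (β p)
    bound : ∀ q → ∑ q β ≤ n
    to    : ∀ i q → i + ∑ q β < n → q + i < rowLength λ′ i + n
    from  : ∀ i q → q + i < rowLength λ′ i + n → i + ∑ q β < n

-- The bead of row i < n belongs at position λ_i + n - 1 - i. `A q i` says that it lies before q, so
-- `C q` is the number of beads before q, and the edge sequence is the difference sequence of `C`.
module Edges (n : ℕ) (λ′ : Partition) where

  A : ℕ → ℕ → Set
  A q i = rowLength λ′ i + n ≤ q + i

  A? : ∀ q i → Dec (A q i)
  A? q i = rowLength λ′ i + n ≤? q + i

  A-up : ∀ q i → A q i → A q (suc i)
  A-up q i a = ≤-trans (+-monoˡ-≤ n (rowLength-antitone λ′ (n≤1+n i)))
                       (≤-trans a (+-monoʳ-≤ q (n≤1+n i)))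

  C : ℕ → ℕ
  C q = count (A? q) n

  C-bound : ∀ q → C q ≤ n
  C-bound q = ∑-bits-≤ n _ λ i → ⟦⟧-bit (A? q i)

  C-mono : ∀ q → C q ≤ C (suc q)
  C-mono q = ≮⇒≥ λ h →
    let i = n ∸ C q
        i+C≡n : i + C q ≡ n
        i+C≡n = m∸n+n≡m (C-bound q)
        ¬a = count-up (A? (suc q)) (A-up (suc q)) n i (<-≤-trans (+-monoʳ-< i h) (≤-reflexive i+C≡n))
        i<n = ≤-<-trans (m≤m+n i _) (<-≤-trans (+-monoʳ-< i h) (≤-reflexive i+C≡n))
    in <-irrefl i+C≡n (count-up⁻ (A? q) (A-up q) n i i<n λ a → ¬a (≤-trans a (n≤1+n _)))

  -- Bead positions strictly decrease with the row, so at most one row has its bead at q.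
  C-step : ∀ q → C (suc q) ≤ suc (C q)
  C-step q = ≮⇒≥ λ h →
    let i = n ∸ C (suc q)
        i+C≡n : i + C (suc q) ≡ n
        i+C≡n = m∸n+n≡m (C-bound (suc q))
        lt : suc i + C q < n
        lt = subst₂ _≤_ (trans (+-suc i _) (cong suc (+-suc i _))) i+C≡n (+-monoʳ-≤ i h)
        ¬a = count-up (A? q) (A-up q) n (suc i) lt
    in <-irrefl i+C≡n (count-up⁻ (A? (suc q)) (A-up (suc q)) n i (≤-trans (s≤s (≤-trans (n≤1+n i) (m≤m+n (suc i) _))) lt)
         λ a → ¬a (≤-trans (+-monoˡ-≤ n (rowLength-antitone λ′ (n≤1+n i)))
                           (≤-trans a (≤-reflexive (sym (+-suc q i))))))

edges : ℕ → Partition → ℕ → ℕ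
edges n λ′ p = C (suc p) ∸ C p where open Edges n λ′

edges-encodes : ∀ n λ′ → length (parts λ′) ≤ n → Encodes n λ′ (edges n λ′)
edges-encodes n λ′ l≤n = record
  { bit   = λ p → ≤-trans (∸-monoˡ-≤ (C p) (C-step p)) (≤-reflexive (m+n∸n≡m 1 (C p)))
  ; bound = λ q → ≤-trans (≤-reflexive (∑-edges q)) (C-bound q)
  ; to    = λ i q h → ≰⇒> (count-up (A? q) (A-up q) n i (subst (λ x → i + x < n) (∑-edges q) h))
  ; from  = λ i q h → subst (λ x → i + x < n) (sym (∑-edges q))
                        (count-up⁻ (A? q) (A-up q) n i (row< i q h) (<⇒≱ h))
  }
  where
  open Edges n λ′
  row< : ∀ i q → q + i < rowLength λ′ i + n → i < n
  row< i q h = ≰⇒> λ n≤i → <⇒≱ (subst (λ x → q + i < x + n) (entry-beyond (parts λ′) (≤-trans l≤n n≤i)) h)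
                                (≤-trans n≤i (m≤n+m i q))
  ∑-edges : ∀ q → ∑ q (edges n λ′) ≡ C q
  ∑-edges zero    = sym (∑-zero n λ i i<n → ⟦⟧-no (A? 0 i) λ a → <⇒≱ i<n (≤-trans (m≤n+m n _) a))
  ∑-edges (suc q) = trans (cong (_+ edges n λ′ q) (∑-edges q)) (m+[n∸m]≡n (C-mono q))

-- For i < n the positions q with fewer than n - i beads before them are those up to the bead of row
-- i. Their number `x i` is therefore one more than the position of that bead, and row i must have
-- length `x i ∸ (n ∸ i)`.
decode : ∀ n P β → (∀ p → Bit (β p)) → (∀ q → ∑ q β ≤ n) → ∑ P β ≡ n → ∃[ λ′ ] Encodes n λ′ β
decode n P β bit bound total = λ′ , record { bit = bit ; bound = bound ; to = to ; from = from }
  where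
  D : ℕ → ℕ → Set
  D i q = i + ∑ q β < n
  D? : ∀ i q → Dec (D i q)
  D? i q = i + ∑ q β <? n
  D-down : ∀ i q → D i (suc q) → D i q
  D-down i q d = ≤-<-trans (+-monoʳ-≤ i (m≤m+n (∑ q β) (β q))) d
  x : ℕ → ℕ
  x i = count (D? i) P
  D⇒< : ∀ i q → D i q → q < x i
  D⇒< i q d = count-down⁻ (D? i) (D-down i) P q
    (≰⇒> λ P≤q → <⇒≱ d (≤-trans (≤-reflexive (sym total)) (≤-trans (∑-mono β P≤q) (m≤n+m _ i)))) d
  <⇒D : ∀ i q → q < x i → D i q
  <⇒D i q = count-down (D? i) (D-down i) P q
  D⇒row< : ∀ i q → D i q → i < n
  D⇒row< i q d = ≤-<-trans (m≤m+n i _) d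
  g : ℕ → ℕ
  g i = x i ∸ (n ∸ i)
  anti : ∀ i → g (suc i) ≤ g i
  anti i with x (suc i) in eq
  ... | zero = ≤-trans (≤-reflexive (0∸n≡0 (n ∸ suc i))) z≤n
  ... | suc y = begin
    suc y ∸ (n ∸ suc i)             ≡⟨⟩
    suc (suc y) ∸ suc (n ∸ suc i)   ≡⟨ cong (suc (suc y) ∸_) (sym (+-∸-assoc 1 (D⇒row< i (suc y) d′))) ⟩
    suc (suc y) ∸ (n ∸ i)           ≤⟨ ∸-monoˡ-≤ (n ∸ i) (D⇒< i (suc y) d′) ⟩
    x i ∸ (n ∸ i)                   ∎
    where
    open ≤-Reasoning
    d : D (suc i) y
    d = <⇒D (suc i) y (≤-reflexive (sym eq))
    d′ : D i (suc y)
    d′ = ≤-<-trans (+-monoʳ-≤ i (≤-trans (+-monoʳ-≤ (∑ y β) (bit y)) (≤-reflexive (+-comm (∑ y β) 1))))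
                   (subst (_< n) (sym (+-suc i _)) d)
  gn≡0 : g n ≡ 0
  gn≡0 with x n in eq
  ... | zero  = 0∸n≡0 (n ∸ n)
  ... | suc y = ⊥-elim (<-irrefl refl (D⇒row< n y (<⇒D n y (≤-reflexive (sym eq)))))
  λ′ : Partition
  λ′ = proj₁ (fromRows n g anti gn≡0)
  rowIs : ∀ i → rowLength λ′ i ≡ g i
  rowIs = proj₂ (fromRows n g anti gn≡0)
  split : ∀ i → i ≤ n → rowLength λ′ i + n ≡ g i + (n ∸ i) + i
  split i i≤n = trans (cong₂ _+_ (rowIs i) (sym (m∸n+n≡m i≤n))) (sym (+-assoc (g i) _ i))
  to : ∀ i q → i + ∑ q β < n → q + i < rowLength λ′ i + n
  to i q d = <-≤-trans (+-monoˡ-< i (D⇒< i q d))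
    (≤-trans (+-monoˡ-≤ i (≤-trans (m≤n+m∸n (x i) (n ∸ i)) (≤-reflexive (+-comm (n ∸ i) (g i)))))
             (≤-reflexive (sym (split i (<⇒≤ (D⇒row< i q d))))))
  from : ∀ i q → q + i < rowLength λ′ i + n → i + ∑ q β < n
  from i q h with i <? n
  ... | no i≮n = ⊥-elim (<⇒≱ (subst (λ x → q + i < x + n) (sym (row-zero i (≮⇒≥ i≮n))) h)
                             (≤-trans (≮⇒≥ i≮n) (m≤n+m i q)))
    where
    row-zero : ∀ i → n ≤ i → 0 ≡ rowLength λ′ i
    row-zero i n≤i = sym (n≤0⇒n≡0 (≤-trans (rowLength-antitone λ′ n≤i) (≤-reflexive (trans (rowIs n) gn≡0))))
  ... | yes i<n = <⇒D i q (+-cancelʳ-< i q (x i) (<-≤-trans h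
      (≤-reflexive (trans (split i (<⇒≤ i<n)) (cong (_+ i) (m∸n+n≡m k≤x))))))
    where
    -- Fewer than n - i positions hold fewer than n - i beads, so the subtraction defining `g i` is
    -- not truncated.
    k≤x : n ∸ i ≤ x i
    k≤x with n ∸ i in eq
    ... | zero  = z≤n
    ... | suc k = D⇒< i k (<-≤-trans (+-monoʳ-< i (s≤s (∑-bits-≤ k β bit)))
      (≤-reflexive (trans (cong (i +_) (sym eq)) (m+[n∸m]≡n (<⇒≤ i<n)))))

module _ {n λ′ β} (E : Encodes n λ′ β) where
  open Encodes E

  rowLength-0 : ∀ i → n ≤ i → rowLength λ′ i ≡ 0
  rowLength-0 i n≤i = n≤0⇒n≡0 (≤-trans (rowLength-antitone λ′ n≤i) (≮⇒≥ λ 0<row →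
    <⇒≱ (from n 0 (+-monoˡ-< n 0<row)) (m≤m+n n 0)))

  length≤ : length (parts λ′) ≤ n
  length≤ = entry-0⇒length (positive λ′) n (rowLength-0 n ≤-refl)

  ∑-total : ∀ {Q} → rowLength λ′ 0 + n ≤ Q → ∑ Q β ≡ n
  ∑-total {Q} h = ≤-antisym (bound Q) (≮⇒≥ λ lt → <⇒≱ (to 0 Q lt) (≤-trans h (m≤m+n Q 0)))

  edges-vanish : VanishesFrom (rowLength λ′ 0 + n) β
  edges-vanish p h = n≤0⇒n≡0 (+-cancelˡ-≤ n (β p) 0
    (≤-trans (≤-reflexive (cong (_+ β p) (sym (∑-total h))))
             (≤-trans (bound (suc p)) (≤-reflexive (sym (+-identityʳ n))))))

  -- The empty rows i with ℓ ≤ i < n put their beads at n - 1 - i and so fill all positions below n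
  -- - ℓ.
  ∑-initial : ∀ {ℓ} q → length (parts λ′) ≤ ℓ → q + ℓ ≤ n → ∑ q β ≡ q
  ∑-initial {ℓ} q l h = ≤-antisym (∑-bits-≤ q β bit) (≮⇒≥ λ lt →
    let q≤n = ≤-trans (m≤m+n q ℓ) h
        ℓ≤i : ℓ ≤ n ∸ q
        ℓ≤i = +-cancelˡ-≤ q _ _ (≤-trans h (≤-reflexive (sym (m+[n∸m]≡n q≤n))))
        lt′ = to (n ∸ q) q (<-≤-trans (+-monoʳ-< (n ∸ q) lt) (≤-reflexive (m∸n+n≡m q≤n)))
    in <-irrefl refl (subst₂ (λ x y → x < y + n) (m+[n∸m]≡n q≤n)
                        (entry-beyond (parts λ′) (≤-trans l ℓ≤i)) lt′))

  edges-initial : ∀ {ℓ} p → length (parts λ′) ≤ ℓ → p + ℓ < n → β p ≡ 1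
  edges-initial {ℓ} p l h = +-cancelˡ-≡ p (β p) 1 (trans (cong (_+ β p) (sym (∑-initial p l (<⇒≤ h))))
    (trans (∑-initial (suc p) l h) (+-comm 1 p)))

  initial⇒length≤ : ∀ j → j ≤ n → (∀ p → p < j → β p ≡ 1) → length (parts λ′) ≤ n ∸ j
  initial⇒length≤ j j≤n ones = entry-0⇒length (positive λ′) (n ∸ j) (n≤0⇒n≡0 (≮⇒≥ λ 0<row →
    <-irrefl (trans (cong (n ∸ j +_) (trans (∑-cong j ones) (trans (∑-const j 1) (*-identityʳ j)))) (m∸n+n≡m j≤n))
      (from (n ∸ j) j (subst (_< rowLength λ′ (n ∸ j) + n) (sym (m+[n∸m]≡n j≤n)) (+-monoˡ-< n 0<row)))))

encodes-injective : ∀ {n λ′ μ β γ} → Encodes n λ′ β → Encodes n μ γ → (∀ p → β p ≡ γ p) → λ′ ≡ μ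
encodes-injective {n} {λ′} {μ} E F β≗γ =
  partition-≡ (entry-ext (positive λ′) (positive μ) λ i → ≤-antisym (half E F β≗γ i) (half F E (sym ∘ β≗γ) i))
  where
  half : ∀ {λ′ μ β γ} → Encodes n λ′ β → Encodes n μ γ → (∀ p → β p ≡ γ p) → ∀ i → rowLength λ′ i ≤ rowLength μ i
  half {λ′} {μ} E F β≗γ i with i ≤? n
  ... | no i≰n = ≤-trans (≤-reflexive (rowLength-0 E i (<⇒≤ (≰⇒> i≰n)))) z≤n
  ... | yes i≤n = ≮⇒≥ λ lt →
    let q = rowLength μ i + (n ∸ i)
        q+i : q + i ≡ rowLength μ i + n
        q+i = trans (+-assoc (rowLength μ i) _ i) (cong (rowLength μ i +_) (m∸n+n≡m i≤n))
    in <-irrefl q+i (Encodes.to F i q (subst (λ x → i + x < n) (∑-cong q λ p _ → β≗γ p)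
         (Encodes.from E i q (subst (_< rowLength λ′ i + n) (sym q+i) (+-monoˡ-< n lt)))))

∑-initial-segment : ∀ {A : ℕ → Set} (A? : ∀ i → Dec (A i)) m k → k ≤ m →
                    (∀ i → A i → i < k) → (∀ i → i < k → A i) → ∑ m (λ i → ⟦ A? i ⟧) ≡ k
∑-initial-segment A? zero    zero    k≤m only all = refl
∑-initial-segment A? (suc m) k       k≤m only all with m≤n⇒m<n∨m≡n k≤m
... | inj₁ k<m = trans (cong₂ _+_ (∑-initial-segment A? m k (s≤s⁻¹ k<m) only all)
                   (⟦⟧-no (A? m) λ a → <⇒≱ (only m a) (s≤s⁻¹ k<m))) (+-identityʳ k)
... | inj₂ refl = trans (∑-cong (suc m) λ i i<k → ⟦⟧-yes (A? i) (all i i<k))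
                        (trans (∑-const (suc m) 1) (*-identityʳ (suc m)))

-- Double counting of the pairs (i, q) with i < n and q < Q such that the bead of row i is not
-- before q. Row i contributes λ_i + (n - i) of them, and position q contributes n - `∑ q β`.
size-edges : ∀ {n λ′ β} → Encodes n λ′ β → ∀ Q → rowLength λ′ 0 + n ≤ Q →
             size λ′ + ∑ n (n ∸_) + ∑ Q (λ q → ∑ q β) ≡ n * Q
size-edges {n} {λ′} {β} E Q h = begin
  size λ′ + ∑ n (n ∸_) + ∑ Q (λ q → ∑ q β)
    ≡⟨ cong (λ x → x + ∑ n (n ∸_) + ∑ Q (λ q → ∑ q β)) (sum-entries (parts λ′) n (length≤ E)) ⟩
  ∑ n (rowLength λ′) + ∑ n (n ∸_) + ∑ Q (λ q → ∑ q β)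
    ≡⟨ cong (_+ ∑ Q (λ q → ∑ q β)) (∑-+ n (rowLength λ′) (n ∸_)) ⟨
  ∑ n (λ i → rowLength λ′ i + (n ∸ i)) + ∑ Q (λ q → ∑ q β)
    ≡⟨ cong (_+ ∑ Q (λ q → ∑ q β)) (∑-cong n rows) ⟩
  ∑ n (λ i → ∑ Q (λ q → ⟦ D? i q ⟧)) + ∑ Q (λ q → ∑ q β)
    ≡⟨ cong (_+ ∑ Q (λ q → ∑ q β)) (∑-swap n Q (λ i q → ⟦ D? i q ⟧)) ⟩
  ∑ Q (λ q → ∑ n (λ i → ⟦ D? i q ⟧)) + ∑ Q (λ q → ∑ q β)
    ≡⟨ ∑-+ Q (λ q → ∑ n (λ i → ⟦ D? i q ⟧)) (λ q → ∑ q β) ⟨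
  ∑ Q (λ q → ∑ n (λ i → ⟦ D? i q ⟧) + ∑ q β)
    ≡⟨ ∑-cong Q (λ q _ → trans (cong (_+ ∑ q β) (columns q)) (m∸n+n≡m (bound q))) ⟩
  ∑ Q (λ _ → n)
    ≡⟨ trans (∑-const Q n) (*-comm Q n) ⟩
  n * Q ∎
  where
  open ≡-Reasoning
  open Encodes E
  D? : ∀ i q → Dec (i + ∑ q β < n)
  D? i q = i + ∑ q β <? n
  rows : ∀ i → i < n → rowLength λ′ i + (n ∸ i) ≡ ∑ Q (λ q → ⟦ D? i q ⟧)
  rows i i<n = sym (∑-initial-segment (D? i) Q _
    (≤-trans (+-mono-≤ (rowLength-antitone λ′ z≤n) (m∸n≤m n i)) h)
    (λ q d → +-cancelʳ-< i q _ (subst (q + i <_) (sym e) (to i q d)))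
    (λ q lt → from i q (subst (q + i <_) e (+-monoˡ-< i lt))))
    where
    e : rowLength λ′ i + (n ∸ i) + i ≡ rowLength λ′ i + n
    e = trans (+-assoc (rowLength λ′ i) _ i) (cong (rowLength λ′ i +_) (m∸n+n≡m (<⇒≤ i<n)))
  columns : ∀ q → ∑ n (λ i → ⟦ D? i q ⟧) ≡ n ∸ ∑ q β
  columns q = ∑-initial-segment (λ i → D? i q) n _ (m∸n≤m n (∑ q β))
    (λ i d → +-cancelʳ-< (∑ q β) i _ (subst (i + ∑ q β <_) (sym (m∸n+n≡m (bound q))) d))
    (λ i lt → subst (i + ∑ q β <_) (m∸n+n≡m (bound q)) (+-monoˡ-< (∑ q β) lt))

-- Ribbons as moves of a bead

⊖-cancelʳ-≡ : ∀ n {a b} → a ⊖ n ≡ b ⊖ n → a ≡ b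
⊖-cancelʳ-≡ n {a} {b} e with <-cmp a b
... | tri< a<b _ _ = ⊥-elim (ℤ.<-irrefl e (ℤ.⊖-monoˡ-< n a<b))
... | tri≈ _ a≡b _ = a≡b
... | tri> _ _ b<a = ⊥-elim (ℤ.<-irrefl (sym e) (ℤ.⊖-monoˡ-< n b<a))

⊖-cancelʳ-< : ∀ n {a b} → a ⊖ n ℤ.< b ⊖ n → a < b
⊖-cancelʳ-< n {a} {b} h = ≰⇒> λ b≤a → ℤ.<⇒≱ h (ℤ.⊖-monoˡ-≤ n b≤a)

⊖-extend : ∀ a b c → a ⊖ b ≡ (a + c) ⊖ (b + c)
⊖-extend a b c = trans (sym (ℤ.+-cancelˡ-⊖ c a b)) (cong₂ _⊖_ (+-comm c a) (+-comm c b))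

⊖-≡⇒ : ∀ a b c d → a ⊖ b ≡ c ⊖ d → a + d ≡ c + b
⊖-≡⇒ a b c d e = ⊖-cancelʳ-≡ (b + d) (trans (sym (⊖-extend a b d))
  (trans e (trans (⊖-extend c d b) (cong (c + b ⊖_) (+-comm d b)))))

⊖-≡⇐ : ∀ a b c d → a + d ≡ c + b → a ⊖ b ≡ c ⊖ d
⊖-≡⇐ a b c d e = trans (⊖-extend a b d) (trans (cong₂ _⊖_ e (+-comm b d)) (sym (⊖-extend c d b)))

⊖-+ : ∀ m n o → n ⊖ o ℤ.+ pos m ≡ (n + m) ⊖ o
⊖-+ m n o = ℤ.distribˡ-⊖-+-pos m n o

length-filter-applyUpTo : ∀ {P : ℕ → Set} (P? : ∀ i → Dec (P i)) m (f : ℕ → ℕ) →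
  length (filter P? (applyUpTo f m)) ≡ ∑ m (λ i → ⟦ P? (f i) ⟧)
length-filter-applyUpTo P? zero f = refl
length-filter-applyUpTo P? (suc m) f rewrite ∑-front m (λ i → ⟦ P? (f i) ⟧) with P? (f 0)
... | yes _ = cong suc (length-filter-applyUpTo P? m (f ∘ suc))
... | no _  = length-filter-applyUpTo P? m (f ∘ suc)

∑-segment : ∀ {P : ℕ → Set} (P? : ∀ i → Dec (P i)) m a e → a ≤ e → e ≤ m →
            (∀ i → P i → a ≤ i × i < e) → (∀ i → a ≤ i → i < e → P i) →
            ∑ m (λ i → ⟦ P? i ⟧) + a ≡ e
∑-segment P? m a e a≤e e≤m only all = begin
  ∑ m (λ i → ⟦ P? i ⟧) + a                          ≡⟨ cong (∑ m (λ i → ⟦ P? i ⟧) +_) (sym (initial a (≤-trans a≤e e≤m))) ⟩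
  ∑ m (λ i → ⟦ P? i ⟧) + ∑ m (λ i → ⟦ i <? a ⟧)     ≡⟨ sym (∑-+ m _ _) ⟩
  ∑ m (λ i → ⟦ P? i ⟧ + ⟦ i <? a ⟧)                 ≡⟨ ∑-cong m (λ i _ → pointwise i) ⟩
  ∑ m (λ i → ⟦ i <? e ⟧)                            ≡⟨ initial e e≤m ⟩
  e                                                 ∎
  where
  open ≡-Reasoning
  initial : ∀ k → k ≤ m → ∑ m (λ i → ⟦ i <? k ⟧) ≡ k
  initial k k≤m = ∑-initial-segment (_<? k) m k k≤m (λ _ h → h) (λ _ h → h)
  pointwise : ∀ i → ⟦ P? i ⟧ + ⟦ i <? a ⟧ ≡ ⟦ i <? e ⟧
  pointwise i with i <? a
  ... | yes i<a rewrite ⟦⟧-no (P? i) (λ p → <⇒≱ i<a (proj₁ (only i p))) = sym (⟦⟧-yes (i <? e) (<-≤-trans i<a a≤e))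
  ... | no i≮a with i <? e
  ...   | yes i<e rewrite ⟦⟧-yes (P? i) (all i (≮⇒≥ i≮a) i<e) = refl
  ...   | no i≮e rewrite ⟦⟧-no (P? i) (i≮e ∘ proj₂ ∘ only i) = refl

∑∑δ : ∀ k p → ∑ (k + suc p) (λ q → ∑ q (δ p)) ≡ k
∑∑δ k p = trans (∑-split (suc p) k (λ q → ∑ q (δ p)))
  (trans (cong₂ _+_ (∑-zero (suc p) λ q q≤p → ∑δ-≤ q (s≤s⁻¹ q≤p))
                    (∑-cong k λ i _ → ∑δ-> (i + suc p) (m≤n+m (suc p) i)))
         (trans (∑-const k 1) (*-identityʳ k)))

-- Additive form of γ = β - δ_p + δ_(p+r). That a bead is present at p need not be demanded: it
-- follows in `move-source`.
Move : ℕ → ℕ → (β γ : ℕ → ℕ) → Set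
Move r p β γ = ∀ q → γ q + δ p q ≡ β q + δ (r + p) q

module _ {r p β γ} (mv : Move r p β γ) where

  ∑-move : ∀ q → ∑ q γ + ∑ q (δ p) ≡ ∑ q β + ∑ q (δ (r + p))
  ∑-move q = trans (sym (∑-+ q γ (δ p))) (trans (∑-cong q λ i _ → mv i) (∑-+ q β (δ (r + p))))

  -- The prefix sums change at the r values p < q ≤ p + r only, which correspond to the r diagonals
  -- of the ribbon.
  ∑-move-inside : ∀ {q} → p < q → q ≤ r + p → ∑ q β ≡ suc (∑ q γ)
  ∑-move-inside {q} p<q q≤ with ∑-move q
  ... | e rewrite ∑δ-> q p<q | ∑δ-≤ q q≤ = sym (trans (+-comm 1 (∑ q γ)) (trans e (+-identityʳ _)))

  ∑-move-outside : ∀ {q} → ¬ (p < q × q ≤ r + p) → ∑ q β ≡ ∑ q γ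
  ∑-move-outside {q} out with ∑-move q | p <? q | q ≤? r + p
  ... | e | yes p<q | yes q≤ = ⊥-elim (out (p<q , q≤))
  ... | e | no p≮q  | _ rewrite ∑δ-≤ q (≮⇒≥ p≮q) | ∑δ-≤ q (≤-trans (≮⇒≥ p≮q) (m≤n+m p r)) =
    sym (+-cancelʳ-≡ 0 _ _ e)
  ... | e | yes p<q | no q≰ rewrite ∑δ-> q p<q | ∑δ-> q (≰⇒> q≰) = sym (+-cancelʳ-≡ 1 _ _ e)

  ∑-move-≤ : ∀ q → ∑ q γ ≤ ∑ q β
  ∑-move-≤ q with p <? q | q ≤? r + p
  ... | yes a | yes b = ≤-trans (n≤1+n _) (≤-reflexive (sym (∑-move-inside a b)))
  ... | no a  | _     = ≤-reflexive (sym (∑-move-outside (a ∘ proj₁)))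
  ... | yes _ | no b  = ≤-reflexive (sym (∑-move-outside (b ∘ proj₂)))

  ∑-move-< : ∀ q → ∑ q γ < ∑ q β → p < q × q ≤ r + p
  ∑-move-< q lt with p <? q | q ≤? r + p
  ... | yes a | yes b = a , b
  ... | no a  | _     = ⊥-elim (<-irrefl (sym (∑-move-outside (a ∘ proj₁))) lt)
  ... | yes _ | no b  = ⊥-elim (<-irrefl (sym (∑-move-outside (b ∘ proj₂))) lt)

  move-source : 0 < r → Bit (β p) → β p ≡ 1
  move-source 0<r b = ≤-antisym b (≤-trans (m≤n+m 1 (γ p)) (≤-reflexive
    (trans (cong (γ p +_) (sym (δ-refl p))) (trans (mv p) (+-absorb (β p) (δ-≢ {r + p} {p} λ e → <-irrefl (sym e) (+-monoˡ-< p 0<r)))))))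

move-from-sums : ∀ r p β γ → (∀ q → p < q → q ≤ r + p → ∑ q β ≡ suc (∑ q γ)) →
                 (∀ q → ¬ (p < q × q ≤ r + p) → ∑ q β ≡ ∑ q γ) → Move r p β γ
move-from-sums r p β γ inside outside q = +-cancelˡ-≡ (∑ q γ + ∑ q (δ p)) _ _
  (trans (interchange (∑ q γ) _ _ _) (trans (sums (suc q)) (trans (interchange (∑ q β) _ _ _)
    (cong (_+ (β q + δ (r + p) q)) (sym (sums q))))))
  where
  sums : ∀ q → ∑ q γ + ∑ q (δ p) ≡ ∑ q β + ∑ q (δ (r + p))
  sums q with p <? q | q ≤? r + p
  ... | yes a | yes b rewrite ∑δ-> q a | ∑δ-≤ q b | inside q a b = trans (+-comm _ 1) (sym (+-identityʳ _))
  ... | no a  | _     rewrite ∑δ-≤ q (≮⇒≥ a) | ∑δ-≤ q (≤-trans (≮⇒≥ a) (m≤n+m p r)) = cong (_+ 0) (sym (outside q (a ∘ proj₁)))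
  ... | yes a | no b  rewrite ∑δ-> q a | ∑δ-> q (≰⇒> b) = cong (_+ 1) (sym (outside q (b ∘ proj₂)))

module _ {n λ′ β} (E : Encodes n λ′ β) where
  open Encodes E

  ∈⇒ : ∀ {q} s → q + row s ≡ col s + n → s ∈ λ′ → row s + ∑ q β < n
  ∈⇒ {q} (i , j) e s∈ = from i q (subst (_< rowLength λ′ i + n) (sym e) (+-monoˡ-< n s∈))

  ∈⇐ : ∀ {q} s → q + row s ≡ col s + n → row s + ∑ q β < n → s ∈ λ′
  ∈⇐ {q} (i , j) e lt = +-cancelʳ-< n j _ (subst (_< rowLength λ′ i + n) e (to i q lt))

  ∈⇒row< : ∀ s → s ∈ λ′ → row s < n
  ∈⇒row< (i , j) s∈ = ≰⇒> λ n≤i → n≮0 (subst (j <_) (rowLength-0 E i n≤i) s∈)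

  ∑-grow : ∀ a b → ∑ (b + a) β ≤ ∑ a β + b
  ∑-grow a b = ≤-trans (≤-reflexive (∑-split a b β)) (+-monoʳ-≤ (∑ a β) (∑-bits-≤ b _ λ i → bit (i + a)))

-- The square in row i on the diagonal numbered q - n.
squareOn : ∀ n q i → n ≤ q + i → ∃[ j ] q + i ≡ j + n
squareOn n q i h = q + i ∸ n , sym (m∸n+n≡m h)

positionOf : ∀ {n} s → row s < n → ∃[ q ] q + row s ≡ col s + n
positionOf {n} (i , j) i<n = j + n ∸ i , m∸n+n≡m (≤-trans (<⇒≤ i<n) (m≤n+m n j))

module _ {r′ : ℕ} {n λ′ μ β γ} (E : Encodes n λ′ β) (F : Encodes n μ γ) where

  private
    r : ℕ
    r = suc r′
    module E = Encodes E
    module F = Encodes F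

  -- On the diagonal numbered q - n, the skew shape occupies the rows i with n - `∑ q β` ≤ i < n -
  -- `∑ q γ`. The number of its squares there is the difference of the two prefix sums.
  skew⇒ : ∀ {q} s → q + row s ≡ col s + n → s ∈ μ ∖ λ′ → row s + ∑ q γ < n × n ≤ row s + ∑ q β
  skew⇒ {q} s e (s∈ , s∉) = ∈⇒ F {q} s e s∈ , ≮⇒≥ (s∉ ∘ ∈⇐ E {q} s e)

  skew⇐ : ∀ {q} s → q + row s ≡ col s + n → row s + ∑ q γ < n → n ≤ row s + ∑ q β → s ∈ μ ∖ λ′
  skew⇐ {q} s e lt ge = ∈⇐ F {q} s e lt , λ s∈ → <⇒≱ (∈⇒ E {q} s e s∈) ge

  module _ (ρ : Ribbon r λ′ μ) where

    private
      s₀ : Square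
      s₀ = proj₁ (oneOnEach ρ (s≤s z≤n))
      s₀∈ : s₀ ∈ μ ∖ λ′
      s₀∈ = proj₁ (proj₁ (proj₂ (oneOnEach ρ (s≤s z≤n))))
      pos₀ : ∃[ q ] q + row s₀ ≡ col s₀ + n
      pos₀ = positionOf s₀ (∈⇒row< F s₀ (proj₁ s₀∈))
      q₀ : ℕ
      q₀ = proj₁ pos₀
      -- The moving bead leaves the position just before the lowest diagonal. There is one, since q₀
      -- = 0 would place s₀ in a row numbered n or more.
      q₀>0 : ∃[ p ] q₀ ≡ suc p
      q₀>0 with q₀ in eq
      ... | suc p = p , refl
      ... | zero  = ⊥-elim (<⇒≱ (∈⇒row< F s₀ (proj₁ s₀∈))
        (≤-trans (m≤n+m n (col s₀)) (≤-reflexive (trans (sym (proj₂ pos₀)) (cong (_+ row s₀) eq)))))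
      p : ℕ
      p = proj₁ q₀>0

      lowest≡ : lowest ρ ≡ suc p ⊖ n
      lowest≡ = begin
        lowest ρ              ≡⟨ ℤ.+-identityʳ _ ⟨
        lowest ρ ℤ.+ pos 0      ≡⟨ proj₂ (proj₁ (proj₂ (oneOnEach ρ (s≤s z≤n)))) ⟨
        diagonal s₀           ≡⟨ ⊖-≡⇐ (col s₀) (row s₀) q₀ n (sym (proj₂ pos₀)) ⟩
        q₀ ⊖ n                ≡⟨ cong (_⊖ n) (proj₂ q₀>0) ⟩
        suc p ⊖ n             ∎
        where open ≡-Reasoning

      diagonal⇒ : ∀ s t → diagonal s ≡ lowest ρ ℤ.+ pos t → (suc p + t) + row s ≡ col s + n
      diagonal⇒ s t e = sym (⊖-≡⇒ (col s) (row s) (suc p + t) n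
        (trans e (trans (cong (ℤ._+ pos t) lowest≡) (⊖-+ t (suc p) n))))

      diagonal⇐ : ∀ s t → (suc p + t) + row s ≡ col s + n → diagonal s ≡ lowest ρ ℤ.+ pos t
      diagonal⇐ s t e = trans (⊖-≡⇐ (col s) (row s) (suc p + t) n (sym e))
        (sym (trans (cong (ℤ._+ pos t) lowest≡) (⊖-+ t (suc p) n)))

      ∑-≤ : ∀ q → ∑ q γ ≤ ∑ q β
      ∑-≤ q = ≮⇒≥ λ lt →
        let i = n ∸ ∑ q γ
            i+∑≡n = m∸n+n≡m (F.bound q)
            j , e = squareOn n q i (≤-trans (≤-reflexive (trans (sym i+∑≡n) (+-comm i _)))
                                            (+-monoˡ-≤ i (∑-bits-≤ q γ F.bit)))
            s∈λ = ∈⇐ E {q} (i , j) e (<-≤-trans (+-monoʳ-< i lt) (≤-reflexive i+∑≡n))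
        in <-irrefl i+∑≡n (∈⇒ F {q} (i , j) e (contained ρ (i , j) s∈λ))

      occupied : ∀ q → ∑ q γ < ∑ q β → ∃[ t ] t < r × q ≡ suc p + t × ∑ q β ≡ suc (∑ q γ)
      occupied q lt = result
        where
        -- The top and the bottom row of the skew shape on the diagonal of q. As a ribbon has only
        -- one square there, they coincide, so the prefix sums differ by exactly one.
        i k : ℕ
        i = n ∸ ∑ q β
        k = n ∸ suc (∑ q γ)
        i+ : i + ∑ q β ≡ n
        i+ = m∸n+n≡m (E.bound q)
        k+ : k + suc (∑ q γ) ≡ n
        k+ = m∸n+n≡m (≤-trans lt (E.bound q))
        sq : ∃[ j ] q + i ≡ j + n
        sq = squareOn n q i (≤-trans (≤-reflexive (trans (sym i+) (+-comm i _)))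
                                            (+-monoˡ-≤ i (∑-bits-≤ q β E.bit)))
        i≤k : i ≤ k
        i≤k = ∸-monoʳ-≤ n lt
        sq′ : ∃[ j ] q + k ≡ j + n
        sq′ = squareOn n q k (≤-trans (≤-trans (m≤n+m n (proj₁ sq)) (≤-reflexive (sym (proj₂ sq)))) (+-monoʳ-≤ q i≤k))
        in₁ : (i , proj₁ sq) ∈ μ ∖ λ′
        in₁ = skew⇐ {q} _ (proj₂ sq) (<-≤-trans (+-monoʳ-< i lt) (≤-reflexive i+)) (≤-reflexive (sym i+))
        in₂ : (k , proj₁ sq′) ∈ μ ∖ λ′
        in₂ = skew⇐ {q} _ (proj₂ sq′) (≤-reflexive (trans (sym (+-suc k _)) k+))
                    (≤-trans (≤-reflexive (sym k+)) (+-monoʳ-≤ k lt))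
        result : ∃[ t ] t < r × q ≡ suc p + t × ∑ q β ≡ suc (∑ q γ)
        result with onDiagonals ρ _ in₁
        ... | t , t<r , d = t , t<r , q≡ , +-cancelˡ-≡ i _ _ (trans i+ (trans (sym k+) (cong (_+ suc (∑ q γ)) (sym i≡k))))
          where
          q≡ : q ≡ suc p + t
          q≡ = +-cancelʳ-≡ i _ _ (trans (proj₂ sq) (sym (diagonal⇒ (i , proj₁ sq) t d)))
          d₂ : diagonal (k , proj₁ sq′) ≡ lowest ρ ℤ.+ pos t
          d₂ = diagonal⇐ (k , proj₁ sq′) t (trans (cong (_+ k) (sym q≡)) (proj₂ sq′))
          unique = proj₂ (proj₂ (oneOnEach ρ t<r))
          i≡k : i ≡ k
          i≡k = cong proj₁ (trans (sym (unique (in₁ , d))) (unique (in₂ , d₂)))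

      inside : ∀ q → p < q → q ≤ r + p → ∑ q β ≡ suc (∑ q γ)
      inside q p<q q≤ with oneOnEach ρ {q ∸ suc p} (≤-trans (s≤s (∸-monoˡ-≤ (suc p) q≤)) (≤-reflexive (cong suc (m+n∸n≡m r′ p))))
      ... | s , (s∈ , d) , _ = proj₂ (proj₂ (proj₂ (occupied q (+-cancelˡ-< (row s) _ _ (<-≤-trans (proj₁ both) (proj₂ both))))))
        where
        both = skew⇒ {q} s (trans (cong (_+ row s) (sym (m+[n∸m]≡n p<q))) (diagonal⇒ s _ d)) s∈

      outside : ∀ q → ¬ (p < q × q ≤ r + p) → ∑ q β ≡ ∑ q γ
      outside q out with m≤n⇒m<n∨m≡n (∑-≤ q)
      ... | inj₂ e = sym e
      ... | inj₁ lt with occupied q lt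
      ...   | t , t<r , refl , _ = ⊥-elim (out (s≤s (m≤m+n p t) ,
              ≤-trans (≤-reflexive (cong suc (+-comm p t))) (+-monoˡ-≤ p t<r)))

    ribbon⇒move : ∃[ p ] Move r p β γ × headDiagonal ρ ≡ (r + p) ⊖ n
    ribbon⇒move = p , move-from-sums r p β γ inside outside , headDiagonal≡
      where
      h : Square
      h = head ρ
      h∈ : h ∈ μ ∖ λ′
      h∈ = inSkew (isHead ρ)
      headDiagonal≡ : headDiagonal ρ ≡ (r + p) ⊖ n
      headDiagonal≡ with onDiagonals ρ h h∈ | oneOnEach ρ {r′} ≤-refl
      ... | t , t<r , d | s , (s∈ , e) , _ = ⊖-≡⇐ (col h) (row h) (r + p) n
        (trans (sym (diagonal⇒ h t d)) (cong (_+ row h) (trans (cong (λ x → suc (p + x)) t≡r′) (cong suc (+-comm p r′)))))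
        where
        -- The head is at least as high and at least as far right as the square on the last of the r
        -- diagonals, so its own diagonal cannot be an earlier one.
        t≡r′ : t ≡ r′
        t≡r′ = ≤-antisym (s≤s⁻¹ t<r) (+-cancelˡ-≤ (suc p) _ _ (+-cancelʳ-≤ (row h) _ _ (begin
          suc p + r′ + row h ≤⟨ +-monoʳ-≤ (suc p + r′) (topmost (isHead ρ) s s∈) ⟩
          suc p + r′ + row s ≡⟨ diagonal⇒ s r′ e ⟩
          col s + n          ≤⟨ +-monoˡ-≤ n (rightmost (isHead ρ) s s∈) ⟩
          col h + n          ≡⟨ diagonal⇒ h t d ⟨
          suc p + t + row h  ∎)))
          where open ≤-Reasoning

  module _ {p} (mv : Move r p β γ) where

    private
      position : ∀ s → s ∈ μ ∖ λ′ →
                 ∃[ q ] q + row s ≡ col s + n × (p < q × q ≤ r + p) × row s + ∑ q β ≡ n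
      position s s∈ with positionOf s (∈⇒row< F s (proj₁ s∈))
      ... | q , e with skew⇒ {q} s e s∈
      ...   | lt , ge = q , e , range , ≤-antisym
              (≤-trans (≤-reflexive (trans (cong (row s +_) (∑-move-inside mv (proj₁ range) (proj₂ range))) (+-suc _ _))) lt) ge
        where
        range : p < q × q ≤ r + p
        range = ∑-move-< mv q (+-cancelˡ-< (row s) _ _ (<-≤-trans lt ge))

      squareAt : ∀ q → p < q → q ≤ r + p →
                 Σ[ s ∈ Square ] q + row s ≡ col s + n × row s + ∑ q β ≡ n × s ∈ μ ∖ λ′
      squareAt q p<q q≤ = (i , j) , e , i+ , skew⇐ {q} (i , j) e
        (≤-reflexive (trans (sym (+-suc i _)) (trans (cong (i +_) (sym (∑-move-inside mv p<q q≤))) i+)))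
        (≤-reflexive (sym i+))
        where
        i = n ∸ ∑ q β
        i+ : i + ∑ q β ≡ n
        i+ = m∸n+n≡m (E.bound q)
        sq = squareOn n q i (≤-trans (≤-reflexive (trans (sym i+) (+-comm i _))) (+-monoˡ-≤ i (∑-bits-≤ q β E.bit)))
        j = proj₁ sq
        e = proj₂ sq

      diagonal≡ : ∀ s t → (suc p + t) + row s ≡ col s + n → diagonal s ≡ suc p ⊖ n ℤ.+ pos t
      diagonal≡ s t e = trans (⊖-≡⇐ (col s) (row s) (suc p + t) n (sym e)) (sym (⊖-+ t (suc p) n))

      inRange : ∀ t → t < r → suc p + t ≤ r + p
      inRange t t<r = ≤-trans (≤-reflexive (cong suc (+-comm p t))) (+-monoˡ-≤ p t<r)

    move⇒ribbon : Σ[ ρ ∈ Ribbon r λ′ μ ] headDiagonal ρ ≡ (r + p) ⊖ n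
    move⇒ribbon = record
      { contained   = λ s s∈ → let q , e = positionOf s (∈⇒row< E s s∈) in
          ∈⇐ F {q} s e (≤-<-trans (+-monoʳ-≤ (row s) (∑-move-≤ {r} {p} {β} {γ} mv q)) (∈⇒ E {q} s e s∈))
      ; lowest      = suc p ⊖ n
      ; onDiagonals = on
      ; oneOnEach   = one
      ; head        = h
      ; isHead      = record { inSkew = h∈ ; topmost = top ; rightmost = right }
      } , ⊖-≡⇐ (col h) (row h) (r + p) n (sym he)
      where
      on : ∀ s → s ∈ μ ∖ λ′ → ∃[ t ] t < r × diagonal s ≡ suc p ⊖ n ℤ.+ pos t
      on s s∈ with position s s∈
      ... | q , e , (p<q , q≤) , _ = q ∸ suc p ,
        ≤-trans (s≤s (∸-monoˡ-≤ (suc p) q≤)) (≤-reflexive (cong suc (m+n∸n≡m r′ p))) ,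
        diagonal≡ s (q ∸ suc p) (trans (cong (_+ row s) (m+[n∸m]≡n p<q)) e)
      one : ∀ {t} → t < r → _
      one {t} t<r with squareAt (suc p + t) (s≤s (m≤m+n p t)) (inRange t t<r)
      ... | s , e , i+ , s∈ = s , (s∈ , diagonal≡ s t e) , λ {s′} → unique {s′}
        where
        unique : ∀ {s′} → s′ ∈ μ ∖ λ′ × diagonal s′ ≡ suc p ⊖ n ℤ.+ pos t → s ≡ s′
        unique {s′} (s′∈ , d) with position s′ s′∈
        ... | q , e′ , _ , i′+ = cong₂ _,_ rows (+-cancelʳ-≡ n _ _ (trans (sym e) (trans (cong₂ _+_ (sym q≡) rows) e′)))
          where
          q≡ : q ≡ suc p + t
          q≡ = +-cancelʳ-≡ (row s′) _ _ (trans e′ (⊖-≡⇒ (col s′) (row s′) (suc p + t) n (trans d (⊖-+ t (suc p) n))))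
          rows : row s ≡ row s′
          rows = +-cancelʳ-≡ (∑ q β) _ _ (trans (cong (λ x → row s + ∑ x β) q≡) (trans i+ (sym i′+)))
      -- The head lies on the last diagonal. The square on the diagonal of q is in row n - `∑ q β`,
      -- and this decreases weakly as q grows.
      last = squareAt (r + p) (s≤s (m≤n+m p r′)) ≤-refl
      h : Square
      h = proj₁ last
      he : r + p + row h ≡ col h + n
      he = proj₁ (proj₂ last)
      hi : row h + ∑ (r + p) β ≡ n
      hi = proj₁ (proj₂ (proj₂ last))
      h∈ : h ∈ μ ∖ λ′
      h∈ = proj₂ (proj₂ (proj₂ last))
      top : ∀ s → s ∈ μ ∖ λ′ → row h ≤ row s
      top s s∈ with position s s∈
      ... | q , e , (_ , q≤) , i+ = +-cancelʳ-≤ (∑ q β) _ _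
        (≤-trans (+-monoʳ-≤ (row h) (∑-mono β q≤)) (≤-reflexive (trans hi (sym i+))))
      -- The column is q + row - n, and the row drops by at most one per diagonal because β consists
      -- of bits.
      right : ∀ s → s ∈ μ ∖ λ′ → col s ≤ col h
      right s s∈ with position s s∈
      ... | q , e , (_ , q≤) , i+ = +-cancelʳ-≤ n _ _ (begin
        col s + n                    ≡⟨ e ⟨
        q + row s                    ≤⟨ +-monoʳ-≤ q rows ⟩
        q + (d + row h)              ≡⟨ trans (sym (+-assoc q d (row h))) (cong (_+ row h) (+-comm q d)) ⟩
        d + q + row h                ≡⟨ cong (_+ row h) (m∸n+n≡m q≤) ⟩
        r + p + row h                ≡⟨ he ⟩
        col h + n                    ∎)
        where
        open ≤-Reasoning
        d = r + p ∸ q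
        rows : row s ≤ d + row h
        rows = +-cancelʳ-≤ (∑ q β) _ _ (begin
          row s + ∑ q β          ≡⟨ trans i+ (sym hi) ⟩
          row h + ∑ (r + p) β    ≡⟨ cong (λ x → row h + ∑ x β) (m∸n+n≡m q≤) ⟨
          row h + ∑ (d + q) β    ≤⟨ +-monoʳ-≤ (row h) (∑-grow E q d) ⟩
          row h + (∑ q β + d)    ≡⟨ trans (+-comm (row h) _) (trans (cong (_+ row h) (+-comm (∑ q β) d)) (trans (+-assoc d _ _) (trans (cong (d +_) (+-comm (∑ q β) (row h))) (sym (+-assoc d _ _))))) ⟩
          d + row h + ∑ q β      ∎)

    -- The ribbon runs from row `a`, that of its head, down to row `e` - 1, that of its square on
    -- the lowest diagonal. The prefix sums defining `a` and `e` differ by the beads at p + 1, ...,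
    -- p + r - 1, the vertical edges passed on the way.
    rowsMet-move : rowsMet λ′ μ ∸ 1 ≡ window r′ β p
    rowsMet-move = cong (_∸ 1) (trans (length-filter-applyUpTo Met? (length (parts μ)) (λ i → i)) rows)
      where
      Met : ℕ → Set
      Met i = rowLength λ′ i < rowLength μ i
      Met? : ∀ i → Dec (Met i)
      Met? i = rowLength λ′ i <? rowLength μ i
      a e : ℕ
      a = n ∸ ∑ (r + p) β
      e = suc (n ∸ ∑ (suc p) β)
      source : β p ≡ 1
      source = move-source mv (s≤s z≤n) (E.bit p)
      n-e : ∀ i → i < e → i + ∑ (suc p) β ≤ n
      n-e i i<e = ≤-trans (+-monoˡ-≤ _ (s≤s⁻¹ i<e)) (≤-reflexive (m∸n+n≡m (E.bound (suc p))))
      only : ∀ i → Met i → a ≤ i × i < e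
      only i met with position (i , rowLength λ′ i) (met , <-irrefl refl)
      ... | q , _ , (p<q , q≤) , i+ =
        +-cancelʳ-≤ (∑ (r + p) β) _ _ (≤-trans (≤-reflexive (trans (m∸n+n≡m (E.bound (r + p))) (sym i+)))
                                               (+-monoʳ-≤ i (∑-mono β q≤))) ,
        s≤s (+-cancelʳ-≤ (∑ (suc p) β) _ _ (≤-trans (+-monoʳ-≤ i (∑-mono β p<q))
               (≤-reflexive (trans i+ (sym (m∸n+n≡m (E.bound (suc p))))))))
      all : ∀ i → a ≤ i → i < e → Met i
      all i a≤i i<e = +-cancelʳ-< n _ _ (subst (_< rowLength μ i + n) q+i (F.to i q
          (≤-trans (≤-reflexive (trans (sym (+-suc i _)) (cong (i +_) (sym (∑-move-inside mv p<q q≤))))) small)))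
        where
        i<n : i < n
        i<n = ≤-trans (≤-trans (≤-reflexive (+-comm 1 i)) (+-monoʳ-≤ i (≤-trans (≤-reflexive (sym source)) (m≤n+m (β p) (∑ p β))))) (n-e i i<e)
        -- The first square of row i outside `λ′` lies on the diagonal numbered q - n, so it is
        -- enough that the move lowers the prefix sum at q.
        q : ℕ
        q = rowLength λ′ i + (n ∸ i)
        q+i : q + i ≡ rowLength λ′ i + n
        q+i = trans (+-assoc (rowLength λ′ i) _ i) (cong (rowLength λ′ i +_) (m∸n+n≡m (<⇒≤ i<n)))
        large : n ≤ i + ∑ q β
        large = ≮⇒≥ λ lt → <-irrefl q+i (E.to i q lt)
        p<q : p < q
        p<q = ≰⇒> λ q≤p → <⇒≱ (≤-trans (≤-reflexive (trans (sym (+-suc i _)) (cong (i +_) (trans (+-comm 1 _) (cong (∑ p β +_) (sym source)))))) (n-e i i<e))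
                (≤-trans large (+-monoʳ-≤ i (∑-mono β q≤p)))
        q≤ : q ≤ r + p
        q≤ = ≮⇒≥ λ lt → <⇒≱ (E.from i (r + p) (<-≤-trans (+-monoˡ-< i lt) (≤-reflexive q+i)))
               (≤-trans (≤-reflexive (sym (m∸n+n≡m (E.bound (r + p))))) (+-monoˡ-≤ _ a≤i))
        small : i + ∑ q β ≤ n
        small with q in eq
        ... | zero   = ≤-trans (≤-reflexive (+-identityʳ i)) (<⇒≤ i<n)
        ... | suc q′ = ≤-trans (+-monoʳ-≤ i (≤-trans (+-monoʳ-≤ (∑ q′ β) (E.bit q′)) (≤-reflexive (+-comm _ 1))))
                         (≤-trans (≤-reflexive (+-suc i _))
                            (E.from i q′ (≤-reflexive (trans (cong (_+ i) (sym eq)) q+i))))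
      ∑-window : ∑ (r + p) β ≡ ∑ (suc p) β + window r′ β p
      ∑-window = trans (cong (λ x → ∑ x β) (sym (+-suc r′ p)))
        (trans (∑-split (suc p) r′ β) (cong (∑ (suc p) β +_) (∑-cong r′ λ j _ → cong β (+-suc j p))))
      a<e : a < e
      a<e = s≤s (∸-monoʳ-≤ n (∑-mono β (s≤s (m≤n+m p r′))))
      e≤ : e ≤ length (parts μ)
      e≤ = row<length (parts μ) (≤-<-trans z≤n (all (n ∸ ∑ (suc p) β) (s≤s⁻¹ a<e) ≤-refl))
      rows : ∑ (length (parts μ)) (λ i → ⟦ Met? i ⟧) ≡ suc (window r′ β p)
      rows = +-cancelʳ-≡ n _ _ (begin
        N + n                                  ≡⟨ cong (N +_) (m∸n+n≡m (E.bound (r + p))) ⟨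
        N + (a + ∑ (r + p) β)                  ≡⟨ +-assoc N a _ ⟨
        N + a + ∑ (r + p) β                    ≡⟨ cong₂ _+_ (∑-segment Met? (length (parts μ)) a e (<⇒≤ a<e) e≤ only all) ∑-window ⟩
        e + (∑ (suc p) β + window r′ β p)      ≡⟨ +-assoc e _ _ ⟨
        suc (n ∸ ∑ (suc p) β + ∑ (suc p) β) + window r′ β p  ≡⟨ cong (λ x → suc x + window r′ β p) (m∸n+n≡m (E.bound (suc p))) ⟩
        suc n + window r′ β p                  ≡⟨ cong suc (+-comm n _) ⟩
        suc (window r′ β p) + n                ∎)
        where
        open ≡-Reasoning
        N = ∑ (length (parts μ)) (λ i → ⟦ Met? i ⟧)

    -- By `size-edges` the size and the sum of all prefix sums have a constant total, and the move
    -- lowers exactly r prefix sums by one.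
    size-move : size μ ≡ size λ′ + r
    size-move = +-cancelʳ-≡ (c + (k + r) + B) _ _ (begin
      size μ + (c + (k + r) + B)      ≡⟨ lemma₁ (size μ) c (k + r) B ⟩
      size μ + c + (B + (k + r))      ≡⟨ cong (size μ + c +_) (sym sums) ⟩
      size μ + c + (G + (k + r + r))  ≡⟨ lemma₂ (size μ) c G (k + r) r ⟩
      size μ + c + G + (k + r + r)    ≡⟨ cong (_+ (k + r + r)) (trans (size-edges F Q μ≤Q) (sym (size-edges E Q λ≤Q))) ⟩
      size λ′ + c + B + (k + r + r)   ≡⟨ lemma₃ (size λ′) c B (k + r) r ⟩
      size λ′ + r + (c + (k + r) + B) ∎)
      where
      open ≡-Reasoning
      k Q c B G : ℕ
      k = rowLength λ′ 0 + n + (rowLength μ 0 + n)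
      -- Large enough for both shapes, and of the form that `∑∑δ` needs both at p and at r + p.
      Q = k + r + suc (r + p)
      c = ∑ n (n ∸_)
      B = ∑ Q (λ q → ∑ q β)
      G = ∑ Q (λ q → ∑ q γ)
      λ≤Q : rowLength λ′ 0 + n ≤ Q
      λ≤Q = ≤-trans (m≤m+n (rowLength λ′ 0 + n) _) (≤-trans (m≤m+n k r) (m≤m+n _ _))
      μ≤Q : rowLength μ 0 + n ≤ Q
      μ≤Q = ≤-trans (m≤n+m _ (rowLength λ′ 0 + n)) (≤-trans (m≤m+n k r) (m≤m+n _ _))
      sums : G + (k + r + r) ≡ B + (k + r)
      sums = begin
        G + (k + r + r)                              ≡⟨ cong (G +_) (trans (sym (∑∑δ (k + r + r) p)) (cong (λ x → ∑ x (λ q → ∑ q (δ p))) (lemma₀ (k + r) r p))) ⟩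
        G + ∑ Q (λ q → ∑ q (δ p))                    ≡⟨ ∑-+ Q _ _ ⟨
        ∑ Q (λ q → ∑ q γ + ∑ q (δ p))                ≡⟨ ∑-cong Q (λ q _ → ∑-move {r} {p} {β} {γ} mv q) ⟩
        ∑ Q (λ q → ∑ q β + ∑ q (δ (r + p)))          ≡⟨ ∑-+ Q _ _ ⟩
        B + ∑ Q (λ q → ∑ q (δ (r + p)))              ≡⟨ cong (B +_) (∑∑δ (k + r) (r + p)) ⟩
        B + (k + r)                                  ∎
        where
        lemma₀ : ∀ x y z → x + y + suc z ≡ x + suc (y + z)
        lemma₀ = solve-∀
      lemma₁ : ∀ x y z w → x + (y + z + w) ≡ x + y + (w + z)
      lemma₁ = solve-∀
      lemma₂ : ∀ x y z w v → x + y + (z + (w + v)) ≡ x + y + z + (w + v)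
      lemma₂ = solve-∀
      lemma₃ : ∀ x y z w v → x + y + z + (w + v) ≡ x + v + (y + w + z)
      lemma₃ = solve-∀

-- Ribbon strips as sets of moving beads

shift-zero : ∀ r f p → (∀ q → r + q ≤ p → f q ≡ 0) → shift r f p ≡ 0
shift-zero r f p z = shift-elim r f p (_≡ 0) (λ _ → refl) (λ q e → z q (≤-reflexive e))

∑-extend-≤ : ∀ {P Q f} → P ≤ Q → VanishesFrom P f → ∑ Q f ≡ ∑ P f
∑-extend-≤ {P} {Q} {f} P≤Q z = trans (cong (λ x → ∑ x f) (sym (m∸n+n≡m P≤Q))) (∑-extend (Q ∸ P) z)

pairing-extend-≤ : ∀ r′ {P Q f} g → P ≤ Q → VanishesFrom P f → pairing r′ Q f g ≡ pairing r′ P f g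
pairing-extend-≤ r′ g P≤Q z = ∑-extend-≤ P≤Q λ p P≤p → cong (_* window r′ g p) (z p P≤p)

∑-shift-≤ : ∀ {P} r q f → VanishesFrom P f → r + P ≤ q → ∑ q f ≡ ∑ q (shift r f)
∑-shift-≤ {P} r q f z h = begin
  ∑ q f                           ≡⟨ cong (λ x → ∑ x f) (sym q≡) ⟩
  ∑ (r + (q ∸ r)) f               ≡⟨ ∑-extend r (vanishesFrom-≤ P≤ z) ⟩
  ∑ (q ∸ r) f                     ≡⟨ ∑-shift r (q ∸ r) f ⟨
  ∑ (r + (q ∸ r)) (shift r f)     ≡⟨ cong (λ x → ∑ x (shift r f)) q≡ ⟩
  ∑ q (shift r f)                 ∎
  where
  open ≡-Reasoning
  q≡ : r + (q ∸ r) ≡ q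
  q≡ = m+[n∸m]≡n (≤-trans (m≤m+n r P) h)
  P≤ : P ≤ q ∸ r
  P≤ = +-cancelˡ-≤ r _ _ (≤-trans h (≤-reflexive (sym q≡)))

encodes-functional : ∀ {n λ′ β γ} → Encodes n λ′ β → Encodes n λ′ γ → ∀ p → β p ≡ γ p
encodes-functional {n} {λ′} {β} {γ} E F p = +-cancelˡ-≡ (∑ p β) _ _
  (trans (sums (suc p)) (cong (_+ γ p) (sym (sums p))))
  where
  half : ∀ {β γ} → Encodes n λ′ β → Encodes n λ′ γ → ∀ q → ∑ q γ ≤ ∑ q β
  half {β} {γ} E F q = ≮⇒≥ λ lt → <-irrefl (m∸n+n≡m (Encodes.bound F q))
    (Encodes.from F (n ∸ ∑ q γ) q (Encodes.to E (n ∸ ∑ q γ) q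
      (<-≤-trans (+-monoʳ-< (n ∸ ∑ q γ) lt) (≤-reflexive (m∸n+n≡m (Encodes.bound F q))))))
  sums : ∀ q → ∑ q β ≡ ∑ q γ
  sums q = ≤-antisym (half F E q) (half E F q)

decode-large : ∀ n P β → (∀ p → Bit (β p)) → (∀ Q → P ≤ Q → ∑ Q β ≡ n) → ∃[ λ′ ] Encodes n λ′ β
decode-large n P β bit total = decode n P β bit
  (λ q → ≤-trans (∑-mono β (m≤n+m q P)) (≤-reflexive (total (P + q) (m≤m+n P q)))) (total P ≤-refl)

-- Only the number of beads has to be checked, and exchanging beads at `f` with beads at
-- `shift r f`, in either direction, preserves it.
decode-balanced : ∀ {n λ′ β P} → Encodes n λ′ β → ∀ r γ f → VanishesFrom P f → (∀ p → Bit (γ p)) →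
  (∀ p → γ p + f p ≡ β p + shift r f p) ⊎ (∀ p → γ p + shift r f p ≡ β p + f p) → ∃[ μ ] Encodes n μ γ
decode-balanced {n} {λ′} {β} {P} E r γ f z bit eqs = decode-large n Q₀ γ bit (go eqs)
  where
  Q₀ = rowLength λ′ 0 + n + (r + P)
  go : _ → ∀ Q → Q₀ ≤ Q → ∑ Q γ ≡ n
  go eqs Q h = trans (sums eqs) (∑-total E (≤-trans (m≤m+n (rowLength λ′ 0 + n) (r + P)) h))
    where
    same : ∑ Q f ≡ ∑ Q (shift r f)
    same = ∑-shift-≤ r Q f z (≤-trans (m≤n+m (r + P) (rowLength λ′ 0 + n)) h)
    sums : _ → ∑ Q γ ≡ ∑ Q β
    sums (inj₁ e) = +-cancelʳ-≡ (∑ Q f) _ _ (trans (sym (∑-+ Q γ f)) (trans (∑-cong Q λ p _ → e p)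
      (trans (∑-+ Q β (shift r f)) (cong (∑ Q β +_) (sym same)))))
    sums (inj₂ e) = +-cancelʳ-≡ (∑ Q f) _ _ (trans (cong (∑ Q γ +_) same) (trans (sym (∑-+ Q γ (shift r f)))
      (trans (∑-cong Q λ p _ → e p) (∑-+ Q β f))))

abstract
  decode-move : ∀ {n λ′ β r p} γ → Encodes n λ′ β → (∀ q → Bit (γ q)) → Move r p β γ → ∃[ μ ] Encodes n μ γ
  decode-move {n} {λ′} {β} {r} {p} γ E bit mv = decode-large n (suc (r + p) + (rowLength λ′ 0 + n)) γ bit λ Q h →
    trans (sym (∑-move-outside {r} {p} {β} {γ} mv λ { (_ , Q≤) → <⇒≱ (≤-trans (m≤m+n (suc (r + p)) _) h) Q≤ }))
          (∑-total E (≤-trans (m≤n+m (rowLength λ′ 0 + n) (suc (r + p))) h))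

  move-ribbon : ∀ {r′ n λ′ β Q} γ → Encodes n λ′ β → (∀ q → Bit (γ q)) → Move (suc r′) Q β γ →
    Σ[ μ ∈ Partition ] Encodes n μ γ × Σ[ ρ ∈ Ribbon (suc r′) λ′ μ ] headDiagonal ρ ≡ (suc r′ + Q) ⊖ n
  move-ribbon {r′} {Q = Q} γ E bit mv =
    Product.map₂ (λ F → F , move⇒ribbon E F mv) (decode-move {r = suc r′} {Q} γ E bit mv)

  ribbon-move : ∀ {r′ n λ′ μ β γ} → Encodes n λ′ β → Encodes n μ γ → (ρ : Ribbon (suc r′) λ′ μ) →
    ∃[ p ] Move (suc r′) p β γ × headDiagonal ρ ≡ (suc r′ + p) ⊖ n ×
           height ρ ≡ window r′ β p × size μ ≡ size λ′ + suc r′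
  ribbon-move {r′} E F ρ = Product.map₂
    (λ {p} (mv , hd) → mv , hd , rowsMet-move {r′} E F {p} mv , size-move {r′} E F {p} mv)
    (ribbon⇒move E F ρ)

chain-rowLength : ∀ {r λ′ μ} → Star (Ribbon r) λ′ μ → ∀ i → rowLength λ′ i ≤ rowLength μ i
chain-rowLength ε       i = ≤-refl
chain-rowLength (ρ ◅ c) i = ≤-trans (≮⇒≥ λ lt → <-irrefl refl (contained ρ (i , _) lt)) (chain-rowLength c i)

chain-length : ∀ {r λ′ μ} → Star (Ribbon r) λ′ μ → length (parts λ′) ≤ length (parts μ)
chain-length {λ′ = λ′} {μ} c = entry-0⇒length (positive λ′) _
  (n≤0⇒n≡0 (≤-trans (chain-rowLength c _) (≤-reflexive (entry-beyond (parts μ) ≤-refl))))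

linked-weaken : ∀ {_∼_ : Rel ℤ 0ℓ} → (∀ {x y z} → x ∼ y → y ∼ z → x ∼ z) →
                ∀ {x y zs} → x ∼ y → Linked _∼_ (y ∷ zs) → Linked _∼_ (x ∷ zs)
linked-weaken tr x∼y [-]       = [-]
linked-weaken tr x∼y (y∼z ∷ l) = tr x∼y y∼z ∷ l

-- A vertical strip moves every bead at most once.
record VConfig (r : ℕ) (M K : ℕ → ℕ) : Set where
  field
    fixed moved : ℕ → ℕ
    source : ∀ p → M p ≡ fixed p + moved p
    target : ∀ p → K p ≡ fixed p + shift r moved p
    P      : ℕ
    vanish : VanishesFrom P moved

-- In a horizontal strip a bead may move repeatedly; moved contains every position
-- that it leaves, and visited counts the beads that stay at, reach or pass a position.
record HConfig (r : ℕ) (N K : ℕ → ℕ) : Set where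
  field
    visited moved : ℕ → ℕ
    source : ∀ p → N p + shift r moved p ≡ visited p
    target : ∀ p → K p + moved p ≡ visited p
    bit    : ∀ p → Bit (visited p)
    P      : ℕ
    vanish : VanishesFrom P moved

module Strips (r′ n : ℕ) where

  private
    r : ℕ
    r = suc r′

  -- A vertical strip starts with its rightmost bead. Once at p + r that bead stays, so `V` counts
  -- it as fixed; the combined strip counts it as moved, whence `u` loses it. The first jump passes
  -- only fixed beads, and the later ones start before p and stop short of p + r, so the heights add
  -- up.
  vconfig-cons : ∀ {β β₁ γ p Q} → Move r p β β₁ → p < Q → (V : VConfig r β₁ γ) → VConfig.P V ≡ p →
    Σ[ V′ ∈ VConfig r β γ ] VConfig.P V′ ≡ Q ×
      window r′ β p + pairing r′ p (VConfig.moved V) (VConfig.fixed V) ≡ pairing r′ Q (VConfig.moved V′) (VConfig.fixed V′) ×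
      ∑ Q (VConfig.moved V′) ≡ suc (∑ p (VConfig.moved V))
  vconfig-cons {β} {β₁} {γ} {p} {Q} mv p<Q V refl = record
    { fixed = u ; moved = S ; source = source′ ; target = target′ ; P = Q ; vanish = vanish′ } , refl , heights′ ,
    trans (∑-+ Q S₁ (δ p)) (trans (cong₂ _+_ (∑-extend-≤ (<⇒≤ p<Q) vanish) (∑δ-> Q p<Q)) (+-comm (∑ p S₁) 1))
    where
    open VConfig V renaming (fixed to u₁; moved to S₁) hiding (P)
    u S : ℕ → ℕ
    u q = u₁ q ∸ δ (r + p) q
    S q = S₁ q + δ p q
    end : u₁ (r + p) ≡ 1 + β (r + p)
    end = begin
      u₁ (r + p)                       ≡⟨ +-identityʳ _ ⟨
      u₁ (r + p) + 0                   ≡⟨ cong (u₁ (r + p) +_) (vanish (r + p) (m≤n+m p r)) ⟨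
      u₁ (r + p) + S₁ (r + p)          ≡⟨ source (r + p) ⟨
      β₁ (r + p)                       ≡⟨ +-identityʳ _ ⟨
      β₁ (r + p) + 0                   ≡⟨ cong (β₁ (r + p) +_) (δ-≢ {p} {r + p} (<⇒≢ (s≤s (m≤n+m p r′)))) ⟨
      β₁ (r + p) + δ p (r + p)         ≡⟨ mv (r + p) ⟩
      β (r + p) + δ (r + p) (r + p)    ≡⟨ cong (β (r + p) +_) (δ-refl (r + p)) ⟩
      β (r + p) + 1                    ≡⟨ +-comm _ 1 ⟩
      1 + β (r + p)                    ∎
      where open ≡-Reasoning
    δ≤u₁ : ∀ q → δ (r + p) q ≤ u₁ q
    δ≤u₁ q with r + p ≟ q
    ... | yes refl = ≤-trans (≤-reflexive (δ-refl (r + p))) (≤-trans (s≤s z≤n) (≤-reflexive (sym end)))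
    ... | no ne = ≤-trans (≤-reflexive (δ-≢ ne)) z≤n
    u+δ : ∀ q → u q + δ (r + p) q ≡ u₁ q
    u+δ q = m∸n+n≡m (δ≤u₁ q)
    source′ : ∀ q → β q ≡ u q + S q
    source′ q = +-cancelʳ-≡ (δ (r + p) q) _ _ (begin
      β q + δ (r + p) q                    ≡⟨ mv q ⟨
      β₁ q + δ p q                         ≡⟨ cong (_+ δ p q) (source q) ⟩
      u₁ q + S₁ q + δ p q                  ≡⟨ cong (λ x → x + S₁ q + δ p q) (u+δ q) ⟨
      u q + δ (r + p) q + S₁ q + δ p q     ≡⟨ lemma (u q) (δ (r + p) q) (S₁ q) (δ p q) ⟩
      u q + S q + δ (r + p) q              ∎)
      where
      open ≡-Reasoning
      lemma : ∀ a b c d → a + b + c + d ≡ a + (c + d) + b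
      lemma = solve-∀
    target′ : ∀ q → γ q ≡ u q + shift r S q
    target′ q = begin
      γ q                                        ≡⟨ target q ⟩
      u₁ q + shift r S₁ q                        ≡⟨ cong (_+ shift r S₁ q) (u+δ q) ⟨
      u q + δ (r + p) q + shift r S₁ q           ≡⟨ +-assoc (u q) _ _ ⟩
      u q + (δ (r + p) q + shift r S₁ q)         ≡⟨ cong (u q +_) (+-comm (δ (r + p) q) _) ⟩
      u q + (shift r S₁ q + δ (r + p) q)         ≡⟨ cong (λ x → u q + (shift r S₁ q + x)) (shift-δ r p q) ⟨
      u q + (shift r S₁ q + shift r (δ p) q)     ≡⟨ cong (u q +_) (shift-+ r S₁ (δ p) q) ⟨
      u q + shift r S q                          ∎
      where open ≡-Reasoning
    vanish′ : VanishesFrom Q S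
    vanish′ q Q≤q = cong₂ _+_ (vanish q (≤-trans (<⇒≤ p<Q) Q≤q)) (δ-≢ (<⇒≢ (<-≤-trans p<Q Q≤q)))
    heights′ : window r′ β p + pairing r′ p S₁ u₁ ≡ pairing r′ Q S u
    heights′ = begin
      window r′ β p + pairing r′ p S₁ u₁             ≡⟨ cong₂ _+_ (window-cong r′ p λ q p<q _ → trans (source′ q)
                                                          (+-absorb (u q) (cong₂ _+_ (vanish q (<⇒≤ p<q)) (δ-≢ (<⇒≢ p<q)))))
                                                         (∑-cong p λ q q<p → cong (S₁ q *_) (window-cong r′ q λ q′ _ q′≤ →
                                                           trans (sym (u+δ q′)) (+-absorb (u q′) (δ-≢ {r + p} {q′}
                                                             λ { refl → <⇒≱ q<p (≤-trans (n≤1+n p) (+-cancelˡ-≤ r′ _ _ (≤-trans (≤-reflexive (+-suc r′ p)) q′≤))) })))) ⟩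
      window r′ u p + pairing r′ p S₁ u              ≡⟨ cong (window r′ u p +_) (pairing-extend-≤ r′ u (<⇒≤ p<Q) vanish) ⟨
      window r′ u p + pairing r′ Q S₁ u              ≡⟨ cong (_+ pairing r′ Q S₁ u) (∑-δ Q p<Q (window r′ u)) ⟨
      pairing r′ Q (δ p) u + pairing r′ Q S₁ u       ≡⟨ +-comm (pairing r′ Q (δ p) u) _ ⟩
      pairing r′ Q S₁ u + pairing r′ Q (δ p) u       ≡⟨ pairing-+ˡ r′ Q S₁ (δ p) u ⟨
      pairing r′ Q S u                               ∎
      where open ≡-Reasoning

  add-ribbon : ∀ {a b m m′} → b ≡ a + r → m′ ≡ suc m → b + r * m ≡ a + r * m′
  add-ribbon {a} {m = m} refl refl = trans (+-assoc a r _) (cong (a +_) (sym (*-suc r m)))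

  -- The imaginary head diagonal (r + Q) - n in front of the chain expresses that every bead leaves
  -- a position below Q.
  vstrip-from : ∀ {λ′ μ β γ} → Encodes n λ′ β → Encodes n μ γ → ∀ Q (c : Star (Ribbon r) λ′ μ) →
    Linked ℤ._>_ ((r + Q) ⊖ n ∷ headDiagonals c) →
    Σ[ V ∈ VConfig r β γ ] VConfig.P V ≡ Q ×
      heightSum c ≡ pairing r′ Q (VConfig.moved V) (VConfig.fixed V) ×
      size μ ≡ size λ′ + r * ∑ Q (VConfig.moved V)
  vstrip-from {λ′} {β = β} {γ} E F Q ε _ = record
    { fixed = β ; moved = λ _ → 0
    ; source = λ p → sym (+-identityʳ (β p))
    ; target = λ p → trans (encodes-functional F E p) (sym (+-absorb (β p) (shift-zero r _ p λ _ _ → refl)))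
    ; P = Q ; vanish = λ _ _ → refl } , refl ,
    sym (∑-zero Q λ _ _ → refl) ,
    sym (trans (cong (λ x → size λ′ + r * x) (∑-zero Q λ _ _ → refl)) (+-absorb (size λ′) (*-zeroʳ r)))
  vstrip-from {λ′} {μ} {β} {γ} E F Q (_◅_ {j = λ₁} ρ c) (h> ∷ l)
    with edges-encodes n λ₁ (≤-trans (chain-length c) (length≤ F))
  ... | E₁ with ribbon-move E E₁ ρ
  ... | p , mv , hd , ht , sz
    with vstrip-from E₁ F p c (subst (λ k → Linked ℤ._>_ (k ∷ headDiagonals c)) hd l)
  ... | V , P≡p , heights , sizes
    with vconfig-cons mv (+-cancelˡ-< r p Q (⊖-cancelʳ-< n (subst (ℤ._< (r + Q) ⊖ n) hd h>))) V P≡p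
  ... | V′ , P≡Q , heights′ , sizes′ = V′ , P≡Q ,
    trans (cong₂ _+_ ht heights) heights′ ,
    trans sizes (add-ribbon sz sizes′)

  -- A horizontal strip starts with its leftmost move. The arrival at p + r is already visited in
  -- `H`, so only p is new. Nothing has landed between p and p + r, and later windows lie to the
  -- right of p, so neither kind of window changes.
  hconfig-cons : ∀ {β β₁ γ p} → (∀ q → Bit (β q)) → Move r p β β₁ → (H : HConfig r β₁ γ) →
    (∀ q → q < suc p → HConfig.moved H q ≡ 0) →
    Σ[ H′ ∈ HConfig r β γ ] (∀ q → q < p → HConfig.moved H′ q ≡ 0) ×
      window r′ β p + pairing r′ (HConfig.P H) (HConfig.moved H) (HConfig.visited H) ≡
        pairing r′ (HConfig.P H′) (HConfig.moved H′) (HConfig.visited H′) ×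
      ∑ (HConfig.P H′) (HConfig.moved H′) ≡ suc (∑ (HConfig.P H) (HConfig.moved H))
  hconfig-cons {β} {β₁} {γ} {p} β-bit mv H below = record
    { visited = w ; moved = T ; source = source′ ; target = target′ ; bit = bit′ ; P = P′ ; vanish = vanish′ } ,
    T-below , heights′ ,
    trans (∑-+ P′ T₁ (δ p)) (trans (cong₂ _+_ (∑-extend-≤ (m≤m+n P (suc p)) vanish) (∑δ-> P′ p<P′)) (+-comm (∑ P T₁) 1))
    where
    open HConfig H renaming (visited to w₁; moved to T₁)
    P′ = P + suc p
    w T : ℕ → ℕ
    w q = w₁ q + δ p q
    T q = T₁ q + δ p q
    T-below : ∀ q → q < p → T q ≡ 0
    T-below q q<p = cong₂ _+_ (below q (m<n⇒m<1+n q<p)) (δ-≢ (>⇒≢ q<p))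
    source′ : ∀ q → β q + shift r T q ≡ w q
    source′ q = begin
      β q + shift r T q                        ≡⟨ cong (β q +_) (shift-+ r T₁ (δ p) q) ⟩
      β q + (shift r T₁ q + shift r (δ p) q)   ≡⟨ cong (λ x → β q + (shift r T₁ q + x)) (shift-δ r p q) ⟩
      β q + (shift r T₁ q + δ (r + p) q)       ≡⟨ x∙yz≈xz∙y (β q) (shift r T₁ q) (δ (r + p) q) ⟩
      β q + δ (r + p) q + shift r T₁ q         ≡⟨ cong (_+ shift r T₁ q) (mv q) ⟨
      β₁ q + δ p q + shift r T₁ q              ≡⟨ x∙yz≈xz∙y (β₁ q) (shift r T₁ q) (δ p q) ⟨
      β₁ q + (shift r T₁ q + δ p q)            ≡⟨ +-assoc (β₁ q) _ _ ⟨
      β₁ q + shift r T₁ q + δ p q              ≡⟨ cong (_+ δ p q) (source q) ⟩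
      w q                                      ∎
      where
      open ≡-Reasoning
    target′ : ∀ q → γ q + T q ≡ w q
    target′ q = trans (sym (+-assoc (γ q) (T₁ q) (δ p q))) (cong (_+ δ p q) (target q))
    bit′ : ∀ q → Bit (w q)
    bit′ q with p ≟ q
    ... | no ne   = ≤-trans (≤-reflexive (+-absorb (w₁ q) (δ-≢ ne))) (bit q)
    ... | yes refl = ≤-trans (≤-reflexive (trans (sym (source′ p)) (+-absorb (β p) (shift-zero r T p λ q r+q≤p → T-below q
                       (<-≤-trans (s≤s (m≤n+m q r′)) r+q≤p))))) (β-bit p)
    vanish₁ : VanishesFrom P′ T₁
    vanish₁ = vanishesFrom-≤ (m≤m+n P (suc p)) vanish
    p<P′ : p < P′
    p<P′ = m≤n+m (suc p) P
    vanish′ : VanishesFrom P′ T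
    vanish′ q h = cong₂ _+_ (vanish₁ q h) (δ-≢ (<⇒≢ (<-≤-trans p<P′ h)))
    heights′ : window r′ β p + pairing r′ P T₁ w₁ ≡ pairing r′ P′ T w
    heights′ = begin
      window r′ β p + pairing r′ P T₁ w₁              ≡⟨ cong (window r′ β p +_) (sym (pairing-extend-≤ r′ w₁ (m≤m+n P (suc p)) vanish)) ⟩
      window r′ β p + pairing r′ P′ T₁ w₁             ≡⟨ cong₂ _+_ (window-cong r′ p λ q _ q≤ → sym (trans (sym (source′ q))
                                                           (+-absorb (β q) (shift-zero r T q λ x r+x≤q → T-below x
                                                             (+-cancelˡ-< r′ _ _ (≤-trans r+x≤q q≤))))))
                                                         (∑-cong P′ λ q _ → above q) ⟩
      window r′ w p + pairing r′ P′ T₁ w              ≡⟨ cong (_+ pairing r′ P′ T₁ w) (∑-δ P′ p<P′ (window r′ w)) ⟨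
      pairing r′ P′ (δ p) w + pairing r′ P′ T₁ w      ≡⟨ +-comm (pairing r′ P′ (δ p) w) _ ⟩
      pairing r′ P′ T₁ w + pairing r′ P′ (δ p) w      ≡⟨ pairing-+ˡ r′ P′ T₁ (δ p) w ⟨
      pairing r′ P′ T w                               ∎
      where
      open ≡-Reasoning
      above : ∀ q → T₁ q * window r′ w₁ q ≡ T₁ q * window r′ w q
      above q with q ≤? p
      ... | yes q≤p rewrite below q (s≤s q≤p) = refl
      ... | no q≰p = cong (T₁ q *_) (window-cong r′ q λ q′ q<q′ _ →
              sym (+-absorb (w₁ q′) (δ-≢ (<⇒≢ (<-trans (≰⇒> q≰p) q<q′)))))

  -- With r′ instead of r, the strict inequality after the imaginary first head diagonal says that
  -- every bead leaves a position that is at least Q.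
  hstrip-from : ∀ {λ′ μ β γ} → Encodes n λ′ β → Encodes n μ γ → ∀ Q (c : Star (Ribbon r) λ′ μ) →
    Linked ℤ._<_ ((r′ + Q) ⊖ n ∷ headDiagonals c) →
    Σ[ H ∈ HConfig r β γ ] (∀ q → q < Q → HConfig.moved H q ≡ 0) ×
      heightSum c ≡ pairing r′ (HConfig.P H) (HConfig.moved H) (HConfig.visited H) ×
      size μ ≡ size λ′ + r * ∑ (HConfig.P H) (HConfig.moved H)
  hstrip-from {λ′} {β = β} {γ} E F Q ε _ = record
    { visited = β ; moved = λ _ → 0
    ; source = λ p → +-absorb (β p) (shift-zero r _ p λ _ _ → refl)
    ; target = λ p → trans (+-identityʳ (γ p)) (encodes-functional F E p)
    ; bit = Encodes.bit E
    ; P = 0 ; vanish = λ _ _ → refl } , (λ _ _ → refl) , refl ,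
    sym (+-absorb (size λ′) (*-zeroʳ r))
  hstrip-from {λ′} {μ} {β} {γ} E F Q (_◅_ {j = λ₁} ρ c) (h< ∷ l)
    with edges-encodes n λ₁ (≤-trans (chain-length c) (length≤ F))
  ... | E₁ with ribbon-move E E₁ ρ
  ... | p , mv , hd , ht , sz
    with hstrip-from E₁ F (suc p) c (subst (λ k → Linked ℤ._<_ (k ∷ headDiagonals c))
           (trans hd (cong (_⊖ n) (sym (+-suc r′ p)))) l)
  ... | H , below , heights , sizes
    with hconfig-cons (Encodes.bit E) mv H below
  ... | H′ , below′ , heights′ , sizes′ = H′ ,
    (λ q q<Q → below′ q (<-≤-trans q<Q (+-cancelˡ-≤ r′ Q p
      (s≤s⁻¹ (⊖-cancelʳ-< n (subst ((r′ + Q) ⊖ n ℤ.<_) hd h<)))))) ,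
    trans (cong₂ _+_ ht heights) heights′ ,
    trans sizes (add-ribbon sz sizes′)

  -- The beads of `S` are moved from right to left. The target r + Q of the next one is free: γ, a
  -- bit there, already counts the arriving bead, so no fixed bead is present, and `S` has nothing
  -- left beyond Q.
  vstrip-to : ∀ {λ′ μ β γ} → Encodes n λ′ β → Encodes n μ γ → (u S : ℕ → ℕ) →
    (∀ p → β p ≡ u p + S p) → (∀ p → γ p ≡ u p + shift r S p) → ∀ Q → VanishesFrom Q S →
    Σ[ c ∈ Star (Ribbon r) λ′ μ ] Linked ℤ._>_ ((r + Q) ⊖ n ∷ headDiagonals c)
  vstrip-to {β = β} {γ} E F u S source target zero vanish
    with encodes-injective E F (λ p → trans (source p) (trans (cong (u p +_)
      (trans (vanish p z≤n) (sym (shift-zero r S p λ q _ → vanish q z≤n)))) (sym (target p))))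
  ... | refl = ε , [-]
  vstrip-to {β = β} {γ} E F u S source target (suc Q) vanish with S Q in SQ
  ... | zero = let c , l = vstrip-to E F u S source target Q
                     (λ p Q≤p → Sum.[ (λ Q<p → vanish p Q<p) , (λ { refl → SQ }) ] (m≤n⇒m<n∨m≡n Q≤p))
               in c , linked-weaken (λ y<x z<y → ℤ.<-trans z<y y<x) (ℤ.⊖-monoˡ-< n (+-monoʳ-< r ≤-refl)) l
  ... | suc s = let λ₁ , E₁ , ρ , hd = move-ribbon β₁ E bit₁ mv
                    c , l = vstrip-to E₁ F u₁ S₁ (λ _ → refl) target₁ Q vanish₁
                in ρ ◅ c , subst (λ h → Linked ℤ._>_ ((r + suc Q) ⊖ n ∷ h ∷ headDiagonals c)) (sym hd)
                             (ℤ.⊖-monoˡ-< n (+-monoʳ-< r ≤-refl) ∷ l)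
    where
    u₁ S₁ β₁ : ℕ → ℕ
    u₁ q = u q + δ (r + Q) q
    S₁ q = S q ∸ δ Q q
    β₁ q = u₁ q + S₁ q
    S-bit : ∀ q → Bit (S q)
    S-bit q = ≤-trans (≤-trans (m≤n+m (S q) (u q)) (≤-reflexive (sym (source q)))) (Encodes.bit E q)
    SQ≡1 : S Q ≡ 1
    SQ≡1 = ≤-antisym (S-bit Q) (≤-trans (s≤s z≤n) (≤-reflexive (sym SQ)))
    S₁+δ : ∀ q → S₁ q + δ Q q ≡ S q
    S₁+δ q with Q ≟ q
    ... | yes refl rewrite δ-refl Q | SQ≡1 = refl
    ... | no ne rewrite δ-≢ ne = +-identityʳ (S q)
    S₁≤S : ∀ q → S₁ q ≤ S q
    S₁≤S q = m∸n≤m (S q) (δ Q q)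
    vanish₁ : VanishesFrom Q S₁
    vanish₁ p Q≤p with m≤n⇒m<n∨m≡n Q≤p
    ... | inj₁ Q<p = n≤0⇒n≡0 (≤-trans (S₁≤S p) (≤-reflexive (vanish p Q<p)))
    ... | inj₂ refl rewrite SQ≡1 | δ-refl Q = refl
    mv : Move r Q β β₁
    mv q = trans (lemma (u q) (δ (r + Q) q) (S₁ q) (δ Q q))
             (cong (_+ δ (r + Q) q) (trans (cong (u q +_) (S₁+δ q)) (sym (source q))))
      where
      lemma : ∀ a b c d → a + b + c + d ≡ a + (c + d) + b
      lemma = solve-∀
    u-end : u (r + Q) ≡ 0
    u-end = n≤0⇒n≡0 (+-cancelʳ-≤ 1 _ _ (≤-trans (≤-reflexive (trans (cong (u (r + Q) +_)
      (sym (trans (shift-above r S Q) SQ≡1))) (sym (target (r + Q))))) (Encodes.bit F (r + Q))))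
    bit₁ : ∀ q → Bit (β₁ q)
    bit₁ q with r + Q ≟ q
    ... | yes refl rewrite u-end | δ-refl (r + Q) | vanish₁ (r + Q) (m≤n+m Q r) = ≤-refl
    ... | no ne = ≤-trans (≤-reflexive (cong (_+ S₁ q) (+-absorb (u q) (δ-≢ ne))))
                    (≤-trans (+-monoʳ-≤ (u q) (S₁≤S q)) (≤-trans (≤-reflexive (sym (source q))) (Encodes.bit E q)))
    target₁ : ∀ q → γ q ≡ u₁ q + shift r S₁ q
    target₁ q = begin
      γ q                                              ≡⟨ target q ⟩
      u q + shift r S q                                ≡⟨ cong (u q +_) (shift-cong r (λ p → sym (S₁+δ p)) q) ⟩
      u q + shift r (λ p → S₁ p + δ Q p) q             ≡⟨ cong (u q +_) (trans (shift-+ r S₁ (δ Q) q) (cong (shift r S₁ q +_) (shift-δ r Q q))) ⟩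
      u q + (shift r S₁ q + δ (r + Q) q)               ≡⟨ x∙yz≈xz∙y (u q) _ _ ⟩
      u₁ q + shift r S₁ q                              ∎
      where
      open ≡-Reasoning

  -- The moves are made from left to right, with m positions from Q on still to be examined. The
  -- target of a move is free because `w` is a bit there and counts the arrival.
  hstrip-to : ∀ {λ′ μ β γ} → Encodes n λ′ β → Encodes n μ γ → (w T : ℕ → ℕ) →
    (∀ p → β p + shift r T p ≡ w p) → (∀ p → γ p + T p ≡ w p) → (∀ p → Bit (w p)) →
    ∀ m Q → VanishesFrom (m + Q) T → (∀ q → q < Q → T q ≡ 0) →
    Σ[ c ∈ Star (Ribbon r) λ′ μ ] Linked ℤ._<_ ((r′ + Q) ⊖ n ∷ headDiagonals c)
  hstrip-to {β = β} {γ} E F w T source target bit zero Q vanish below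
    with encodes-injective E F (λ p → trans (sym (+-identityʳ (β p))) (trans (cong (β p +_) (sym (shift-zero r T p λ q _ → zeroes q)))
      (trans (source p) (trans (sym (target p)) (+-absorb (γ p) (zeroes p))))))
    where
    zeroes : ∀ q → T q ≡ 0
    zeroes q with q <? Q
    ... | yes q<Q = below q q<Q
    ... | no q≮Q = vanish q (≮⇒≥ q≮Q)
  ... | refl = ε , [-]
  hstrip-to {β = β} {γ} E F w T source target bit (suc m) Q vanish below with T Q in TQ
  ... | zero = let c , l = hstrip-to E F w T source target bit m (suc Q)
                     (λ p h → vanish p (≤-trans (≤-reflexive (sym (+-suc m Q))) h))
                     (λ q q≤Q → Sum.[ below q , (λ { refl → TQ }) ] (m≤n⇒m<n∨m≡n (s≤s⁻¹ q≤Q)))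
               in c , linked-weaken ℤ.<-trans (ℤ.⊖-monoˡ-< n (+-monoʳ-< r′ ≤-refl)) l
  ... | suc s = let λ₁ , E₁ , ρ , hd = move-ribbon β₁ E bit₁ mv
                    c , l = hstrip-to E₁ F w₁ T₁ source₁ (λ _ → refl) w₁-bit m (suc Q) vanish₁ below₁
                in ρ ◅ c , subst (λ h → Linked ℤ._<_ ((r′ + Q) ⊖ n ∷ h ∷ headDiagonals c))
                             (sym (trans hd (cong (_⊖ n) (sym (+-suc r′ Q)))))
                             (ℤ.⊖-monoˡ-< n (+-monoʳ-< r′ ≤-refl) ∷ l)
    where
    T₁ w₁ β₁ : ℕ → ℕ
    T₁ q = T q ∸ δ Q q
    w₁ q = γ q + T₁ q
    β₁ q = β q + δ (r + Q) q ∸ δ Q q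
    T-bit : ∀ q → Bit (T q)
    T-bit q = ≤-trans (≤-trans (m≤n+m (T q) (γ q)) (≤-reflexive (target q))) (bit q)
    TQ≡1 : T Q ≡ 1
    TQ≡1 = ≤-antisym (T-bit Q) (≤-trans (s≤s z≤n) (≤-reflexive (sym TQ)))
    T₁+δ : ∀ q → T₁ q + δ Q q ≡ T q
    T₁+δ q with Q ≟ q
    ... | yes refl rewrite δ-refl Q | TQ≡1 = refl
    ... | no ne rewrite δ-≢ ne = +-identityʳ (T q)
    below₁ : ∀ q → q < suc Q → T₁ q ≡ 0
    below₁ q q≤Q with m≤n⇒m<n∨m≡n (s≤s⁻¹ q≤Q)
    ... | inj₁ q<Q rewrite below q q<Q = 0∸n≡0 (δ Q q)
    ... | inj₂ refl rewrite TQ≡1 | δ-refl Q = refl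
    vanish₁ : VanishesFrom (m + suc Q) T₁
    vanish₁ p h = n≤0⇒n≡0 (≤-trans (m∸n≤m (T p) (δ Q p)) (≤-reflexive (vanish p (≤-trans (≤-reflexive (sym (+-suc m Q))) h))))
    shift-at : shift r T Q ≡ 0
    shift-at = shift-zero r T Q λ q r+q≤Q → below q (<-≤-trans (s≤s (m≤n+m q r′)) r+q≤Q)
    β-start : 1 ≤ β Q
    β-start = ≤-trans (≤-reflexive (sym TQ≡1)) (≤-trans (m≤n+m (T Q) (γ Q)) (≤-reflexive
      (trans (target Q) (trans (sym (source Q)) (+-absorb (β Q) shift-at)))))
    δ≤ : ∀ q → δ Q q ≤ β q + δ (r + Q) q
    δ≤ q with Q ≟ q
    ... | yes refl = ≤-trans (δ-bit Q Q) (≤-trans β-start (m≤m+n (β Q) _))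
    ... | no ne = ≤-trans (≤-reflexive (δ-≢ ne)) z≤n
    mv : Move r Q β β₁
    mv q = m∸n+n≡m (δ≤ q)
    β-end : β (r + Q) ≡ 0
    β-end = n≤0⇒n≡0 (+-cancelʳ-≤ 1 _ _ (≤-trans (≤-reflexive (trans (cong (β (r + Q) +_)
      (sym (trans (shift-above r T Q) TQ≡1))) (source (r + Q)))) (bit (r + Q))))
    bit₁ : ∀ q → Bit (β₁ q)
    bit₁ q with r + Q ≟ q
    ... | yes refl rewrite β-end | δ-refl (r + Q) = m∸n≤m 1 (δ Q (r + Q))
    ... | no ne = ≤-trans (m∸n≤m _ (δ Q q)) (≤-trans (≤-reflexive (+-absorb (β q) (δ-≢ ne))) (Encodes.bit E q))
    source₁ : ∀ q → β₁ q + shift r T₁ q ≡ w₁ q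
    source₁ q = +-cancelʳ-≡ (δ Q q) _ _ (begin
      β₁ q + shift r T₁ q + δ Q q             ≡⟨ xy∙z≈xz∙y (β₁ q) _ _ ⟩
      β₁ q + δ Q q + shift r T₁ q             ≡⟨ cong (_+ shift r T₁ q) (mv q) ⟩
      β q + δ (r + Q) q + shift r T₁ q        ≡⟨ xy∙z≈x∙zy (β q) _ _ ⟩
      β q + (shift r T₁ q + δ (r + Q) q)      ≡⟨ cong (β q +_) (trans (cong (shift r T₁ q +_) (sym (shift-δ r Q q))) (sym (shift-+ r T₁ (δ Q) q))) ⟩
      β q + shift r (λ p → T₁ p + δ Q p) q    ≡⟨ cong (β q +_) (shift-cong r T₁+δ q) ⟩
      β q + shift r T q                       ≡⟨ trans (source q) (sym (target q)) ⟩
      γ q + T q                               ≡⟨ cong (γ q +_) (T₁+δ q) ⟨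
      γ q + (T₁ q + δ Q q)                    ≡⟨ +-assoc (γ q) _ _ ⟨
      w₁ q + δ Q q                            ∎)
      where
      open ≡-Reasoning
    w₁-bit : ∀ q → Bit (w₁ q)
    w₁-bit q = ≤-trans (+-monoʳ-≤ (γ q) (m∸n≤m (T q) (δ Q q))) (≤-trans (≤-reflexive (target q)) (bit q))

  -- The equation `f` - `shift r f` = β - γ determines `f`. This is the source of the uniqueness of
  -- standardisations.
  moved-unique : ∀ {β γ : ℕ → ℕ} (f g : ℕ → ℕ) → (∀ p → γ p + f p ≡ β p + shift r f p) → (∀ p → γ p + g p ≡ β p + shift r g p) →
                 ∀ p → f p ≡ g p
  moved-unique {β} {γ} f g ef eg = shift-unique r f g (s≤s z≤n) λ p →
    cancel _ _ (cong₂ _+_ (ef p) (sym (eg p)))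
      (identity (γ p) (β p) (f p) (shift r f p) (g p) (shift r g p))
    where
    identity : ∀ k m a a⃗ b b⃗ → a + b⃗ + (m + a⃗ + (k + b)) ≡ b + a⃗ + (k + a + (m + b⃗))
    identity = solve-∀

  vconfig-balance : ∀ {β γ} (V : VConfig r β γ) → ∀ p → γ p + VConfig.moved V p ≡ β p + shift r (VConfig.moved V) p
  vconfig-balance V p = trans (cong (_+ moved p) (target p)) (trans (xy∙z≈xz∙y (fixed p) _ _)
                          (cong (_+ shift r moved p) (sym (source p))))
    where
    open VConfig V

  vconfig-moved : ∀ {β γ} (V V′ : VConfig r β γ) → ∀ p → VConfig.moved V p ≡ VConfig.moved V′ p
  vconfig-moved {β} {γ} V V′ = moved-unique {β} {γ} _ _ (vconfig-balance V) (vconfig-balance V′)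

  hconfig-moved : ∀ {β γ} (H H′ : HConfig r β γ) → ∀ p → HConfig.moved H p ≡ HConfig.moved H′ p
  hconfig-moved {β} {γ} H H′ = moved-unique {β} {γ} _ _ (balance H) (balance H′)
    where
    balance : ∀ {β γ} (H : HConfig r β γ) → ∀ p → γ p + HConfig.moved H p ≡ β p + shift r (HConfig.moved H) p
    balance H p = trans (HConfig.target H p) (sym (HConfig.source H p))

  pairing-unique : ∀ {P P′ f f′ g g′} → VanishesFrom P f → VanishesFrom P′ f′ →
    (∀ p → f p ≡ f′ p) → (∀ p → g p ≡ g′ p) → pairing r′ P f g ≡ pairing r′ P′ f′ g′
  pairing-unique {P} {P′} {f} {f′} {g} {g′} z z′ ef eg = begin
    pairing r′ P f g           ≡⟨ pairing-extend-≤ r′ g (m≤m+n P P′) z ⟨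
    pairing r′ (P + P′) f g    ≡⟨ ∑-cong (P + P′) (λ p _ → cong₂ _*_ (ef p) (window-cong r′ p λ q _ _ → eg q)) ⟩
    pairing r′ (P + P′) f′ g′  ≡⟨ pairing-extend-≤ r′ g′ (m≤n+m P′ P) z′ ⟩
    pairing r′ P′ f′ g′        ∎
    where open ≡-Reasoning

  ∑-unique : ∀ {P P′ f f′} → VanishesFrom P f → VanishesFrom P′ f′ → (∀ p → f p ≡ f′ p) → ∑ P f ≡ ∑ P′ f′
  ∑-unique {P} {P′} {f} {f′} z z′ e = begin
    ∑ P f           ≡⟨ ∑-extend-≤ (m≤m+n P P′) z ⟨
    ∑ (P + P′) f    ≡⟨ ∑-cong (P + P′) (λ p _ → e p) ⟩
    ∑ (P + P′) f′   ≡⟨ ∑-extend-≤ (m≤n+m P′ P) z′ ⟩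
    ∑ P′ f′         ∎
    where open ≡-Reasoning

  module _ {λ′ μ β γ} (E : Encodes n λ′ β) (F : Encodes n μ γ) where

    vstrip-measured : (s : VStrip r λ′ μ) → Σ[ V ∈ VConfig r β γ ]
      heightSum (proj₁ s) ≡ pairing r′ (VConfig.P V) (VConfig.moved V) (VConfig.fixed V) ×
      size μ ≡ size λ′ + r * ∑ (VConfig.P V) (VConfig.moved V)
    vstrip-measured (c , l) with start c l
      where
      start : (c : Star (Ribbon r) λ′ μ) → Linked ℤ._>_ (headDiagonals c) →
              ∃[ Q ] Linked ℤ._>_ ((r + Q) ⊖ n ∷ headDiagonals c)
      start ε       l = 0 , [-]
      start (_◅_ {j = λ₁} ρ c) l =
        let p , _ , hd , _ = ribbon-move E (edges-encodes n λ₁ (≤-trans (chain-length c) (length≤ F))) ρ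
        in suc p , subst (ℤ._< (r + suc p) ⊖ n) (sym hd) (ℤ.⊖-monoˡ-< n (+-monoʳ-< r ≤-refl)) ∷ l
    ... | Q , l′ with vstrip-from E F Q c l′
    ... | V , refl , heights , sizes = V , heights , sizes

    hstrip-measured : (s : HStrip r λ′ μ) → Σ[ H ∈ HConfig r β γ ]
      heightSum (proj₁ s) ≡ pairing r′ (HConfig.P H) (HConfig.moved H) (HConfig.visited H) ×
      size μ ≡ size λ′ + r * ∑ (HConfig.P H) (HConfig.moved H)
    hstrip-measured (c , l) with hstrip-from E F 0 c (start c l)
      where
      start : (c : Star (Ribbon r) λ′ μ) → Linked ℤ._<_ (headDiagonals c) →
              Linked ℤ._<_ ((r′ + 0) ⊖ n ∷ headDiagonals c)
      start ε       l = [-]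
      start (_◅_ {j = λ₁} ρ c) l =
        let p , _ , hd , _ = ribbon-move E (edges-encodes n λ₁ (≤-trans (chain-length c) (length≤ F))) ρ
        in subst ((r′ + 0) ⊖ n ℤ.<_) (sym hd) (ℤ.⊖-monoˡ-< n (s≤s (+-monoʳ-≤ r′ z≤n))) ∷ l
    ... | H , _ , heights , sizes = H , heights , sizes

    -- By uniqueness of `moved` and `fixed`, the height sum of any chain can be read from any
    -- configuration, not just from the one that the chain yields.
    vstrip-measure : (s : VStrip r λ′ μ) (V : VConfig r β γ) →
      heightSum (proj₁ s) ≡ pairing r′ (VConfig.P V) (VConfig.moved V) (VConfig.fixed V) ×
      size μ ≡ size λ′ + r * ∑ (VConfig.P V) (VConfig.moved V)
    vstrip-measure s V with vstrip-measured s
    ... | V₁ , heights , sizes =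
      trans heights (pairing-unique V₁.vanish V.vanish moved≡ fixed≡) ,
      trans sizes (cong (λ x → size λ′ + r * x) (∑-unique V₁.vanish V.vanish moved≡))
      where
      module V = VConfig V
      module V₁ = VConfig V₁
      moved≡ : ∀ p → V₁.moved p ≡ V.moved p
      moved≡ = vconfig-moved V₁ V
      fixed≡ : ∀ p → V₁.fixed p ≡ V.fixed p
      fixed≡ p = +-cancelʳ-≡ (V.moved p) _ _ (trans (cong (V₁.fixed p +_) (sym (moved≡ p)))
                   (trans (sym (V₁.source p)) (V.source p)))

    hstrip-measure : (s : HStrip r λ′ μ) (H : HConfig r β γ) →
      heightSum (proj₁ s) ≡ pairing r′ (HConfig.P H) (HConfig.moved H) (HConfig.visited H) ×
      size μ ≡ size λ′ + r * ∑ (HConfig.P H) (HConfig.moved H)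
    hstrip-measure s H with hstrip-measured s
    ... | H₁ , heights , sizes =
      trans heights (pairing-unique H₁.vanish H.vanish moved≡ visited≡) ,
      trans sizes (cong (λ x → size λ′ + r * x) (∑-unique H₁.vanish H.vanish moved≡))
      where
      module H = HConfig H
      module H₁ = HConfig H₁
      moved≡ : ∀ p → H₁.moved p ≡ H.moved p
      moved≡ = hconfig-moved H₁ H
      visited≡ : ∀ p → H₁.visited p ≡ H.visited p
      visited≡ p = trans (sym (H₁.target p)) (trans (cong (γ p +_) (moved≡ p)) (H.target p))

    abstract
      config⇒vstrip : VConfig r β γ → VStrip r λ′ μ
      config⇒vstrip V = let c , l = vstrip-to E F fixed moved source target P vanish in c , Linked.tail l
        where open VConfig V

      config⇒hstrip : HConfig r β γ → HStrip r λ′ μ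
      config⇒hstrip H =
        let c , l = hstrip-to E F visited moved source target bit P 0
                      (vanishesFrom-≤ (m≤m+n P 0) vanish) (λ _ ()) in c , Linked.tail l
        where open HConfig H

-- Overlays of a horizontal and a vertical strip, and their registers

-- S and T are the positions left in the vertical and in the horizontal strip. They
-- are not determined by M and N, but their difference and v are.
record Overlay (r : ℕ) (M N : ℕ → ℕ) : Set where
  field
    v S T    : ℕ → ℕ
    left     : ∀ p → M p + T p ≡ v p + S p
    right    : ∀ p → N p + shift r T p ≡ v p + shift r S p
    v-bit    : ∀ p → Bit (v p)
    P        : ℕ
    v-vanish : VanishesFrom P v
    S-vanish : VanishesFrom P S
    T-vanish : VanishesFrom P T

-- The overlays of the strips from μ and ν to some κ ...
record IsAbove {r M N} (o : Overlay r M N) : Set where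
  open Overlay o
  field
    T≤v   : ∀ p → T p ≤ v p
    v+S≤1 : ∀ p → v (r + p) + S p ≤ 1

-- ... and of those from some λ to μ and ν.
record IsBelow {r M N} (o : Overlay r M N) : Set where
  open Overlay o
  field
    T≤v   : ∀ p → T p ≤ v (r + p)
    v+S≤1 : ∀ p → v p + S p ≤ 1

module _ {r M N} (o : Overlay r M N) where
  open Overlay o

  module AboveStrips (a : IsAbove o) where
    open IsAbove a

    K : ℕ → ℕ
    K p = v p ∸ T p + shift r S p

    v-T : ∀ p → v p ∸ T p + T p ≡ v p
    v-T p = m∸n+n≡m (T≤v p)

    visited-bit : ∀ p → Bit (v p + shift r S p)
    visited-bit p = shift-elim r S p (λ s → v p + s ≤ 1)
      (λ _ → ≤-trans (≤-reflexive (+-identityʳ (v p))) (v-bit p)) λ { q refl → v+S≤1 q }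

    vconfig : VConfig r M K
    vconfig = record { fixed = λ p → v p ∸ T p ; moved = S ; P = P ; vanish = S-vanish
      ; source = λ p → +-cancelʳ-≡ (T p) _ _ (trans (left p) (trans (cong (_+ S p) (sym (v-T p))) (xy∙z≈xz∙y (v p ∸ T p) (T p) (S p))))
      ; target = λ _ → refl }

    hconfig : HConfig r N K
    hconfig = record { visited = λ p → v p + shift r S p ; moved = T ; bit = visited-bit ; P = P ; vanish = T-vanish
      ; source = right
      ; target = λ p → trans (xy∙z≈xz∙y (v p ∸ T p) (shift r S p) (T p)) (cong (_+ shift r S p) (v-T p)) }

    K-bit : ∀ p → Bit (K p)
    K-bit p = ≤-trans (+-monoˡ-≤ _ (m∸n≤m (v p) (T p))) (visited-bit p)

    -- Relative to v, the vertical strip misses the pairs of S with T, and the horizontal strip has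
    -- the extra pairs of T with the shifted S. By `pairing-shift` these cancel.
    energy : ∀ {r′} → r ≡ suc r′ →
      pairing r′ P S (λ p → v p ∸ T p) + pairing r′ P T (λ p → v p + shift r S p) ≡ pairing r′ P (λ p → S p + T p) v
    energy {r′} refl = begin
      A + pairing r′ P T (λ p → v p + shift r S p)    ≡⟨ cong (A +_) (pairing-+ʳ r′ P T v (shift r S)) ⟩
      A + (B + pairing r′ P T (shift r S))            ≡⟨ cong (λ x → A + (B + x)) (pairing-shift r′ P T S T-vanish) ⟩
      A + (B + pairing r′ P S T)                      ≡⟨ x∙yz≈xz∙y A B _ ⟩
      A + pairing r′ P S T + B                        ≡⟨ cong (_+ B) (sym (pairing-+ʳ r′ P S (λ p → v p ∸ T p) T)) ⟩
      pairing r′ P S (λ p → v p ∸ T p + T p) + B      ≡⟨ cong (_+ B) (pairing-congʳ r′ P {S} v-T) ⟩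
      pairing r′ P S v + B                            ≡⟨ pairing-+ˡ r′ P S T v ⟨
      pairing r′ P (λ p → S p + T p) v                ∎
      where
      open ≡-Reasoning
      A = pairing r′ P S (λ p → v p ∸ T p)
      B = pairing r′ P T v

  module BelowStrips (b : IsBelow o) where
    open IsBelow b

    shift-T≤v : ∀ p → shift r T p ≤ v p
    shift-T≤v p = shift-elim r T p (_≤ v p) (λ _ → z≤n) λ { q refl → T≤v q }

    u L : ℕ → ℕ
    u p = v p ∸ shift r T p
    L p = u p + S p

    v-T : ∀ p → u p + shift r T p ≡ v p
    v-T p = m∸n+n≡m (shift-T≤v p)

    hconfig : HConfig r L M
    hconfig = record { visited = λ p → v p + S p ; moved = T ; bit = v+S≤1 ; P = P ; vanish = T-vanish
      ; source = λ p → trans (xy∙z≈xz∙y (u p) (S p) (shift r T p)) (cong (_+ S p) (v-T p))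
      ; target = left }

    vconfig : VConfig r L N
    vconfig = record { fixed = u ; moved = S ; P = P ; vanish = S-vanish
      ; source = λ _ → refl
      ; target = λ p → +-cancelʳ-≡ (shift r T p) _ _ (trans (right p) (trans (cong (_+ shift r S p) (sym (v-T p)))
                         (xy∙z≈xz∙y (u p) (shift r T p) (shift r S p)))) }

    L-bit : ∀ p → Bit (L p)
    L-bit p = ≤-trans (+-monoˡ-≤ _ (m∸n≤m (v p) (shift r T p))) (v+S≤1 p)

    -- The same cancellation, now between the pairs of T with S and those of S with the shifted T.
    energy : ∀ {r′} → r ≡ suc r′ →
      pairing r′ P T (λ p → v p + S p) + pairing r′ P S u ≡ pairing r′ P (λ p → S p + T p) v
    energy {r′} refl = begin
      pairing r′ P T (λ p → v p + S p) + A            ≡⟨ cong (_+ A) (pairing-+ʳ r′ P T v S) ⟩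
      B + pairing r′ P T S + A                        ≡⟨ cong (λ x → B + x + A) (pairing-shift r′ P S T S-vanish) ⟨
      B + pairing r′ P S (shift r T) + A              ≡⟨ xy∙z≈zy∙x B _ A ⟩
      A + pairing r′ P S (shift r T) + B              ≡⟨ cong (_+ B) (sym (pairing-+ʳ r′ P S u (shift r T))) ⟩
      pairing r′ P S (λ p → u p + shift r T p) + B    ≡⟨ cong (_+ B) (pairing-congʳ r′ P {S} v-T) ⟩
      pairing r′ P S v + B                            ≡⟨ pairing-+ˡ r′ P S T v ⟨
      pairing r′ P (λ p → S p + T p) v                ∎
      where
      open ≡-Reasoning
      A = pairing r′ P S u
      B = pairing r′ P T v

-- As M is `fixed` + S, the sequence v = M - S + T is `fixed` + T. It is a bit since it is bounded
-- by `visited`.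
fromAbove : ∀ {r M N K Q} → (∀ p → Bit (M p)) → VanishesFrom Q M → (V : VConfig r M K) (H : HConfig r N K) →
            Σ[ o ∈ Overlay r M N ] Σ[ a ∈ IsAbove o ] (∀ p → AboveStrips.K o a p ≡ K p)
fromAbove {r} {M} {N} {K} {Q} M-bit M-vanish V H = record
  { v = λ p → fixed p + T p ; S = S ; T = T
  ; left = λ p → trans (cong (_+ T p) (V.source p)) (xy∙z≈xz∙y (fixed p) (S p) (T p))
  ; right = λ p → trans (H.source p) (sym (visited≡ p))
  ; v-bit = λ p → ≤-trans (m≤m+n _ (shift r S p)) (≤-trans (≤-reflexive (visited≡ p)) (H.bit p))
  ; P = P ; v-vanish = λ p h → cong₂ _+_ (fixed-vanish p h) (T-vanish p h) ; S-vanish = S-vanish ; T-vanish = T-vanish } ,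
  record
  { T≤v = λ p → m≤n+m (T p) (fixed p)
  ; v+S≤1 = λ p → ≤-trans (≤-reflexive (trans (cong (fixed (r + p) + T (r + p) +_) (sym (shift-above r S p))) (visited≡ (r + p))))
                          (H.bit (r + p)) } ,
  λ p → trans (cong (_+ shift r S p) (m+n∸n≡m (fixed p) (T p))) (sym (V.target p))
  where
  module V = VConfig V
  module H = HConfig H
  open V using (fixed) renaming (moved to S)
  open H using () renaming (moved to T)
  P = V.P + H.P + Q
  visited≡ : ∀ p → fixed p + T p + shift r S p ≡ H.visited p
  visited≡ p = trans (xy∙z≈xz∙y (fixed p) (T p) (shift r S p)) (trans (cong (_+ T p) (sym (V.target p))) (H.target p))
  S-vanish : VanishesFrom P S
  S-vanish = vanishesFrom-≤ (≤-trans (m≤m+n V.P H.P) (m≤m+n _ Q)) V.vanish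
  T-vanish : VanishesFrom P T
  T-vanish = vanishesFrom-≤ (≤-trans (m≤n+m H.P V.P) (m≤m+n _ Q)) H.vanish
  fixed-vanish : VanishesFrom P fixed
  fixed-vanish p h = m+n≡0⇒m≡0 (fixed p) (trans (sym (V.source p)) (M-vanish p (≤-trans (m≤n+m Q _) h)))

-- Here v is found from N = `fixed` + `shift r S`, by exchanging the arrivals of S for those of T.
fromBelow : ∀ {r M N L Q} → VanishesFrom Q N → (H : HConfig r L M) (V : VConfig r L N) →
            Σ[ o ∈ Overlay r M N ] Σ[ b ∈ IsBelow o ] (∀ p → BelowStrips.L o b p ≡ L p)
fromBelow {r} {M} {N} {L} {Q} N-vanish H V = record
  { v = v ; S = S ; T = T
  ; left = λ p → trans (H.target p) (sym (visited≡ p))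
  ; right = λ p → trans (cong (_+ shift r T p) (V.target p)) (xy∙z≈xz∙y (fixed p) (shift r S p) (shift r T p))
  ; v-bit = λ p → ≤-trans (m≤m+n (v p) (S p)) (≤-trans (≤-reflexive (visited≡ p)) (H.bit p))
  ; P = P ; v-vanish = v-vanish ; S-vanish = S-vanish ; T-vanish = T-vanish } ,
  record
  { T≤v = λ p → ≤-trans (≤-reflexive (sym (shift-above r T p))) (m≤n+m _ (fixed (r + p)))
  ; v+S≤1 = λ p → ≤-trans (≤-reflexive (visited≡ p)) (H.bit p) } ,
  λ p → trans (cong (_+ S p) (m+n∸n≡m (fixed p) (shift r T p))) (sym (V.source p))
  where
  module V = VConfig V
  module H = HConfig H
  open V using (fixed) renaming (moved to S)
  open H using () renaming (moved to T)
  v : ℕ → ℕ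
  v p = fixed p + shift r T p
  -- The summand r makes room for the shifted T contained in `v`.
  P = r + (V.P + H.P + Q)
  visited≡ : ∀ p → v p + S p ≡ H.visited p
  visited≡ p = trans (xy∙z≈xz∙y (fixed p) (shift r T p) (S p)) (trans (cong (_+ shift r T p) (sym (V.source p))) (H.source p))
  S-vanish : VanishesFrom P S
  S-vanish = vanishesFrom-≤ (≤-trans (≤-trans (m≤m+n V.P H.P) (m≤m+n _ Q)) (m≤n+m _ r)) V.vanish
  T-vanish₀ : VanishesFrom (V.P + H.P + Q) T
  T-vanish₀ = vanishesFrom-≤ (≤-trans (m≤n+m H.P V.P) (m≤m+n _ Q)) H.vanish
  T-vanish : VanishesFrom P T
  T-vanish = vanishesFrom-≤ (m≤n+m _ r) T-vanish₀
  v-vanish : VanishesFrom P v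
  v-vanish p h = cong₂ _+_
    (m+n≡0⇒m≡0 (fixed p) (trans (sym (V.target p)) (N-vanish p (≤-trans (≤-trans (m≤n+m Q _) (m≤n+m _ r)) h))))
    (shift-elim r T p (_≡ 0) (λ _ → refl) λ { q refl → T-vanish₀ q (+-cancelˡ-≤ r _ _ h) })

module _ {r M N} (o o′ : Overlay r M N) where
  private
    module O = Overlay o
    module O′ = Overlay o′

  -- Eliminating v from `left` and `right` gives M - N = (S - T) - `shift r` (S - T), so
  -- `shift-unique` applies.
  overlay-difference : 0 < r → ∀ p → O.S p + O′.T p ≡ O′.S p + O.T p
  overlay-difference 0<r = shift-unique r _ _ 0<r λ p →
    trans (cong (O.S p + O′.T p +_) (shift-+ r O′.S O.T p)) (trans
      (cancel _ _ (cong₂ _+_ (sym (cong₂ _+_ (O.left p) (O′.right p))) (cong₂ _+_ (O′.left p) (O.right p)))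
        (identity (M p) (N p) (O.v p) (O′.v p) (O.S p) (O.T p) (O′.S p) (O′.T p)
                  (shift r O.S p) (shift r O.T p) (shift r O′.S p) (shift r O′.T p)))
      (cong (O′.S p + O.T p +_) (sym (shift-+ r O.S O′.T p))))
    where
    identity : ∀ m n v v′ s t s′ t′ s⃗ t⃗ s⃗′ t⃗′ →
      s + t′ + (s⃗′ + t⃗) + (m + t + (n + t⃗′) + (v′ + s′ + (v + s⃗))) ≡
      s′ + t + (s⃗ + t⃗′) + (v + s + (v′ + s⃗′) + (m + t′ + (n + t⃗)))
    identity = solve-∀

  overlay-v : 0 < r → ∀ p → O.v p ≡ O′.v p
  overlay-v 0<r p = cancel _ _ (cong₂ _+_ (sym (O.left p)) (cong₂ _+_ (O′.left p) (sym (overlay-difference 0<r p))))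
    (identity (M p) (O.v p) (O′.v p) (O.S p) (O.T p) (O′.S p) (O′.T p))
    where
    identity : ∀ m v v′ s t s′ t′ →
      v + (m + t + (v′ + s′ + (s + t′))) ≡ v′ + (v + s + (m + t′ + (s′ + t)))
    identity = solve-∀

-- Reading from right to left, the bit chosen at a descent of v is stored in the
-- register for its level k, until it is released at the next ascent of that level;
-- c and c′ are the registers to the left and right of position p, and x = v p,
-- y = v (p + r).  Unprimed bits belong to κ, primed ones to λ.
data Step (k : ℕ) (c c′ : ℕ → ℕ) : (x y s t s′ t′ : ℕ) → Set where
  down : ∀ e → c k ≡ e → c′ k ≡ 0 → (∀ i → i ≢ k → c i ≡ c′ i) → Step k c c′ 1 0 e e 0 0
  up   : ∀ e → c k ≡ 0 → c′ k ≡ e → (∀ i → i ≢ k → c i ≡ c′ i) → Step k c c′ 0 1 0 0 e e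
  flat : ∀ x s t → (∀ i → c i ≡ c′ i) → Step k c c′ x x s t s t

-- Reversing the reading direction exchanges ascents with descents and κ with λ. Every lemma about
-- one direction thereby gives one about the other.
step-sym : ∀ {k c c′ x y s t s′ t′} → Step k c c′ x y s t s′ t′ → Step k c′ c y x s′ t′ s t
step-sym (down e ck c′k off) = up e c′k ck λ i i≢k → sym (off i i≢k)
step-sym (up e ck c′k off)   = down e c′k ck λ i i≢k → sym (off i i≢k)
step-sym (flat x s t eq)     = flat x s t (sym ∘ eq)

-- Determinism from left to right: a descent must release the content of register k, an ascent must
-- store the given bit. Through `step-sym` it also gives determinism from right to left.
step-unique : ∀ {k c c′ d d′ x y s t s′ t′ u w} → Step k c c′ x y s t s′ t′ → Step k d d′ x y u w s′ t′ →
              (∀ i → c i ≡ d i) → (∀ i → c′ i ≡ d′ i) × s ≡ u × t ≡ w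
step-unique {k} {c′ = c′} {d′ = d′} (down e ck c′k off) (down e₁ dk d′k off₁) eq = registers , e≡ , e≡
  where
  e≡ : e ≡ e₁
  e≡ = trans (sym ck) (trans (eq k) dk)
  registers : ∀ i → c′ i ≡ d′ i
  registers i with i ≟ k
  ... | yes refl = trans c′k (sym d′k)
  ... | no i≢k = trans (sym (off i i≢k)) (trans (eq i) (off₁ i i≢k))
step-unique {k} {c′ = c′} {d′ = d′} (up e ck c′k off) (up .e dk d′k off₁) eq = registers , refl , refl
  where
  registers : ∀ i → c′ i ≡ d′ i
  registers i with i ≟ k
  ... | yes refl = trans c′k (sym d′k)
  ... | no i≢k = trans (sym (off i i≢k)) (trans (eq i) (off₁ i i≢k))
step-unique (flat x s t e) (flat .x .s .t e₁) eq = (λ i → trans (sym (e i)) (trans (eq i) (e₁ i))) , refl , refl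

-- A stored or released bit belongs to S and to T alike, so S - T is the same above and below; `M`
-- and `N` require this.
step-difference : ∀ {k c c′ x y s t s′ t′} → Step k c c′ x y s t s′ t′ → s + t′ ≡ s′ + t
step-difference (down e _ _ _) = +-identityʳ e
step-difference (up e _ _ _)   = sym (+-identityʳ e)
step-difference (flat x s t _) = refl

step-above : ∀ {k c c′ x y s t s′ t′} → Step k c c′ x y s t s′ t′ → (∀ i → Bit (c i)) →
             t′ ≤ y × x + s′ ≤ 1 → t ≤ x × y + s ≤ 1
step-above {k} (down e refl _ _) bit _ = bit k , bit k
step-above (up e _ _ _) bit _ = z≤n , ≤-refl
step-above (flat x s t _) bit h = h

step-below : ∀ {k c c′ x y s t s′ t′} → Step k c c′ x y s t s′ t′ → (∀ i → Bit (c′ i)) →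
             t ≤ x × y + s ≤ 1 → t′ ≤ y × x + s′ ≤ 1
step-below st = step-above (step-sym st)

update : ℕ → ℕ → (ℕ → ℕ) → ℕ → ℕ
update k e c i with i ≟ k
... | yes _ = e
... | no _  = c i

update-at : ∀ k e c → update k e c k ≡ e
update-at k e c with k ≟ k
... | yes _ = refl
... | no ne = ⊥-elim (ne refl)

update-off : ∀ k e c i → i ≢ k → update k e c i ≡ c i
update-off k e c i i≢k with i ≟ k
... | yes i≡k = ⊥-elim (i≢k i≡k)
... | no _    = refl

update-all : ∀ (A : ℕ → Set) k e c → A e → (∀ i → A (c i)) → ∀ i → A (update k e c i)
update-all A k e c a all i with i ≟ k
... | yes _ = a
... | no _  = all i

-- The scan from left to right: a descent empties the register of its level into κ, an ascent fills
-- it with the bit from λ. The scan from right to left is the same with x and y exchanged. `emit` is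
-- the bit produced.
next : (k x y s : ℕ) (c : ℕ → ℕ) → ℕ → ℕ
next k (suc _) zero    s c = update k 0 c
next k zero    (suc _) s c = update k s c
next k zero    zero    s c = c
next k (suc _) (suc _) s c = c

emit : (k x y s : ℕ) (c : ℕ → ℕ) → ℕ
emit k (suc _) zero    s c = c k
emit k zero    (suc _) s c = 0
emit k zero    zero    s c = s
emit k (suc _) (suc _) s c = s

-- Registers from the level x + k on are empty. Hence register k is free when an ascent (x = 0)
-- wants to fill it, and emptying it at a descent restores the invariant for the new level k + y.
step-next : ∀ {k x y s t c} → Bit x → Bit y → Bit s → t ≤ y → x + s ≤ 1 → y + s ≤ 1 + t → t ≤ x + s →
            VanishesFrom (x + k) c → (∀ i → Bit (c i)) →
            Step k c (next k x y s c) x y (emit k x y s c) (emit k x y t c) s t ×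
            VanishesFrom (k + y) (next k x y s c) × (∀ i → Bit (next k x y s c i))
step-next {k} {c = c} z≤n z≤n bs t≤y xs ys t≤ z b =
  flat 0 _ _ (λ _ → refl) , (λ i h → z i (≤-trans (≤-reflexive (sym (+-identityʳ k))) h)) , b
step-next {k} {c = c} (s≤s z≤n) (s≤s z≤n) bs t≤y xs ys t≤ z b =
  flat 1 _ _ (λ _ → refl) , (λ i h → z i (≤-trans (≤-reflexive (+-comm 1 k)) h)) , b
step-next {k} {c = c} (s≤s z≤n) z≤n bs z≤n (s≤s z≤n) ys t≤ z b =
  down (c k) refl (update-at k 0 c) (λ i i≢k → sym (update-off k 0 c i i≢k)) , vanish , update-all Bit k 0 c z≤n b
  where
  vanish : VanishesFrom (k + 0) (update k 0 c)
  vanish i h with i ≟ k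
  ... | yes _ = refl
  ... | no i≢k = z i (≤∧≢⇒< (≤-trans (≤-reflexive (sym (+-identityʳ k))) h) (i≢k ∘ sym))
-- At an ascent the last two bounds read s ≤ t and t ≤ s, so a single stored bit describes both.
step-next {k} {s = s} {t} {c} z≤n (s≤s z≤n) bs t≤y xs ys t≤ z b with ≤-antisym (s≤s⁻¹ ys) t≤
... | refl = up s (z k ≤-refl) (update-at k s c) (λ i i≢k → sym (update-off k s c i i≢k)) , vanish , update-all Bit k s c bs b
  where
  vanish : VanishesFrom (k + 1) (update k s c)
  vanish i h with i ≟ k
  ... | yes refl = ⊥-elim (<⇒≱ ≤-refl (≤-trans (≤-reflexive (+-comm 1 k)) h))
  ... | no _ = z i (≤-trans (m≤m+n k 1) h)

step-level : ∀ {k c c′ s t s′ t′} → Step k c c′ 0 0 s t s′ t′ → s ≡ s′ × t ≡ t′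
step-level (flat .0 s t _) = refl , refl

-- A complete run of the registers. `vanish` confines the loaded ones to levels below the number of
-- beads of v among the r positions from p on.
record Flow (r′ : ℕ) (v S T S′ T′ : ℕ → ℕ) (c : ℕ → ℕ → ℕ) : Set where
  field
    step   : ∀ p → Step (window r′ v p) (c p) (c (suc p)) (v p) (v (suc r′ + p)) (S p) (T p) (S′ p) (T′ p)
    vanish : ∀ p → VanishesFrom (v p + window r′ v p) (c p)
    bit    : ∀ p i → Bit (c p i)

module _ {r′ : ℕ} {v S T : ℕ → ℕ} (v-bit : ∀ p → Bit (v p)) where

  private
    r : ℕ
    r = suc r′
    W : ℕ → ℕ
    W = window r′ v

  flow-from-start : (∀ p → Bit (S p)) → (∀ p → T p ≤ v (r + p)) → (∀ p → v p + S p ≤ 1) →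
    (∀ p → v (r + p) + S p ≤ 1 + T p) → (∀ p → T p ≤ v p + S p) →
    ∀ a → VanishesFrom (v 0 + W 0) a → (∀ i → Bit (a i)) →
    ∃[ S₁ ] ∃[ T₁ ] ∃[ c ] Flow r′ v S₁ T₁ S T c × (∀ i → c 0 i ≡ a i)
  flow-from-start bs t≤y xs ys t≤ a a-vanish a-bit = _ , _ , c , record
    { step = λ p → proj₁ (steps p) ; vanish = λ p → proj₁ (inv p) ; bit = λ p → proj₂ (inv p) } , λ _ → refl
    where
    c : ℕ → ℕ → ℕ
    c zero    = a
    c (suc p) = next (W p) (v p) (v (r + p)) (S p) (c p)
    step′ : ∀ p → VanishesFrom (v p + W p) (c p) × (∀ i → Bit (c p i)) → _
    step′ p (z , b) = step-next {W p} {v p} {v (r + p)} {S p} {T p} {c p}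
      (v-bit p) (v-bit (r + p)) (bs p) (t≤y p) (xs p) (ys p) (t≤ p) z b
    inv : ∀ p → VanishesFrom (v p + W p) (c p) × (∀ i → Bit (c p i))
    inv zero    = a-vanish , a-bit
    inv (suc p) = subst (λ h → VanishesFrom h (c (suc p))) (window-shift r′ v p) (proj₁ (proj₂ (step′ p (inv p)))) ,
                  proj₂ (proj₂ (step′ p (inv p)))
    steps : ∀ p → _
    steps p = step′ p (inv p)

  flow-from-end : (∀ p → Bit (S p)) → (∀ p → T p ≤ v p) → (∀ p → v (r + p) + S p ≤ 1) →
    (∀ p → v p + S p ≤ 1 + T p) → (∀ p → T p ≤ v (r + p) + S p) → ∀ {P} → VanishesFrom P v →
    ∃[ S₁ ] ∃[ T₁ ] ∃[ c ] Flow r′ v S T S₁ T₁ c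
  flow-from-end bs t≤y xs ys t≤ {P} v-vanish = S₁ , T₁ , c , record
    { step = steps ; vanish = λ p → proj₁ (inv (P ∸ p) p) ; bit = λ p → proj₂ (inv (P ∸ p) p) }
    where
    -- `back m p` holds the registers at p when the scan enters p + m from the right with empty
    -- registers. Starting at P is enough: from there on v has no beads and all steps are level.
    back : ℕ → ℕ → ℕ → ℕ
    back zero    p = λ _ → 0
    back (suc m) p = next (W p) (v (r + p)) (v p) (S p) (back m (suc p))
    c : ℕ → ℕ → ℕ
    c p = back (P ∸ p) p
    S₁ T₁ : ℕ → ℕ
    S₁ p = emit (W p) (v (r + p)) (v p) (S p) (c (suc p))
    T₁ p = emit (W p) (v (r + p)) (v p) (T p) (c (suc p))
    inv : ∀ m p → VanishesFrom (v p + W p) (back m p) × (∀ i → Bit (back m p i))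
    step′ : ∀ m p → Step (W p) (back m (suc p)) (back (suc m) p) (v (r + p)) (v p)
                      (emit (W p) (v (r + p)) (v p) (S p) (back m (suc p)))
                      (emit (W p) (v (r + p)) (v p) (T p) (back m (suc p))) (S p) (T p) ×
                    VanishesFrom (W p + v p) (back (suc m) p) × (∀ i → Bit (back (suc m) p i))
    step′ m p = step-next {W p} {v (r + p)} {v p} {S p} {T p} {back m (suc p)}
      (v-bit (r + p)) (v-bit p) (bs p) (t≤y p) (xs p) (ys p) (t≤ p)
      (subst (λ h → VanishesFrom h (back m (suc p))) (trans (sym (window-shift r′ v p)) (+-comm (W p) _)) (proj₁ (inv m (suc p))))
      (proj₂ (inv m (suc p)))
    inv zero    p = (λ _ _ → refl) , λ _ → z≤n
    inv (suc m) p = subst (λ h → VanishesFrom h (back (suc m) p)) (+-comm (W p) (v p)) (proj₁ (proj₂ (step′ m p))) ,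
                    proj₂ (proj₂ (step′ m p))
    steps : ∀ p → Step (W p) (c p) (c (suc p)) (v p) (v (r + p)) (S p) (T p) (S₁ p) (T₁ p)
    steps p with P ≤? p
    ... | no P≰p = subst (λ m → Step (W p) (back m p) (c (suc p)) (v p) (v (r + p)) (S p) (T p) (S₁ p) (T₁ p))
                     (sym (+-∸-assoc 1 (≰⇒> P≰p))) (step-sym (proj₁ (step′ (P ∸ suc p) p)))
    ... | yes P≤p rewrite v-vanish p P≤p | v-vanish (r + p) (≤-trans P≤p (m≤n+m p r))
                        | m≤n⇒m∸n≡0 P≤p | m≤n⇒m∸n≡0 (≤-trans P≤p (n≤1+n p)) = flat 0 (S p) (T p) λ _ → refl

module _ {r′ v S T S′ T′ c} (φ : Flow r′ v S T S′ T′ c) where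
  open Flow φ

  private
    W : ℕ → ℕ
    W = window r′ v

  flow-difference : ∀ p → S p + T′ p ≡ S′ p + T p
  flow-difference p = step-difference (step p)

  flow-level : ∀ {P} → VanishesFrom P v → ∀ p → P ≤ p → S p ≡ S′ p × T p ≡ T′ p
  flow-level v-vanish p P≤p = step-level (subst₂ (λ x y → Step (W p) (c p) (c (suc p)) x y (S p) (T p) (S′ p) (T′ p))
    (v-vanish p P≤p) (v-vanish (suc r′ + p) (≤-trans P≤p (m≤n+m p (suc r′)))) (step p))

  flow-end : ∀ {P} → VanishesFrom P v → ∀ i → c P i ≡ 0
  flow-end {P} v-vanish i = vanish P i (≤-trans (≤-reflexive (cong₂ _+_ (v-vanish P ≤-refl)
    (∑-zero r′ λ j _ → v-vanish (suc j + P) (m≤n+m P (suc j))))) z≤n)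

  -- A bit passes between the register of level k and a position whose window has value k, so
  -- weighing it by `f k` in either place gives a conserved total.
  step-weight : ∀ (f : ℕ → ℕ) {R} p → W p < R →
    ∑ R (λ i → f i * c p i) + f (W p) * T′ p ≡ ∑ R (λ i → f i * c (suc p) i) + f (W p) * T p
  step-weight f {R} p k<R = go k<R (step p)
    where
    balance : ∀ {k} (d d′ : ℕ → ℕ) → k < R → (∀ i → i ≢ k → d i ≡ d′ i) →
              ∑ R (λ i → f i * d i) + f k * d′ k ≡ ∑ R (λ i → f i * d′ i) + f k * d k
    balance {k} d d′ k<R off = begin
      ∑ R (λ i → f i * d i) + f k * d′ k                               ≡⟨ cong (∑ R (λ i → f i * d i) +_) (∑-δ R k<R (λ i → f i * d′ i)) ⟨
      ∑ R (λ i → f i * d i) + ∑ R (λ i → δ k i * (f i * d′ i))         ≡⟨ ∑-+ R _ _ ⟨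
      ∑ R (λ i → f i * d i + δ k i * (f i * d′ i))                     ≡⟨ ∑-cong R (λ i _ → pointwise i) ⟩
      ∑ R (λ i → f i * d′ i + δ k i * (f i * d i))                     ≡⟨ ∑-+ R _ _ ⟩
      ∑ R (λ i → f i * d′ i) + ∑ R (λ i → δ k i * (f i * d i))         ≡⟨ cong (∑ R (λ i → f i * d′ i) +_) (∑-δ R k<R (λ i → f i * d i)) ⟩
      ∑ R (λ i → f i * d′ i) + f k * d k                               ∎
      where
      open ≡-Reasoning
      pointwise : ∀ i → f i * d i + δ k i * (f i * d′ i) ≡ f i * d′ i + δ k i * (f i * d i)
      pointwise i with i ≟ k
      ... | yes refl rewrite δ-refl i | +-identityʳ (f i * d i) | +-identityʳ (f i * d′ i) = +-comm (f i * d i) _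
      ... | no i≢k rewrite off i i≢k = refl
    go : ∀ {k x y s t s′ t′} → k < R → Step k (c p) (c (suc p)) x y s t s′ t′ →
         ∑ R (λ i → f i * c p i) + f k * t′ ≡ ∑ R (λ i → f i * c (suc p) i) + f k * t
    go {k} k<R (down e ck c′k off) = subst₂
      (λ a b → ∑ R (λ i → f i * c p i) + f k * b ≡ ∑ R (λ i → f i * c (suc p) i) + f k * a) ck c′k
      (balance (c p) (c (suc p)) k<R off)
    go {k} k<R (up e ck c′k off) = subst₂
      (λ a b → ∑ R (λ i → f i * c p i) + f k * b ≡ ∑ R (λ i → f i * c (suc p) i) + f k * a) ck c′k
      (balance (c p) (c (suc p)) k<R off)
    go {k} {t = t} k<R (flat x s t eq) = cong (_+ f k * t) (∑-cong R λ i _ → cong (f i *_) (eq i))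

  flow-weight : ∀ (f : ℕ → ℕ) {R} → (∀ p → W p < R) → ∀ P →
    ∑ R (λ i → f i * c 0 i) + ∑ P (λ p → f (W p) * T′ p) ≡ ∑ R (λ i → f i * c P i) + ∑ P (λ p → f (W p) * T p)
  flow-weight f W<R zero    = refl
  flow-weight f {R} W<R (suc P) = begin
    A + (B + b)      ≡⟨ +-assoc A B b ⟨
    A + B + b        ≡⟨ cong (_+ b) (flow-weight f W<R P) ⟩
    C + D + b        ≡⟨ xy∙z≈xz∙y C D b ⟩
    C + b + D        ≡⟨ cong (_+ D) (step-weight f P (W<R P)) ⟩
    E + d + D        ≡⟨ xy∙z≈x∙zy E d D ⟩
    E + (D + d)      ∎
    where
    open ≡-Reasoning
    A = ∑ R (λ i → f i * c 0 i)
    B = ∑ P (λ p → f (W p) * T′ p)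
    b = f (W P) * T′ P
    C = ∑ R (λ i → f i * c P i)
    D = ∑ P (λ p → f (W p) * T p)
    d = f (W P) * T P
    E = ∑ R (λ i → f i * c (suc P) i)

  module _ (v-bit : ∀ p → Bit (v p)) {P} (v-vanish : VanishesFrom P v) where

    private
      weigh : ∀ (f : ℕ → ℕ) → ∑ (suc r′) (λ i → f i * c 0 i) + ∑ P (λ p → f (W p) * T′ p) ≡ ∑ P (λ p → f (W p) * T p)
      weigh f = trans (flow-weight f (λ p → s≤s (window-bound r′ v p v-bit)) P)
        (cong (_+ ∑ P (λ p → f (W p) * T p)) (∑-zero (suc r′) λ i _ → trans (cong (f i *_) (flow-end v-vanish i)) (*-zeroʳ (f i))))

    flow-count : ∑ (suc r′) (c 0) + ∑ P T′ ≡ ∑ P T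
    flow-count = trans (cong₂ _+_ (∑-cong (suc r′) λ i _ → sym (*-identityˡ (c 0 i))) (∑-cong P λ p _ → sym (*-identityˡ (T′ p))))
      (trans (weigh λ _ → 1) (∑-cong P λ p _ → *-identityˡ (T p)))

    -- Conservation with the level as weight gives the sum of i times the initial bit i for T, and
    -- `flow-difference` carries it over to S. The resulting factor 2 is absorbed by the half in the
    -- definition of spin.
    flow-energy : pairing r′ P (λ p → S p + T p) v ≡
                  pairing r′ P (λ p → S′ p + T′ p) v + 2 * ∑ (suc r′) (λ i → i * c 0 i)
    flow-energy = begin
      pairing r′ P (λ p → S p + T p) v                         ≡⟨ pairing-+ˡ r′ P S T v ⟩
      ⟨S⟩ + ⟨T⟩                                                ≡⟨ cong₂ _+_ S≡ T≡ ⟩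
      Φ + ⟨S′⟩ + (Φ + ⟨T′⟩)                                    ≡⟨ lemma Φ ⟨S′⟩ ⟨T′⟩ ⟩
      ⟨S′⟩ + ⟨T′⟩ + 2 * Φ                                      ≡⟨ cong (_+ 2 * Φ) (pairing-+ˡ r′ P S′ T′ v) ⟨
      pairing r′ P (λ p → S′ p + T′ p) v + 2 * Φ               ∎
      where
      open ≡-Reasoning
      ⟨S⟩ = pairing r′ P S v
      ⟨T⟩ = pairing r′ P T v
      ⟨S′⟩ = pairing r′ P S′ v
      ⟨T′⟩ = pairing r′ P T′ v
      Φ = ∑ (suc r′) (λ i → i * c 0 i)
      T≡ : ⟨T⟩ ≡ Φ + ⟨T′⟩
      T≡ = trans (∑-cong P λ p _ → *-comm (T p) (W p)) (trans (sym (weigh λ i → i))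
             (cong (Φ +_) (∑-cong P λ p _ → *-comm (W p) (T′ p))))
      S≡ : ⟨S⟩ ≡ Φ + ⟨S′⟩
      S≡ = +-cancelʳ-≡ ⟨T′⟩ _ _ (begin
        ⟨S⟩ + ⟨T′⟩                            ≡⟨ pairing-+ˡ r′ P S T′ v ⟨
        pairing r′ P (λ p → S p + T′ p) v     ≡⟨ ∑-cong P (λ p _ → cong (_* W p) (flow-difference p)) ⟩
        pairing r′ P (λ p → S′ p + T p) v     ≡⟨ pairing-+ˡ r′ P S′ T v ⟩
        ⟨S′⟩ + ⟨T⟩                            ≡⟨ cong (⟨S′⟩ +_) T≡ ⟩
        ⟨S′⟩ + (Φ + ⟨T′⟩)                     ≡⟨ x∙yz≈yx∙z ⟨S′⟩ Φ ⟨T′⟩ ⟩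
        Φ + ⟨S′⟩ + ⟨T′⟩                       ∎)
      lemma : ∀ x y z → x + y + (x + z) ≡ y + z + 2 * x
      lemma = solve-∀

-- Determinism from left to right, with given initial registers: this makes κ depend on a and λ
-- only.
flow-sources : ∀ {r′ v S T S′ T′ c v̄ S̄ T̄ S̄′ T̄′ c̄} →
  Flow r′ v S T S′ T′ c → Flow r′ v̄ S̄ T̄ S̄′ T̄′ c̄ → (∀ p → v p ≡ v̄ p) →
  (∀ p → S′ p ≡ S̄′ p) → (∀ p → T′ p ≡ T̄′ p) → (∀ i → c 0 i ≡ c̄ 0 i) → ∀ p → S p ≡ S̄ p × T p ≡ T̄ p
flow-sources {r′} {v} {S} {T} {S′} {T′} {c} {v̄} {S̄} {T̄} {S̄′} {T̄′} {c̄} φ φ̄ v≡ S≡ T≡ c₀≡ p = proj₂ (match p (registers p))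
  where
  aligned : ∀ p → Step (window r′ v p) (c̄ p) (c̄ (suc p)) (v p) (v (suc r′ + p)) (S̄ p) (T̄ p) (S′ p) (T′ p)
  aligned p = subst₂ (λ s t → Step _ _ _ _ _ (S̄ p) (T̄ p) s t) (sym (S≡ p)) (sym (T≡ p))
    (subst₂ (λ x y → Step _ _ _ x y (S̄ p) (T̄ p) _ _) (sym (v≡ p)) (sym (v≡ (suc r′ + p)))
      (subst (λ k → Step k _ _ _ _ (S̄ p) (T̄ p) _ _) (window-cong r′ p λ q _ _ → sym (v≡ q)) (Flow.step φ̄ p)))
  match : ∀ p → (∀ i → c p i ≡ c̄ p i) → (∀ i → c (suc p) i ≡ c̄ (suc p) i) × S p ≡ S̄ p × T p ≡ T̄ p
  match p = step-unique (Flow.step φ p) (aligned p)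
  registers : ∀ p i → c p i ≡ c̄ p i
  registers zero    = c₀≡
  registers (suc p) = proj₁ (match p (registers p))

-- Determinism from right to left. The registers agree from P on because they are empty there, so a
-- and λ depend on κ only.
flow-targets : ∀ {r′ v S T S′ T′ c v̄ S̄ T̄ S̄′ T̄′ c̄ P} →
  Flow r′ v S T S′ T′ c → Flow r′ v̄ S̄ T̄ S̄′ T̄′ c̄ → (∀ p → v p ≡ v̄ p) → VanishesFrom P v →
  (∀ p → S p ≡ S̄ p) → (∀ p → T p ≡ T̄ p) → (∀ i → c 0 i ≡ c̄ 0 i) × (∀ p → S′ p ≡ S̄′ p × T′ p ≡ T̄′ p)
flow-targets {r′} {v} {S} {T} {S′} {T′} {c} {v̄} {S̄} {T̄} {S̄′} {T̄′} {c̄} {P} φ φ̄ v≡ v-vanish S≡ T≡ =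
  everywhere 0 , λ p → proj₂ (match p (everywhere (suc p)))
  where
  aligned : ∀ p → Step (window r′ v p) (c̄ (suc p)) (c̄ p) (v (suc r′ + p)) (v p) (S̄′ p) (T̄′ p) (S p) (T p)
  aligned p = step-sym (subst₂ (λ s t → Step _ _ _ _ _ s t (S̄′ p) (T̄′ p)) (sym (S≡ p)) (sym (T≡ p))
    (subst₂ (λ x y → Step _ _ _ x y _ _ (S̄′ p) (T̄′ p)) (sym (v≡ p)) (sym (v≡ (suc r′ + p)))
      (subst (λ k → Step k _ _ _ _ _ _ (S̄′ p) (T̄′ p)) (window-cong r′ p λ q _ _ → sym (v≡ q)) (Flow.step φ̄ p))))
  match : ∀ p → (∀ i → c (suc p) i ≡ c̄ (suc p) i) → (∀ i → c p i ≡ c̄ p i) × S′ p ≡ S̄′ p × T′ p ≡ T̄′ p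
  match p = step-unique (step-sym (Flow.step φ p)) (aligned p)
  registers : ∀ m p → P ≤ m + p → ∀ i → c p i ≡ c̄ p i
  registers zero    p P≤p i = trans (flow-end φ (vanishesFrom-≤ P≤p v-vanish) i)
    (sym (flow-end φ̄ (λ q p≤q → trans (sym (v≡ q)) (v-vanish q (≤-trans P≤p p≤q))) i))
  registers (suc m) p P≤ = proj₁ (match p (registers m (suc p) (≤-trans P≤ (≤-reflexive (sym (+-suc m p))))))
  everywhere : ∀ p i → c p i ≡ c̄ p i
  everywhere p = registers P p (m≤m+n P p)

right-above : ∀ {r M N} (o : Overlay r M N) → ∀ p → N (r + p) + Overlay.T o p ≡ Overlay.v o (r + p) + Overlay.S o p
right-above {r} {N = N} o p = trans (cong (N (r + p) +_) (sym (shift-above r T p)))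
  (trans (right (r + p)) (cong (v (r + p) +_) (shift-above r S p)))
  where open Overlay o

transfer : ∀ {m t v s t₁ s₁} → m + t ≡ v + s → s + t₁ ≡ s₁ + t → m + t₁ ≡ v + s₁
transfer {m} {t} {v} {s} {t₁} {s₁} e₁ e₂ = cancel _ _ (cong₂ _+_ e₁ e₂) (identity m t v s t₁ s₁)
  where
  identity : ∀ m t v s t₁ s₁ → m + t₁ + (v + s + (s₁ + t)) ≡ v + s₁ + (m + t + (s + t₁))
  identity = solve-∀

-- M p ≤ 1 becomes v p + S p ≤ 1 + T p, and N (r + p) ≥ 0 becomes T p ≤ v (r + p) + S p. Together
-- they make S and T agree at the descents, which the scan from the right requires.
lower : ∀ {r′ M N} → (∀ p → Bit (M p)) → (∀ p → Bit (N p)) → (o : Overlay (suc r′) M N) → IsAbove o →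
  Σ[ o′ ∈ Overlay (suc r′) M N ] IsBelow o′ × Overlay.v o′ ≡ Overlay.v o × Overlay.P o′ ≡ Overlay.P o ×
  ∃[ c ] Flow r′ (Overlay.v o) (Overlay.S o) (Overlay.T o) (Overlay.S o′) (Overlay.T o′) c
lower {r′} {M} {N} M-bit N-bit o a =
  let S₁ , T₁ , c , φ = flow-from-end {r′} {v} {S} {T} v-bit
        (λ p → ≤-trans (m≤n+m (S p) (v (r + p))) (v+S≤1 p)) T≤v v+S≤1
        (λ p → ≤-trans (≤-reflexive (sym (left p))) (+-monoˡ-≤ (T p) (M-bit p)))
        (λ p → ≤-trans (m≤n+m (T p) (N (r + p))) (≤-reflexive (right-above o p))) v-vanish
      difference = flow-difference φ
  in record
      { v = v ; S = S₁ ; T = T₁ ; v-bit = v-bit ; P = P ; v-vanish = v-vanish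
      ; left = λ p → transfer {M p} {T p} {v p} {S p} (left p) (difference p)
      ; right = λ p → transfer {N p} {shift r T p} {v p} {shift r S p} (right p)
          (trans (sym (shift-+ r S T₁ p)) (trans (shift-cong r difference p) (shift-+ r S₁ T p)))
      ; S-vanish = λ p P≤p → trans (sym (proj₁ (flow-level φ v-vanish p P≤p))) (S-vanish p P≤p)
      ; T-vanish = λ p P≤p → trans (sym (proj₂ (flow-level φ v-vanish p P≤p))) (T-vanish p P≤p) } ,
    record
      { T≤v = λ p → proj₁ (step-below (Flow.step φ p) (Flow.bit φ (suc p)) (T≤v p , v+S≤1 p))
      ; v+S≤1 = λ p → proj₂ (step-below (Flow.step φ p) (Flow.bit φ (suc p)) (T≤v p , v+S≤1 p)) } ,
    refl , refl , c , φ
  where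
  open Overlay o
  open IsAbove a
  r = suc r′

-- With the roles exchanged, N (r + p) ≤ 1 and M p ≥ 0 make S and T agree at the ascents.
raise : ∀ {r′ M N} → (∀ p → Bit (M p)) → (∀ p → Bit (N p)) → (o′ : Overlay (suc r′) M N) → IsBelow o′ →
  ∀ (a : ℕ → ℕ) → (∀ i → Bit (a i)) → VanishesFrom (Overlay.v o′ 0 + window r′ (Overlay.v o′) 0) a →
  Σ[ o ∈ Overlay (suc r′) M N ] IsAbove o × Overlay.v o′ ≡ Overlay.v o × Overlay.P o′ ≡ Overlay.P o ×
  ∃[ c ] Flow r′ (Overlay.v o) (Overlay.S o) (Overlay.T o) (Overlay.S o′) (Overlay.T o′) c × (∀ i → c 0 i ≡ a i)
raise {r′} {M} {N} M-bit N-bit o′ b a a-bit a-vanish =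
  let S₁ , T₁ , c , φ , c₀ = flow-from-start {r′} {v} {S} {T} v-bit
        (λ p → ≤-trans (m≤n+m (S p) (v p)) (v+S≤1 p)) T≤v v+S≤1
        (λ p → ≤-trans (≤-reflexive (sym (right-above o′ p))) (+-monoˡ-≤ (T p) (N-bit (r + p))))
        (λ p → ≤-trans (m≤n+m (T p) (M p)) (≤-reflexive (left p))) a a-vanish a-bit
      difference = λ p → sym (flow-difference φ p)
  in record
      { v = v ; S = S₁ ; T = T₁ ; v-bit = v-bit ; P = P ; v-vanish = v-vanish
      ; left = λ p → transfer {M p} {T p} {v p} {S p} (left p) (difference p)
      ; right = λ p → transfer {N p} {shift r T p} {v p} {shift r S p} (right p)
          (trans (sym (shift-+ r S T₁ p)) (trans (shift-cong r difference p) (shift-+ r S₁ T p)))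
      ; S-vanish = λ p P≤p → trans (proj₁ (flow-level φ v-vanish p P≤p)) (S-vanish p P≤p)
      ; T-vanish = λ p P≤p → trans (proj₂ (flow-level φ v-vanish p P≤p)) (T-vanish p P≤p) } ,
    record
      { T≤v = λ p → proj₁ (step-above (Flow.step φ p) (Flow.bit φ p) (T≤v p , v+S≤1 p))
      ; v+S≤1 = λ p → proj₂ (step-above (Flow.step φ p) (Flow.bit φ p) (T≤v p , v+S≤1 p)) } ,
    refl , refl , c , φ , c₀
  where
  open Overlay o′
  open IsBelow b
  r = suc r′

-- The shape datum

registers : ∀ {r} → Bits r → ℕ → ℕ
registers []      i       = 0
registers (b ∷ a) zero    = toℕ b
registers (b ∷ a) (suc i) = registers a i

toBit : ℕ → Fin 2
toBit zero    = 0F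
toBit (suc _) = sucF 0F

toBits : ∀ r → (ℕ → ℕ) → Bits r
toBits zero    c = []
toBits (suc r) c = toBit (c 0) ∷ toBits r (c ∘ suc)

registers-bit : ∀ {r} (a : Bits r) i → Bit (registers a i)
registers-bit []      i       = z≤n
registers-bit (b ∷ a) zero    = s≤s⁻¹ (Fin.toℕ<n b)
registers-bit (b ∷ a) (suc i) = registers-bit a i

registers-vanish : ∀ {r} (a : Bits r) → VanishesFrom r (registers a)
registers-vanish []      i       h = refl
registers-vanish (b ∷ a) (suc i) h = registers-vanish a i (s≤s⁻¹ h)

registers-toBits : ∀ r c → (∀ i → Bit (c i)) → VanishesFrom r c → ∀ i → c i ≡ registers (toBits r c) i
registers-toBits zero    c bit z i       = z i z≤n
registers-toBits (suc r) c bit z (suc i) = registers-toBits r (c ∘ suc) (bit ∘ suc) (λ j h → z (suc j) (s≤s h)) i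
registers-toBits (suc r) c bit z zero with c 0 | bit 0
... | _ | z≤n     = refl
... | _ | s≤s z≤n = refl

registers-injective : ∀ {r} (a b : Bits r) → (∀ i → registers a i ≡ registers b i) → a ≡ b
registers-injective []      []      e = refl
registers-injective (x ∷ a) (y ∷ b) e = cong₂ _∷_ (Fin.toℕ-injective (e 0)) (registers-injective a b (e ∘ suc))

∑-registers : ∀ {r} (a : Bits r) → ∑ r (registers a) ≡ ∣ a ∣ᵇ
∑-registers []                = refl
∑-registers {suc r} (b ∷ a) = trans (∑-front r (registers (b ∷ a))) (cong (toℕ b +_) (∑-registers a))

∑-weighted-registers : ∀ {r} (f : ℕ → ℕ) (a : Bits r) →
  ∑ r (λ i → f i * registers a i) ≡ Vec.sum (Vec.tabulate λ i → f (toℕ i) * toℕ (Vec.lookup a i))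
∑-weighted-registers f []                = refl
∑-weighted-registers {suc r} f (b ∷ a) = trans (∑-front r (λ i → f i * registers (b ∷ a) i))
  (cong (f 0 * toℕ b +_) (∑-weighted-registers (f ∘ suc) a))

ℕ→ℚ-+ : ∀ a b → ℕ→ℚ (a + b) ≡ ℕ→ℚ a ℚ.+ ℕ→ℚ b
ℕ→ℚ-+ a b = ℚ.toℚᵘ-injective (begin
  ℚ.toℚᵘ (ℕ→ℚ (a + b))                        ≈⟨ ℚ.toℚᵘ-fromℚᵘ (mkℚᵘ (pos (a + b)) 0) ⟩
  mkℚᵘ (pos (a + b)) 0                         ≈⟨ *≡* (cong (λ x → x ℤ.* pos 1) (cong₂ ℤ._+_ (sym (ℤ.*-identityʳ (pos a))) (sym (ℤ.*-identityʳ (pos b))))) ⟩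
  mkℚᵘ (pos a) 0 ℚᵘ.+ mkℚᵘ (pos b) 0           ≈⟨ ℚᵘ.+-cong (ℚ.toℚᵘ-fromℚᵘ (mkℚᵘ (pos a) 0)) (ℚ.toℚᵘ-fromℚᵘ (mkℚᵘ (pos b) 0)) ⟨
  ℚ.toℚᵘ (ℕ→ℚ a) ℚᵘ.+ ℚ.toℚᵘ (ℕ→ℚ b)           ≈⟨ ℚ.toℚᵘ-homo-+ (ℕ→ℚ a) (ℕ→ℚ b) ⟨
  ℚ.toℚᵘ (ℕ→ℚ a ℚ.+ ℕ→ℚ b)                     ∎)
  where open ℚᵘ.≃-Reasoning

half-+ : ∀ a b → ½ ℚ.* ℕ→ℚ (a + b) ≡ ½ ℚ.* ℕ→ℚ a ℚ.+ ½ ℚ.* ℕ→ℚ b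
half-+ a b = trans (cong (½ ℚ.*_) (ℕ→ℚ-+ a b)) (ℚ.*-distribˡ-+ ½ (ℕ→ℚ a) (ℕ→ℚ b))

half-double : ∀ a → ½ ℚ.* ℕ→ℚ (2 * a) ≡ ℕ→ℚ a
half-double a = begin
  ½ ℚ.* ℕ→ℚ (a + (a + 0))              ≡⟨ cong (λ x → ½ ℚ.* ℕ→ℚ (a + x)) (+-identityʳ a) ⟩
  ½ ℚ.* ℕ→ℚ (a + a)                    ≡⟨ half-+ a a ⟩
  ½ ℚ.* ℕ→ℚ a ℚ.+ ½ ℚ.* ℕ→ℚ a          ≡⟨ ℚ.*-distribʳ-+ (ℕ→ℚ a) ½ ½ ⟨
  (½ ℚ.+ ½) ℚ.* ℕ→ℚ a                  ≡⟨ ℚ.*-identityˡ (ℕ→ℚ a) ⟩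
  ℕ→ℚ a                                ∎
  where open ≡-Reasoning

encodes-cong : ∀ {n λ′ β γ} → (∀ p → β p ≡ γ p) → Encodes n λ′ β → Encodes n λ′ γ
encodes-cong {n} β≗γ E = record
  { bit   = λ p → subst Bit (β≗γ p) (bit p)
  ; bound = λ q → subst (_≤ n) (sums q) (bound q)
  ; to    = λ i q h → to i q (subst (λ x → i + x < n) (sym (sums q)) h)
  ; from  = λ i q h → subst (λ x → i + x < n) (sums q) (from i q h) }
  where
  open Encodes E
  sums = λ q → ∑-cong q λ p _ → β≗γ p

-- A bead at p cannot move when p + r is occupied, since a horizontal strip visits no position
-- twice. So at most the last r beads of the initial run of ν can leave.
hstrip-length : ∀ {r′ ν κ} → HStrip (suc r′) ν κ → length (parts κ) ≤ suc r′ + length (parts ν)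
hstrip-length {r′} {ν} {κ} s = ≤-trans
  (initial⇒length≤ F (length (parts κ)) (m≤m+n _ ℓ) ones) (≤-reflexive (m+n∸m≡n (length (parts κ)) ℓ))
  where
  r = suc r′
  ℓ = r + length (parts ν)
  -- For every p below the length of κ, both p and p + r then lie in the initial run of beads of ν.
  n = length (parts κ) + ℓ
  E : Encodes n ν (edges n ν)
  E = edges-encodes n ν (≤-trans (m≤n+m _ r) (m≤n+m ℓ _))
  F : Encodes n κ (edges n κ)
  F = edges-encodes n κ (m≤m+n _ ℓ)
  H : HConfig r (edges n ν) (edges n κ)
  H = proj₁ (Strips.hstrip-measured r′ n E F s)
  open HConfig H
  ones : ∀ p → p < length (parts κ) → edges n κ p ≡ 1
  ones p p< = ≤-antisym (Encodes.bit F p) (≤-trans (≤-reflexive (sym N≡1)) (≤-trans (m≤m+n _ (shift r moved p))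
      (≤-reflexive (trans (source p) (trans (sym (target p)) (+-absorb (edges n κ p) unmoved))))))
    where
    N≡1 : edges n ν p ≡ 1
    N≡1 = edges-initial E p ≤-refl (≤-trans (+-monoˡ-≤ (length (parts ν)) p<) (+-monoʳ-≤ _ (m≤n+m _ r)))
    N≡1′ : edges n ν (r + p) ≡ 1
    N≡1′ = edges-initial E (r + p) ≤-refl (≤-trans (≤-reflexive (lemma r p (length (parts ν)))) (+-monoˡ-≤ ℓ p<))
      where
      lemma : ∀ x y z → suc (x + y + z) ≡ suc y + (x + z)
      lemma = solve-∀
    unmoved : moved p ≡ 0
    unmoved = n≤0⇒n≡0 (+-cancelˡ-≤ 1 _ _ (≤-trans (≤-reflexive (trans (cong₂ _+_ (sym N≡1′) (sym (shift-above r moved p)))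
      (source (r + p)))) (bit (r + p))))

/-skew : ∀ r′ {a} b k → a ≡ b + suc r′ * k → a / suc r′ ≡ b / suc r′ + k
/-skew r′ b k refl = trans (+-distrib-/-∣ʳ b (m∣m*n k))
  (cong (b / suc r′ +_) (trans (cong (_/ suc r′) (*-comm (suc r′) k)) (m*n/n≡m k (suc r′))))

skewSize : ∀ r′ {μ λ′ k} → size μ ≡ size λ′ + suc r′ * k → skewSize/ (suc r′) μ λ′ ≡ k
skewSize r′ {μ} {λ′} {k} e = trans (cong (λ x → (x ∸ size λ′) / suc r′) e) (trans (cong (_/ suc r′) (m+n∸m≡n (size λ′) (suc r′ * k)))
  (trans (cong (_/ suc r′) (*-comm (suc r′) k)) (m*n/n≡m k (suc r′))))

module _ (r′ : ℕ) (μ ν : Partition) where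

  private
    r n : ℕ
    r = suc r′
    -- By `hstrip-length` there is room for κ, and the first r positions are beads of ν, hence of v,
    -- so the level starts at r and all r registers are available for a.
    n = length (parts μ) + (r + length (parts ν))
    M N : ℕ → ℕ
    M = edges n μ
    N = edges n ν
    EM : Encodes n μ M
    EM = edges-encodes n μ (m≤m+n _ _)
    EN : Encodes n ν N
    EN = edges-encodes n ν (≤-trans (m≤n+m _ r) (m≤n+m _ (length (parts μ))))
    open Strips r′ n

  -- The graph of the bijection, with all the data from which heights and sizes are read. `descend`
  -- and `ascend` show that it is total on both sides, `linked-below` and `linked-above` that
  -- partners are unique.
  record Correspondence (κ : Partition) (a : Bits r) (λ′ : Partition) : Set where
    field
      upperOverlay   : Overlay r M N
      above   : IsAbove upperOverlay
      κ-edges : Encodes n κ (AboveStrips.K upperOverlay above)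
      lowerOverlay  : Overlay r M N
      below   : IsBelow lowerOverlay
      λ-edges : Encodes n λ′ (BelowStrips.L lowerOverlay below)
      v≡      : Overlay.v lowerOverlay ≡ Overlay.v upperOverlay
      P≡      : Overlay.P lowerOverlay ≡ Overlay.P upperOverlay
      c       : ℕ → ℕ → ℕ
      flow    : Flow r′ (Overlay.v upperOverlay) (Overlay.S upperOverlay) (Overlay.T upperOverlay)
                        (Overlay.S lowerOverlay) (Overlay.T lowerOverlay) c
      start   : ∀ i → c 0 i ≡ registers a i

    private
      module U = Overlay upperOverlay
      module L = Overlay lowerOverlay
      module A = AboveStrips upperOverlay above
      module B = BelowStrips lowerOverlay below

    κ/μ : VStrip r μ κ
    κ/μ = config⇒vstrip EM κ-edges A.vconfig
    κ/ν : HStrip r ν κ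
    κ/ν = config⇒hstrip EN κ-edges A.hconfig
    μ/λ : HStrip r λ′ μ
    μ/λ = config⇒hstrip λ-edges EM B.hconfig
    ν/λ : VStrip r λ′ ν
    ν/λ = config⇒vstrip λ-edges EN B.vconfig

    heights : (s : VStrip r μ κ) (s′ : HStrip r ν κ) (t : HStrip r λ′ μ) (t′ : VStrip r λ′ ν) →
      heightSum (proj₁ s) + heightSum (proj₁ s′) ≡ heightSum (proj₁ t) + heightSum (proj₁ t′) + 2 * n⟨ a ⟩
    heights s s′ t t′ = begin
      heightSum (proj₁ s) + heightSum (proj₁ s′)
        ≡⟨ cong₂ _+_ (proj₁ (vstrip-measure EM κ-edges s A.vconfig)) (proj₁ (hstrip-measure EN κ-edges s′ A.hconfig)) ⟩
      pairing r′ U.P U.S (λ p → U.v p ∸ U.T p) + pairing r′ U.P U.T (λ p → U.v p + shift r U.S p)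
        ≡⟨ A.energy refl ⟩
      pairing r′ U.P (λ p → U.S p + U.T p) U.v
        ≡⟨ flow-energy flow U.v-bit U.v-vanish ⟩
      pairing r′ U.P (λ p → L.S p + L.T p) U.v + 2 * ∑ r (λ i → i * c 0 i)
        ≡⟨ cong₂ (λ x y → x + 2 * y)
             (trans (cong₂ (λ P v → pairing r′ P (λ p → L.S p + L.T p) v) (sym P≡) (sym v≡)) (sym (B.energy refl)))
             (trans (∑-cong r λ i _ → cong (i *_) (start i)) (∑-weighted-registers (λ i → i) a)) ⟩
      pairing r′ L.P L.T (λ p → L.v p + L.S p) + pairing r′ L.P L.S B.u + 2 * n⟨ a ⟩
        ≡⟨ cong (_+ 2 * n⟨ a ⟩) (cong₂ _+_ (proj₁ (hstrip-measure λ-edges EM t B.hconfig)) (proj₁ (vstrip-measure λ-edges EN t′ B.vconfig))) ⟨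
      heightSum (proj₁ t) + heightSum (proj₁ t′) + 2 * n⟨ a ⟩ ∎
      where open ≡-Reasoning

    #κ/ν #μ/λ #κ/μ #ν/λ : ℕ
    #κ/ν = ∑ U.P U.T
    #μ/λ = ∑ L.P L.T
    #κ/μ = ∑ U.P U.S
    #ν/λ = ∑ L.P L.S

    size-κ/ν : size κ ≡ size ν + r * #κ/ν
    size-κ/ν = proj₂ (hstrip-measure EN κ-edges κ/ν A.hconfig)
    size-μ/λ : size μ ≡ size λ′ + r * #μ/λ
    size-μ/λ = proj₂ (hstrip-measure λ-edges EM μ/λ B.hconfig)
    size-κ/μ : size κ ≡ size μ + r * #κ/μ
    size-κ/μ = proj₂ (vstrip-measure EM κ-edges κ/μ A.vconfig)
    size-ν/λ : size ν ≡ size λ′ + r * #ν/λ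
    size-ν/λ = proj₂ (vstrip-measure λ-edges EN ν/λ B.vconfig)

    #κ/ν≡ : #κ/ν ≡ ∣ a ∣ᵇ + #μ/λ
    #κ/ν≡ = trans (sym (flow-count flow U.v-bit U.v-vanish))
      (cong₂ _+_ (trans (∑-cong r λ i _ → start i) (∑-registers a)) (cong (λ P → ∑ P L.T) (sym P≡)))

    -- `flow-count` treats T only. The count for S follows by computing the size of κ from λ through
    -- μ and through ν.
    #κ/μ≡ : #κ/μ ≡ ∣ a ∣ᵇ + #ν/λ
    #κ/μ≡ = +-cancelʳ-≡ #μ/λ _ _ (*-cancelˡ-≡ _ _ r (+-cancelˡ-≡ (size λ′) _ _ (begin
      size λ′ + r * (#κ/μ + #μ/λ)               ≡⟨ lemma (size λ′) r #κ/μ #μ/λ ⟩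
      size λ′ + r * #μ/λ + r * #κ/μ             ≡⟨ cong (_+ r * #κ/μ) size-μ/λ ⟨
      size μ + r * #κ/μ                         ≡⟨ trans (sym size-κ/μ) size-κ/ν ⟩
      size ν + r * #κ/ν                         ≡⟨ cong₂ (λ x y → x + r * y) size-ν/λ #κ/ν≡ ⟩
      size λ′ + r * #ν/λ + r * (∣ a ∣ᵇ + #μ/λ)  ≡⟨ lemma′ (size λ′) r #ν/λ ∣ a ∣ᵇ #μ/λ ⟩
      size λ′ + r * (∣ a ∣ᵇ + #ν/λ + #μ/λ)      ∎)))
      where
      open ≡-Reasoning
      lemma : ∀ x r y z → x + r * (y + z) ≡ x + r * z + r * y
      lemma = solve-∀
      lemma′ : ∀ x r y z w → x + r * y + r * (z + w) ≡ x + r * (z + y + w)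
      lemma′ = solve-∀

  -- κ determines S and T by uniqueness of standardisations, and these determine the whole scan from
  -- the right, including the registers at 0.
  linked-below : ∀ {κ a λ′ b ρ} → Correspondence κ a λ′ → Correspondence κ b ρ → (a , λ′) ≡ (b , ρ)
  linked-below {a = a} {b = b} X Y = cong₂ _,_
    (registers-injective a b λ i → trans (sym (X.start i)) (trans (proj₁ both i) (Y.start i)))
    (encodes-injective X.λ-edges Y.λ-edges λ p →
      cong₂ (λ v,t s → proj₁ v,t ∸ proj₂ v,t + s) (cong₂ _,_ (v-lower p) (shift-cong r (proj₂ ∘ proj₂ both) p)) (proj₁ (proj₂ both p)))
    where
    module X = Correspondence X
    module Y = Correspondence Y
    module XA = AboveStrips X.upperOverlay X.above
    module YA = AboveStrips Y.upperOverlay Y.above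
    K≡ : ∀ p → XA.K p ≡ YA.K p
    K≡ = encodes-functional X.κ-edges Y.κ-edges
    S≡ : ∀ p → Overlay.S X.upperOverlay p ≡ Overlay.S Y.upperOverlay p
    S≡ = vconfig-moved XA.vconfig record { fixed = Y′.fixed ; moved = Y′.moved ; source = Y′.source
           ; target = λ p → trans (K≡ p) (Y′.target p) ; P = Y′.P ; vanish = Y′.vanish }
      where module Y′ = VConfig YA.vconfig
    T≡ : ∀ p → Overlay.T X.upperOverlay p ≡ Overlay.T Y.upperOverlay p
    T≡ = hconfig-moved XA.hconfig record { visited = Y′.visited ; moved = Y′.moved ; source = Y′.source ; bit = Y′.bit
           ; target = λ p → trans (cong (_+ Y′.moved p) (K≡ p)) (Y′.target p) ; P = Y′.P ; vanish = Y′.vanish }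
      where module Y′ = HConfig YA.hconfig
    both = flow-targets X.flow Y.flow (overlay-v X.upperOverlay Y.upperOverlay (s≤s z≤n)) (Overlay.v-vanish X.upperOverlay) S≡ T≡
    v-lower : ∀ p → Overlay.v X.lowerOverlay p ≡ Overlay.v Y.lowerOverlay p
    v-lower = overlay-v X.lowerOverlay Y.lowerOverlay (s≤s z≤n)

  linked-above : ∀ {κ ρ a λ′} → Correspondence κ a λ′ → Correspondence ρ a λ′ → κ ≡ ρ
  linked-above X Y = encodes-injective X.κ-edges Y.κ-edges λ p →
    cong₂ (λ v,t s → proj₁ v,t ∸ proj₂ v,t + s) (cong₂ _,_ (v-upperOverlay p) (proj₂ (both p))) (shift-cong r (proj₁ ∘ both) p)
    where
    module X = Correspondence X
    module Y = Correspondence Y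
    module XB = BelowStrips X.lowerOverlay X.below
    module YB = BelowStrips Y.lowerOverlay Y.below
    L≡ : ∀ p → XB.L p ≡ YB.L p
    L≡ = encodes-functional X.λ-edges Y.λ-edges
    S≡ : ∀ p → Overlay.S X.lowerOverlay p ≡ Overlay.S Y.lowerOverlay p
    S≡ = vconfig-moved XB.vconfig record { fixed = Y′.fixed ; moved = Y′.moved ; target = Y′.target
           ; source = λ p → trans (L≡ p) (Y′.source p) ; P = Y′.P ; vanish = Y′.vanish }
      where module Y′ = VConfig YB.vconfig
    T≡ : ∀ p → Overlay.T X.lowerOverlay p ≡ Overlay.T Y.lowerOverlay p
    T≡ = hconfig-moved XB.hconfig record { visited = Y′.visited ; moved = Y′.moved ; target = Y′.target ; bit = Y′.bit
           ; source = λ p → trans (cong (_+ shift r Y′.moved p) (L≡ p)) (Y′.source p) ; P = Y′.P ; vanish = Y′.vanish }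
      where module Y′ = HConfig YB.hconfig
    v-upperOverlay : ∀ p → Overlay.v X.upperOverlay p ≡ Overlay.v Y.upperOverlay p
    v-upperOverlay = overlay-v X.upperOverlay Y.upperOverlay (s≤s z≤n)
    both = flow-sources X.flow Y.flow v-upperOverlay S≡ T≡ λ i → trans (X.start i) (sym (Y.start i))

  private
    -- Below r the shifted sets contribute nothing to `right`, so v agrees there with N, which
    -- begins with at least r beads.
    initial : (o : Overlay r M N) → Overlay.v o 0 + window r′ (Overlay.v o) 0 ≡ r
    initial o = trans (cong₂ _+_ (ones 0 (s≤s z≤n)) (∑-cong r′ λ j j<r′ →
        trans (cong v (cong suc (+-identityʳ j))) (ones (suc j) (s≤s j<r′))))
      (cong suc (trans (∑-const r′ 1) (*-identityʳ r′)))
      where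
      open Overlay o
      ones : ∀ p → p < r → v p ≡ 1
      ones p p<r = begin
        v p                    ≡⟨ +-identityʳ (v p) ⟨
        v p + 0                ≡⟨ cong (v p +_) (shift-below r S p<r) ⟨
        v p + shift r S p      ≡⟨ right p ⟨
        N p + shift r T p      ≡⟨ cong (N p +_) (shift-below r T p<r) ⟩
        N p + 0                ≡⟨ +-identityʳ (N p) ⟩
        N p                    ≡⟨ edges-initial EN p ≤-refl (≤-trans (+-monoˡ-≤ _ p<r) (m≤n+m _ (length (parts μ)))) ⟩
        1                      ∎
        where open ≡-Reasoning

  abstract
    descend : ∀ κ → VStrip r μ κ → HStrip r ν κ → ∃[ a ] ∃[ λ′ ] Correspondence κ a λ′
    descend κ s t =
      let Eκ = edges-encodes n κ (≤-trans (hstrip-length t) (m≤n+m _ _))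
          V = proj₁ (vstrip-measured EM Eκ s)
          H = proj₁ (hstrip-measured EN Eκ t)
          o , ab , K≡ = fromAbove (Encodes.bit EM) (edges-vanish EM) V H
          o′ , be , v≡ , P≡ , c , φ = lower (Encodes.bit EM) (Encodes.bit EN) o ab
          λ′ , Eλ = decode-balanced EM r (BelowStrips.L o′ be) (Overlay.T o′) (Overlay.T-vanish o′) (BelowStrips.L-bit o′ be)
                      (inj₂ λ p → trans (HConfig.source (BelowStrips.hconfig o′ be) p) (sym (HConfig.target (BelowStrips.hconfig o′ be) p)))
      in toBits r (c 0) , λ′ , record
        { upperOverlay = o ; above = ab ; κ-edges = encodes-cong (sym ∘ K≡) Eκ
        ; lowerOverlay = o′ ; below = be ; λ-edges = Eλ ; v≡ = v≡ ; P≡ = P≡ ; c = c ; flow = φ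
        ; start = registers-toBits r (c 0) (Flow.bit φ 0) (subst (λ h → VanishesFrom h (c 0)) (initial o) (Flow.vanish φ 0)) }

    ascend : ∀ a λ′ → HStrip r λ′ μ → VStrip r λ′ ν → ∃[ κ ] Correspondence κ a λ′
    ascend a λ′ s t =
      let Eλ = edges-encodes n λ′ (≤-trans (chain-length (proj₁ s)) (m≤m+n _ _))
          H = proj₁ (hstrip-measured Eλ EM s)
          V = proj₁ (vstrip-measured Eλ EN t)
          o′ , be , L≡ = fromBelow (edges-vanish EN) H V
          o , ab , v≡ , P≡ , c , φ , c₀ = raise (Encodes.bit EM) (Encodes.bit EN) o′ be (registers a) (registers-bit a)
                                            (subst (λ h → VanishesFrom h (registers a)) (sym (initial o′)) (registers-vanish a))
          κ , Eκ = decode-balanced EM r (AboveStrips.K o ab) (Overlay.S o) (Overlay.S-vanish o) (AboveStrips.K-bit o ab)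
                     (inj₁ (vconfig-balance (AboveStrips.vconfig o ab)))
      in κ , record
        { upperOverlay = o ; above = ab ; κ-edges = Eκ
        ; lowerOverlay = o′ ; below = be ; λ-edges = encodes-cong (sym ∘ L≡) Eλ ; v≡ = v≡ ; P≡ = P≡ ; c = c ; flow = φ
        ; start = c₀ }

asymmetricShapeDatum : ∀ r′ → AsymmetricShapeDatum (suc r′)
asymmetricShapeDatum r′ = record
  { bijection = λ μ ν → record
      { to = to μ ν
      ; cong = λ { {x} {y} refl → linked-below r′ μ ν (link μ ν x) (link μ ν y) }
      ; bijective = (λ {x} {y} → injective μ ν x y) , surjective μ ν
      }
  ; weight-preserving = λ {μ} {ν} x → weight μ ν x
  }
  where
  r = suc r′
  below : ∀ μ ν (x : Setoid.Carrier (Above r μ ν)) → ∃[ a ] ∃[ λ′ ] Correspondence r′ μ ν (proj₁ x) a λ′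
  below μ ν (κ , s , t) = descend r′ μ ν κ s t
  link : ∀ μ ν (x : Setoid.Carrier (Above r μ ν)) → Correspondence r′ μ ν (proj₁ x) (proj₁ (below μ ν x)) (proj₁ (proj₂ (below μ ν x)))
  link μ ν x = proj₂ (proj₂ (below μ ν x))
  to : ∀ μ ν → Setoid.Carrier (Above r μ ν) → Setoid.Carrier (Below r μ ν)
  to μ ν x = (proj₁ (below μ ν x) , proj₁ (proj₂ (below μ ν x))) , Correspondence.μ/λ (link μ ν x) , Correspondence.ν/λ (link μ ν x)
  injective : ∀ μ ν (x y : Setoid.Carrier (Above r μ ν)) → proj₁ (to μ ν x) ≡ proj₁ (to μ ν y) → proj₁ x ≡ proj₁ y
  injective μ ν x y e = linked-above r′ μ ν (link μ ν x)
    (subst (λ (a , λ′) → Correspondence r′ μ ν (proj₁ y) a λ′) (sym e) (link μ ν y))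
  surjective : ∀ μ ν (y : Setoid.Carrier (Below r μ ν)) →
               Σ[ x ∈ Setoid.Carrier (Above r μ ν) ] (∀ {z} → proj₁ z ≡ proj₁ x → proj₁ (to μ ν z) ≡ proj₁ y)
  surjective μ ν ((a , λ′) , s , t) with ascend r′ μ ν a λ′ s t
  ... | κ , l = (κ , Correspondence.κ/μ l , Correspondence.κ/ν l) , λ { {z} refl → linked-below r′ μ ν (link μ ν z) l }
  weight : ∀ μ ν x → pos (size/ r (proj₁ x)) ℤ.- pos (size/ r ν) ℤ.- pos (size/ r μ) ℤ.+ pos (size/ r (proj₁ (proj₂ (below μ ν x))))
                     ≡ pos ∣ proj₁ (below μ ν x) ∣ᵇ
  weight μ ν x = trans
    (cong₂ (λ k m → pos k ℤ.- pos (size/ r ν) ℤ.- pos m ℤ.+ pos (size/ r λ′))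
      (trans (/-skew r′ (size ν) l.#κ/ν l.size-κ/ν) (cong (size/ r ν +_) l.#κ/ν≡)) (/-skew r′ (size λ′) l.#μ/λ l.size-μ/λ))
    (trans (cong₂ (λ k m → k ℤ.- pos (size/ r ν) ℤ.- m ℤ.+ pos (size/ r λ′))
             (trans (ℤ.pos-+ (size/ r ν) (∣ a ∣ᵇ + l.#μ/λ)) (cong (λ z → pos (size/ r ν) ℤ.+ z) (ℤ.pos-+ ∣ a ∣ᵇ l.#μ/λ))) (ℤ.pos-+ (size/ r λ′) l.#μ/λ))
           (identity (pos (size/ r ν)) (pos ∣ a ∣ᵇ) (pos l.#μ/λ) (pos (size/ r λ′))))
    where
    module l = Correspondence (link μ ν x)
    a = proj₁ (below μ ν x)
    λ′ = proj₁ (proj₂ (below μ ν x))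
    identity : ∀ n a m l → n ℤ.+ (a ℤ.+ m) ℤ.- n ℤ.- (l ℤ.+ m) ℤ.+ l ≡ a
    identity = ℤ-solve-∀

spinPreserving : ∀ r′ → SpinPreserving (asymmetricShapeDatum r′)
spinPreserving r′ {μ} {ν} x@(κ , s , t) = begin
  ½ ℚ.* ℕ→ℚ h₁ ℚ.+ ½ ℚ.* ℕ→ℚ h₂               ≡⟨ half-+ h₁ h₂ ⟨
  ½ ℚ.* ℕ→ℚ (h₁ + h₂)                         ≡⟨ cong (λ z → ½ ℚ.* ℕ→ℚ z) (l.heights s t l.μ/λ l.ν/λ) ⟩
  ½ ℚ.* ℕ→ℚ (h₃ + h₄ + 2 * n⟨ a ⟩)            ≡⟨ half-+ (h₃ + h₄) (2 * n⟨ a ⟩) ⟩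
  ½ ℚ.* ℕ→ℚ (h₃ + h₄) ℚ.+ ½ ℚ.* ℕ→ℚ (2 * n⟨ a ⟩)  ≡⟨ cong₂ ℚ._+_ (half-+ h₃ h₄) (half-double n⟨ a ⟩) ⟩
  ½ ℚ.* ℕ→ℚ h₃ ℚ.+ ½ ℚ.* ℕ→ℚ h₄ ℚ.+ ℕ→ℚ n⟨ a ⟩  ∎
  where
  open ≡-Reasoning
  linked = descend r′ μ ν κ s t
  a = proj₁ linked
  module l = Correspondence (proj₂ (proj₂ linked))
  h₁ = heightSum (proj₁ s)
  h₂ = heightSum (proj₁ t)
  h₃ = heightSum (proj₁ l.μ/λ)
  h₄ = heightSum (proj₁ l.ν/λ)

-- Linear forms on polynomials and on the free module

sumᶻ : ∀ {A : Set} → (A → ℤ) → List A → ℤ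
sumᶻ f []       = pos 0
sumᶻ f (x ∷ xs) = f x ℤ.+ sumᶻ f xs

sumᶻ-cong : ∀ {A : Set} {f g : A → ℤ} xs → (∀ x → f x ≡ g x) → sumᶻ f xs ≡ sumᶻ g xs
sumᶻ-cong []       e = refl
sumᶻ-cong (x ∷ xs) e = cong₂ ℤ._+_ (e x) (sumᶻ-cong xs e)

sumᶻ-zero : ∀ {A : Set} {f : A → ℤ} xs → (∀ x → x ∈ˡ xs → f x ≡ pos 0) → sumᶻ f xs ≡ pos 0
sumᶻ-zero []       e = refl
sumᶻ-zero (x ∷ xs) e = cong₂ ℤ._+_ (e x (here refl)) (sumᶻ-zero xs λ y → e y ∘ there)

sumᶻ-++ : ∀ {A : Set} (f : A → ℤ) xs ys → sumᶻ f (xs ++ ys) ≡ sumᶻ f xs ℤ.+ sumᶻ f ys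
sumᶻ-++ f []       ys = sym (ℤ.+-identityˡ _)
sumᶻ-++ f (x ∷ xs) ys = trans (cong (λ z → f x ℤ.+ z) (sumᶻ-++ f xs ys)) (sym (ℤ.+-assoc (f x) _ _))

sumᶻ-map : ∀ {A B : Set} (f : B → ℤ) (h : A → B) xs → sumᶻ f (map h xs) ≡ sumᶻ (f ∘ h) xs
sumᶻ-map f h []       = refl
sumᶻ-map f h (x ∷ xs) = cong (λ z → f (h x) ℤ.+ z) (sumᶻ-map f h xs)

sumᶻ-concatMap : ∀ {A B : Set} (f : B → ℤ) (h : A → List B) xs → sumᶻ f (concatMap h xs) ≡ sumᶻ (sumᶻ f ∘ h) xs
sumᶻ-concatMap f h []       = refl
sumᶻ-concatMap f h (x ∷ xs) = trans (sumᶻ-++ f (h x) (concatMap h xs)) (cong (λ z → sumᶻ f (h x) ℤ.+ z) (sumᶻ-concatMap f h xs))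

sumᶻ-cartesianProduct : ∀ {A B : Set} (f : A × B → ℤ) xs ys →
  sumᶻ f (cartesianProduct xs ys) ≡ sumᶻ (λ x → sumᶻ (λ y → f (x , y)) ys) xs
sumᶻ-cartesianProduct f []       ys = refl
sumᶻ-cartesianProduct f (x ∷ xs) ys = trans (sumᶻ-++ f (map (x ,_) ys) (cartesianProduct xs ys))
  (cong₂ ℤ._+_ (sumᶻ-map f (x ,_) ys) (sumᶻ-cartesianProduct f xs ys))

sumᶻ-single : ∀ {A : Set} {f : A → ℤ} {xs} (x₀ : A) → DecidableEquality A → Unique xs →
  (∀ x → x ≢ x₀ → f x ≡ pos 0) → (x₀ ∉ˡ xs → f x₀ ≡ pos 0) → sumᶻ f xs ≡ f x₀
sumᶻ-single {xs = []} x₀ _≟′_ [] off out = sym (out λ ())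
sumᶻ-single {f = f} {x ∷ xs} x₀ _≟′_ (x∉ ∷ u) off out with x ≟′ x₀
... | yes refl = trans (cong (λ z → f x ℤ.+ z) (sumᶻ-zero xs λ y y∈ → off y λ { refl → All.lookup x∉ y∈ refl })) (ℤ.+-identityʳ (f x))
... | no x≢x₀ = trans (cong₂ ℤ._+_ (off x x≢x₀) (sumᶻ-single x₀ _≟′_ u off λ x₀∉ → out λ { (here e) → x≢x₀ (sym e) ; (there x₀∈) → x₀∉ x₀∈ }))
                      (ℤ.+-identityˡ (f x₀))

-- Only the supports of f and g need to be matched, so the lists may contain irrelevant entries.
-- Each x in the support is cancelled together with its partner y, which is cut out of the other
-- list.
sumᶻ-bijection : ∀ {A B : Set} {f : A → ℤ} {g : B → ℤ} {xs ys} (R : A → B → Set) → Unique xs → Unique ys →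
  (∀ x → x ∈ˡ xs → f x ≢ pos 0 → ∃[ y ] y ∈ˡ ys × R x y × f x ≡ g y) →
  (∀ y → y ∈ˡ ys → g y ≢ pos 0 → ∃[ x ] x ∈ˡ xs × R x y × f x ≡ g y) →
  (∀ {x y y′} → R x y → R x y′ → y ≡ y′) → (∀ {x x′ y} → R x y → R x′ y → x ≡ x′) →
  sumᶻ f xs ≡ sumᶻ g ys
sumᶻ-bijection {f = f} {g} {[]} {ys} R ux uy to from functional injective =
  sym (sumᶻ-zero ys λ y y∈ → decide y y∈ (g y ℤ.≟ pos 0))
  where
  decide : ∀ y → y ∈ˡ ys → Dec (g y ≡ pos 0) → g y ≡ pos 0
  decide y y∈ (yes e) = e
  decide y y∈ (no ne) with from y y∈ ne
  ... | _ , () , _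
sumᶻ-bijection {A = A} {B = B} {f = f} {g} {x ∷ xs} {ys} R (x∉ ∷ ux) uy to from functional injective with f x ℤ.≟ pos 0
... | yes fx≡0 = trans (cong (ℤ._+ sumᶻ f xs) fx≡0) (trans (ℤ.+-identityˡ _)
    (sumᶻ-bijection R ux uy (λ x′ x′∈ → to x′ (there x′∈)) from′ functional injective))
  where
  from′ : ∀ y → y ∈ˡ ys → g y ≢ pos 0 → ∃[ x′ ] x′ ∈ˡ xs × R x′ y × f x′ ≡ g y
  from′ y y∈ ne with from y y∈ ne
  ... | x′ , here refl , _ , e = ⊥-elim (ne (trans (sym e) fx≡0))
  ... | x′ , there x′∈ , ρ , e = x′ , x′∈ , ρ , e
... | no fx≢0 with to x (here refl) fx≢0
...   | y , y∈ , ρ , fx≡gy with Mem.∈-∃++ y∈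
...     | as , bs , refl = begin
  f x ℤ.+ sumᶻ f xs                          ≡⟨ cong₂ ℤ._+_ fx≡gy (sumᶻ-bijection R ux uy′ to′ from′ functional injective) ⟩
  g y ℤ.+ sumᶻ g (as ++ bs)                  ≡⟨ cong (λ z → g y ℤ.+ z) (sumᶻ-++ g as bs) ⟩
  g y ℤ.+ (sumᶻ g as ℤ.+ sumᶻ g bs)          ≡⟨ ℤ+.x∙yz≈y∙xz (g y) (sumᶻ g as) (sumᶻ g bs) ⟩
  sumᶻ g as ℤ.+ (g y ℤ.+ sumᶻ g bs)          ≡⟨ sumᶻ-++ g as (y ∷ bs) ⟨
  sumᶻ g (as ++ y ∷ bs)                      ∎
  where
  open ≡-Reasoning
  drop : ∀ (as : List B) {bs} → Unique (as ++ y ∷ bs) → Unique (as ++ bs) × y ∉ˡ (as ++ bs)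
  drop []       (y∉ ∷ u) = u , λ y∈ → All.lookup y∉ y∈ refl
  drop (z ∷ as) {bs} (z∉ ∷ u) with drop as u
  ... | u′ , y∉ = (All.++⁺ (All.++⁻ˡ as z∉) (All.tail (All.++⁻ʳ as z∉)) ∷ u′) ,
    λ { (here refl) → All.lookup z∉ (Mem.∈-++⁺ʳ as (here refl)) refl ; (there y∈) → y∉ y∈ }
  uy′ : Unique (as ++ bs)
  uy′ = proj₁ (drop as uy)
  y∉ : y ∉ˡ (as ++ bs)
  y∉ = proj₂ (drop as uy)
  restrict : ∀ {y′} → y′ ∈ˡ (as ++ y ∷ bs) → y′ ≢ y → y′ ∈ˡ (as ++ bs)
  restrict y′∈ ne with Mem.∈-++⁻ as y′∈
  ... | inj₁ ∈as          = Mem.∈-++⁺ˡ ∈as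
  ... | inj₂ (here e)     = ⊥-elim (ne e)
  ... | inj₂ (there ∈bs)  = Mem.∈-++⁺ʳ as ∈bs
  extend′ : ∀ {y′} → y′ ∈ˡ (as ++ bs) → y′ ∈ˡ (as ++ y ∷ bs)
  extend′ y′∈ with Mem.∈-++⁻ as y′∈
  ... | inj₁ ∈as = Mem.∈-++⁺ˡ ∈as
  ... | inj₂ ∈bs = Mem.∈-++⁺ʳ as (there ∈bs)
  to′ : ∀ x′ → x′ ∈ˡ xs → f x′ ≢ pos 0 → ∃[ y′ ] y′ ∈ˡ (as ++ bs) × R x′ y′ × f x′ ≡ g y′
  to′ x′ x′∈ ne with to x′ (there x′∈) ne
  ... | y′ , y′∈ , ρ′ , e = y′ , restrict y′∈ (λ { refl → All.lookup x∉ x′∈ (injective ρ ρ′) }) , ρ′ , e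
  from′ : ∀ y′ → y′ ∈ˡ (as ++ bs) → g y′ ≢ pos 0 → ∃[ x′ ] x′ ∈ˡ xs × R x′ y′ × f x′ ≡ g y′
  from′ y′ y′∈ ne with from y′ (extend′ y′∈) ne
  ... | x′ , here refl , ρ′ , e = ⊥-elim (y∉ (subst (_∈ˡ (as ++ bs)) (functional ρ′ ρ) y′∈))
  ... | x′ , there x′∈ , ρ′ , e = x′ , x′∈ , ρ′ , e

-- The value at p of the linear form that takes the value φ k at (q^½)^k.
pair : Poly → (ℕ → ℤ) → ℤ
pair []      φ = pos 0
pair (a ∷ p) φ = a ℤ.* φ 0 ℤ.+ pair p (φ ∘ suc)

pair-cong : ∀ p {φ ψ} → (∀ k → φ k ≡ ψ k) → pair p φ ≡ pair p ψ
pair-cong []      e = refl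
pair-cong (a ∷ p) e = cong₂ (λ x y → a ℤ.* x ℤ.+ y) (e 0) (pair-cong p (e ∘ suc))

pair-zero : ∀ p → pair p (λ _ → pos 0) ≡ pos 0
pair-zero []      = refl
pair-zero (a ∷ p) = cong₂ ℤ._+_ (ℤ.*-zeroʳ a) (pair-zero p)

pair-+ʳ : ∀ p φ ψ → pair p (λ k → φ k ℤ.+ ψ k) ≡ pair p φ ℤ.+ pair p ψ
pair-+ʳ []      φ ψ = refl
pair-+ʳ (a ∷ p) φ ψ = trans (cong (λ z → a ℤ.* (φ 0 ℤ.+ ψ 0) ℤ.+ z) (pair-+ʳ p (φ ∘ suc) (ψ ∘ suc)))
                            (lemma a (φ 0) (ψ 0) _ _)
  where
  lemma : ∀ a x y z w → a ℤ.* (x ℤ.+ y) ℤ.+ (z ℤ.+ w) ≡ a ℤ.* x ℤ.+ z ℤ.+ (a ℤ.* y ℤ.+ w)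
  lemma = ℤ-solve-∀

pair-+ᴾ : ∀ p p′ φ → pair (p +ᴾ p′) φ ≡ pair p φ ℤ.+ pair p′ φ
pair-+ᴾ []      p′       φ = sym (ℤ.+-identityˡ _)
pair-+ᴾ (a ∷ p) []       φ = sym (ℤ.+-identityʳ _)
pair-+ᴾ (a ∷ p) (b ∷ p′) φ = trans (cong (λ z → (a ℤ.+ b) ℤ.* φ 0 ℤ.+ z) (pair-+ᴾ p p′ (φ ∘ suc)))
                                   (lemma a b (φ 0) _ _)
  where
  lemma : ∀ a b x y z → (a ℤ.+ b) ℤ.* x ℤ.+ (y ℤ.+ z) ≡ a ℤ.* x ℤ.+ y ℤ.+ (b ℤ.* x ℤ.+ z)
  lemma = ℤ-solve-∀

pair-map : ∀ a p φ → pair (map (a ℤ.*_) p) φ ≡ a ℤ.* pair p φ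
pair-map a []      φ = sym (ℤ.*-zeroʳ a)
pair-map a (b ∷ p) φ = trans (cong (λ z → a ℤ.* b ℤ.* φ 0 ℤ.+ z) (pair-map a p (φ ∘ suc))) (lemma a b (φ 0) _)
  where
  lemma : ∀ a b x y → a ℤ.* b ℤ.* x ℤ.+ a ℤ.* y ≡ a ℤ.* (b ℤ.* x ℤ.+ y)
  lemma = ℤ-solve-∀

pair-*ᴾ : ∀ p p′ φ → pair (p *ᴾ p′) φ ≡ pair p (λ k → pair p′ (λ l → φ (k + l)))
pair-*ᴾ []      p′ φ = refl
pair-*ᴾ (a ∷ p) p′ φ = trans (pair-+ᴾ (map (a ℤ.*_) p′) (pos 0 ∷ p *ᴾ p′) φ)
  (cong₂ ℤ._+_ (pair-map a p′ φ) (trans (ℤ.+-identityˡ _) (pair-*ᴾ p p′ (φ ∘ suc))))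

pair-q½^ : ∀ k φ → pair (q½^ k) φ ≡ φ k
pair-q½^ zero    φ = trans (ℤ.+-identityʳ _) (ℤ.*-identityˡ (φ 0))
pair-q½^ (suc k) φ = trans (ℤ.+-identityˡ _) (pair-q½^ k (φ ∘ suc))

pair-δ : ∀ p t → pair p (λ k → pos (δ t k)) ≡ coeff p t
pair-δ []      t       = refl
pair-δ (a ∷ p) zero    = trans (cong₂ ℤ._+_ (ℤ.*-identityʳ a) (pair-zero p)) (ℤ.+-identityʳ a)
pair-δ (a ∷ p) (suc t) = trans (cong₂ ℤ._+_ (ℤ.*-zeroʳ a) (pair-δ p t)) (ℤ.+-identityˡ _)

-- The value of the linear form that takes the value Φ k μ at (q^½)^k μ. Under such forms,
-- composition of operators becomes nesting and multiplication of polynomials becomes addition of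
-- exponents.
integrate : Module → (ℕ → Partition → ℤ) → ℤ
integrate v Φ = sumᶻ (λ (p , μ) → pair p (λ k → Φ k μ)) v

integrate-++ : ∀ v w Φ → integrate (v ++ w) Φ ≡ integrate v Φ ℤ.+ integrate w Φ
integrate-++ v w Φ = sumᶻ-++ _ v w

integrate-• : ∀ p v Φ → integrate (p • v) Φ ≡ pair p (λ k → integrate v (λ l μ → Φ (k + l) μ))
integrate-• p []            Φ = sym (pair-zero p)
integrate-• p ((p′ , μ) ∷ v) Φ = trans (cong₂ ℤ._+_ (pair-*ᴾ p p′ (λ k → Φ k μ)) (integrate-• p v Φ))
  (sym (pair-+ʳ p _ _))

integrate-extend : ∀ f v Φ → integrate (extend f v) Φ ≡ integrate v (λ k κ → integrate (f κ) (λ l μ → Φ (k + l) μ))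
integrate-extend f []            Φ = refl
integrate-extend f ((p , κ) ∷ v) Φ = trans (integrate-++ (p • f κ) (extend f v) Φ)
  (cong₂ ℤ._+_ (integrate-• p (f κ) Φ) (integrate-extend f v Φ))

-- The linear form that extracts the coefficient of (q^½)^t μ.
probe : Partition → ℕ → ℕ → Partition → ℤ
probe μ t k ν with μ ≟ᴾ ν
... | yes _ = pos (δ t k)
... | no  _ = pos 0

probe-refl : ∀ μ t k → probe μ t k μ ≡ pos (δ t k)
probe-refl μ t k with μ ≟ᴾ μ
... | yes _ = refl
... | no ne = ⊥-elim (ne refl)

probe-≢ : ∀ {μ ν} t k → ν ≢ μ → probe μ t k ν ≡ pos 0
probe-≢ {μ} {ν} t k ne with μ ≟ᴾ ν
... | yes e = ⊥-elim (ne (sym e))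
... | no _  = refl

coeff-coefficient : ∀ μ v t → coeff (coefficient μ v) t ≡ integrate v (probe μ t)
coeff-coefficient μ []            t = refl
coeff-coefficient μ ((p , ν) ∷ v) t with μ ≟ᴾ ν
... | yes _ = trans (sym (pair-δ (p +ᴾ coefficient μ v) t)) (trans (pair-+ᴾ p (coefficient μ v) _)
                (cong (λ z → pair p (λ k → pos (δ t k)) ℤ.+ z) (trans (pair-δ (coefficient μ v) t) (coeff-coefficient μ v t))))
... | no _  = trans (coeff-coefficient μ v t) (trans (sym (ℤ.+-identityˡ _)) (cong (ℤ._+ integrate v (probe μ t)) (sym (pair-zero p))))

integrate-foldr : ∀ Fs μ Φ → integrate (foldr _+ᴱ_ 0ᴱ Fs μ) Φ ≡ sumᶻ (λ F → integrate (F μ) Φ) Fs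
integrate-foldr []       μ Φ = refl
integrate-foldr (F ∷ Fs) μ Φ = trans (integrate-++ (F μ) _ Φ) (cong (λ z → integrate (F μ) Φ ℤ.+ z) (integrate-foldr Fs μ Φ))

pair-foldr : ∀ ps φ → pair (foldr _+ᴾ_ 0ᴾ ps) φ ≡ sumᶻ (λ p → pair p φ) ps
pair-foldr []       φ = refl
pair-foldr (p ∷ ps) φ = trans (pair-+ᴾ p _ φ) (cong (λ z → pair p φ ℤ.+ z) (pair-foldr ps φ))

sumᶻ-double : ∀ {B : Set} (f : B → ℤ) (h : ℕ → ℕ → B) is js →
  sumᶻ f (concatMap (λ i → map (h i) js) is) ≡ sumᶻ (λ i → sumᶻ (λ j → f (h i j)) js) is
sumᶻ-double f h is js = trans (sumᶻ-concatMap f (λ i → map (h i) js) is) (sumᶻ-cong is λ i → sumᶻ-map f (h i) js)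

sumᶻ-applyUpTo-zero : ∀ n (h : ℕ → ℕ) (f : ℕ → ℤ) → (∀ i → f (h i) ≡ pos 0) → sumᶻ f (applyUpTo h n) ≡ pos 0
sumᶻ-applyUpTo-zero zero    h f z = refl
sumᶻ-applyUpTo-zero (suc n) h f z = cong₂ ℤ._+_ (z 0) (sumᶻ-applyUpTo-zero n (h ∘ suc) f (z ∘ suc))

sumᶻ-upTo-first : ∀ n (f : ℕ → ℤ) → (∀ i → f (suc i) ≡ pos 0) → sumᶻ f (upTo (suc n)) ≡ f 0
sumᶻ-upTo-first n f z = trans (cong (λ y → f 0 ℤ.+ y) (sumᶻ-applyUpTo-zero n suc f z)) (ℤ.+-identityʳ (f 0))

sumᶻ-upTo-last : ∀ n (f : ℕ → ℤ) → (∀ i → i < n → f i ≡ pos 0) → sumᶻ f (upTo (suc n)) ≡ f n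
sumᶻ-upTo-last n f z = begin
  sumᶻ f (upTo (suc n))                      ≡⟨ cong (sumᶻ f) (List.upTo-∷ʳ n) ⟨
  sumᶻ f (upTo n ++ n ∷ [])                  ≡⟨ sumᶻ-++ f (upTo n) (n ∷ []) ⟩
  sumᶻ f (upTo n) ℤ.+ (f n ℤ.+ pos 0)        ≡⟨ cong₂ ℤ._+_ (sumᶻ-zero (upTo n) λ i i∈ → z i (Mem.∈-upTo⁻ i∈)) (ℤ.+-identityʳ (f n)) ⟩
  pos 0 ℤ.+ f n                              ≡⟨ ℤ.+-identityˡ (f n) ⟩
  f n                                        ∎
  where open ≡-Reasoning

-- The commutation relation

guard : ∀ {A : Set} → Dec A → ℤ → ℤ
guard (yes _) z = z
guard (no _)  z = pos 0

guard-yes : ∀ {A : Set} (d : Dec A) {z} → A → guard d z ≡ z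
guard-yes (yes _) a = refl
guard-yes (no ¬a) a = ⊥-elim (¬a a)

guard-no : ∀ {A : Set} (d : Dec A) {z} → ¬ A → guard d z ≡ pos 0
guard-no (yes a) ¬a = ⊥-elim (¬a a)
guard-no (no _)  ¬a = refl

guard-≢0 : ∀ {A : Set} (d : Dec A) {z} → guard d z ≢ pos 0 → A × z ≢ pos 0
guard-≢0 (yes a) ne = a , ne
guard-≢0 (no _)  ne = ⊥-elim (ne refl)

guard-cong : ∀ {A : Set} (d : Dec A) {y z} → y ≡ z → guard d y ≡ guard d z
guard-cong d refl = refl

guard-0 : ∀ {A : Set} (d : Dec A) → guard d (pos 0) ≡ pos 0
guard-0 (yes _) = refl
guard-0 (no _)  = refl

guard-⇔ : ∀ {A B : Set} (d : Dec A) (e : Dec B) {z} → (A → B) → (B → A) → guard d z ≡ guard e z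
guard-⇔ (yes a) e to from = sym (guard-yes e (to a))
guard-⇔ (no ¬a) e to from = sym (guard-no e (¬a ∘ from))

guard-sumᶻ : ∀ {A B : Set} (d : Dec A) (f : B → ℤ) xs → guard d (sumᶻ f xs) ≡ sumᶻ (λ x → guard d (f x)) xs
guard-sumᶻ (yes _) f xs = refl
guard-sumᶻ (no _)  f xs = sym (sumᶻ-zero xs λ _ _ → refl)

sumᶻ-filter : ∀ {A : Set} {P : A → Set} (P? : ∀ x → Dec (P x)) (f : A → ℤ) xs →
  sumᶻ f (filter P? xs) ≡ sumᶻ (λ x → guard (P? x) (f x)) xs
sumᶻ-filter P? f []       = refl
sumᶻ-filter P? f (x ∷ xs) with P? x
... | yes _ = cong (λ z → f x ℤ.+ z) (sumᶻ-filter P? f xs)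
... | no _  = trans (sumᶻ-filter P? f xs) (sym (ℤ.+-identityˡ _))

module _ {_∼_ : Rel ℤ 0ℓ} {r : ℕ} {λ′ μ : Partition} where

  overStrip : Dec (Strip _∼_ r λ′ μ) → (ℕ → ℤ) → ℤ
  overStrip d φ = pair (q^spin d) φ

  -- Which strip the decision procedure finds is immaterial as long as φ takes the same value on the
  -- heights of all strips.
  overStrip-any : ∀ d {φ z} → Strip _∼_ r λ′ μ → (∀ (s : Strip _∼_ r λ′ μ) → φ (heightSum (proj₁ s)) ≡ z) → overStrip d φ ≡ z
  overStrip-any (yes s) {φ} _ e = trans (pair-q½^ (heightSum (proj₁ s)) φ) (e s)
  overStrip-any (no ¬s) s e = ⊥-elim (¬s s)

  overStrip-≢0 : ∀ d {φ} → overStrip d φ ≢ pos 0 → Σ[ s ∈ Strip _∼_ r λ′ μ ] φ (heightSum (proj₁ s)) ≢ pos 0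
  overStrip-≢0 (yes s) {φ} ne = s , λ e → ne (trans (pair-q½^ (heightSum (proj₁ s)) φ) e)
  overStrip-≢0 (no _)  ne = ⊥-elim (ne refl)

  overStrip-no : ∀ d {φ} → ¬ Strip _∼_ r λ′ μ → overStrip d φ ≡ pos 0
  overStrip-no (yes s) ¬s = ⊥-elim (¬s s)
  overStrip-no (no _)  ¬s = refl

  overStrip-cong : ∀ d {φ ψ} → (∀ k → φ k ≡ ψ k) → overStrip d φ ≡ overStrip d ψ
  overStrip-cong d e = pair-cong (q^spin d) e

  overStrip-0 : ∀ d {φ} → (∀ k → φ k ≡ pos 0) → overStrip d φ ≡ pos 0
  overStrip-0 d e = trans (pair-cong (q^spin d) e) (pair-zero (q^spin d))

guard-overStrip-≢0 : ∀ {A : Set} {_∼_ : Rel ℤ 0ℓ} {r λ′ μ} (d : Dec A) (e : Dec (Strip _∼_ r λ′ μ)) {φ} →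
  guard d (overStrip e φ) ≢ pos 0 → A × Σ[ s ∈ Strip _∼_ r λ′ μ ] φ (heightSum (proj₁ s)) ≢ pos 0
guard-overStrip-≢0 (yes a) e ≢0 = a , overStrip-≢0 e ≢0
guard-overStrip-≢0 (no _)  e ≢0 = ⊥-elim (≢0 refl)

-- The product over 1 + q^i XY as a sum over bit vectors

allBits : ∀ r → List (Bits r)
allBits zero    = [] ∷ []
allBits (suc r) = map (0F ∷_) (allBits r) ++ map (sucF 0F ∷_) (allBits r)

allBits-complete : ∀ {r} (a : Bits r) → a ∈ˡ allBits r
allBits-complete []               = here refl
allBits-complete (0F ∷ a)         = Mem.∈-++⁺ˡ (Mem.∈-map⁺ (0F ∷_) (allBits-complete a))
allBits-complete {suc r} (sucF 0F ∷ a) = Mem.∈-++⁺ʳ (map (0F ∷_) (allBits r)) (Mem.∈-map⁺ (sucF 0F ∷_) (allBits-complete a))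

allBits-unique : ∀ r → Unique (allBits r)
allBits-unique zero    = [] ∷ []
allBits-unique (suc r) = Unique.++⁺ (Unique.map⁺ Vec.∷-injectiveʳ (allBits-unique r)) (Unique.map⁺ Vec.∷-injectiveʳ (allBits-unique r))
  λ (p , q) → case (Mem.∈-map⁻ (0F ∷_) p) (Mem.∈-map⁻ (sucF 0F ∷_) q)
  where
  case : ∀ {v : Bits (suc r)} → ∃[ a ] a ∈ˡ allBits r × v ≡ 0F ∷ a → ∃[ b ] b ∈ˡ allBits r × v ≡ sucF 0F ∷ b → _
  case (_ , _ , refl) (_ , _ , ())

weightedSum : ∀ {r} → (ℕ → ℕ) → Bits r → ℕ
weightedSum f a = Vec.sum (Vec.tabulate λ i → f (toℕ i) * toℕ (Vec.lookup a i))

pair-*ˢ : ∀ F G m n φ → pair ((F *ˢ G) m n) φ ≡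
  sumᶻ (λ i → sumᶻ (λ j → pair (F i j) (λ k → pair (G (m ∸ i) (n ∸ j)) (λ l → φ (k + l)))) (upTo (suc n))) (upTo (suc m))
pair-*ˢ F G m n φ = trans (pair-foldr (concatMap (λ i → map (λ j → F i j *ᴾ G (m ∸ i) (n ∸ j)) (upTo (suc n))) (upTo (suc m))) φ)
  (trans (sumᶻ-double (λ p → pair p φ) (λ i j → F i j *ᴾ G (m ∸ i) (n ∸ j)) (upTo (suc m)) (upTo (suc n)))
    (sumᶻ-cong (upTo (suc m)) λ i → sumᶻ-cong (upTo (suc n)) λ j → pair-*ᴾ (F i j) (G (m ∸ i) (n ∸ j)) φ))

-- The contribution of the summand (q^½)^e XY of a factor: it lowers both exponents by one, so it is
-- zero unless both are positive.
lowerTerm : (Q : Series Poly) (e m n : ℕ) → (ℕ → ℤ) → ℤ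
lowerTerm Q e (suc m) (suc n) φ = pair (Q m n) (λ l → φ (e + l))
lowerTerm Q e _       _       φ = pos 0

pair-1+q^ : ∀ i Q m n φ → pair (((1+q^ i XY) *ˢ Q) m n) φ ≡ pair (Q m n) φ ℤ.+ lowerTerm Q (2 * i) m n φ
pair-1+q^ i Q m n φ = trans (pair-*ˢ (1+q^ i XY) Q m n φ) (cong₂ ℤ._+_ (row₀ m n) (rows m n))
  where
  term : (m n x y : ℕ) → ℤ
  term m n x y = pair ((1+q^ i XY) x y) (λ k → pair (Q (m ∸ x) (n ∸ y)) (λ l → φ (k + l)))
  row₀ : ∀ m n → sumᶻ (term m n 0) (upTo (suc n)) ≡ pair (Q m n) φ
  row₀ m n = trans (sumᶻ-upTo-first n (term m n 0) λ _ → refl) (trans (ℤ.+-identityʳ _) (ℤ.*-identityˡ (pair (Q m n) φ)))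
  row₁ : ∀ m n → sumᶻ (term (suc m) n 1) (upTo (suc n)) ≡ lowerTerm Q (2 * i) (suc m) n φ
  row₁ m zero    = refl
  row₁ m (suc n) = begin
    pos 0 ℤ.+ (term (suc m) (suc n) 1 1 ℤ.+ rest)    ≡⟨ ℤ.+-identityˡ _ ⟩
    term (suc m) (suc n) 1 1 ℤ.+ rest                ≡⟨ cong₂ ℤ._+_ (pair-q½^ (2 * i) (λ k → pair (Q m n) (λ l → φ (k + l))))
                                                          (sumᶻ-applyUpTo-zero n (suc ∘ suc) (term (suc m) (suc n) 1) λ _ → refl) ⟩
    pair (Q m n) (λ l → φ (2 * i + l)) ℤ.+ pos 0     ≡⟨ ℤ.+-identityʳ _ ⟩
    pair (Q m n) (λ l → φ (2 * i + l))               ∎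
    where
    open ≡-Reasoning
    rest = sumᶻ (term (suc m) (suc n) 1) (applyUpTo (suc ∘ suc) n)
  rows : ∀ m n → sumᶻ (λ x → sumᶻ (term m n x) (upTo (suc n))) (applyUpTo suc m) ≡ lowerTerm Q (2 * i) m n φ
  rows zero    zero    = refl
  rows zero    (suc n) = refl
  rows (suc m) n = trans (cong₂ ℤ._+_ (row₁ m n) (sumᶻ-applyUpTo-zero m (suc ∘ suc) _
      λ x → sumᶻ-zero (upTo (suc n)) λ _ _ → refl)) (ℤ.+-identityʳ _)

-- A bit vector records whether 1 or the other summand is chosen from each factor. General exponents
-- `f` are needed because removing the first factor turns `f` into `f ∘ suc`; for the identity,
-- `weightedSum` is n(a).
pair-∏ : ∀ (f : ℕ → ℕ) r m n φ → pair (foldr _*ˢ_ 1ˢ (map 1+q^_XY (applyUpTo f r)) m n) φ ≡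
  sumᶻ (λ a → guard (∣ a ∣ᵇ ≟ m) (guard (∣ a ∣ᵇ ≟ n) (φ (2 * weightedSum f a)))) (allBits r)
pair-∏ f zero zero    zero    φ = cong (ℤ._+ pos 0) (ℤ.*-identityˡ (φ 0))
pair-∏ f zero zero    (suc n) φ = refl
pair-∏ f zero (suc m) n       φ = refl
pair-∏ f (suc r) m n φ = begin
  pair (((1+q^ f 0 XY) *ˢ Q) m n) φ
    ≡⟨ pair-1+q^ (f 0) Q m n φ ⟩
  pair (Q m n) φ ℤ.+ lowerTerm Q (2 * f 0) m n φ
    ≡⟨ cong₂ ℤ._+_ (trans (pair-∏ (f ∘ suc) r m n φ) (sumᶻ-cong (allBits r) λ a → guard-cong (∣ a ∣ᵇ ≟ m) (guard-cong (∣ a ∣ᵇ ≟ n)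
         (cong (λ x → φ (2 * (x + weightedSum (f ∘ suc) a))) (sym (*-zeroʳ (f 0))))))) (ones m n) ⟩
  sumᶻ (G ∘ (0F ∷_)) (allBits r) ℤ.+ sumᶻ (G ∘ (sucF 0F ∷_)) (allBits r)
    ≡⟨ cong₂ ℤ._+_ (sym (sumᶻ-map G (0F ∷_) (allBits r))) (sym (sumᶻ-map G (sucF 0F ∷_) (allBits r))) ⟩
  sumᶻ G (map (0F ∷_) (allBits r)) ℤ.+ sumᶻ G (map (sucF 0F ∷_) (allBits r))
    ≡⟨ sumᶻ-++ G (map (0F ∷_) (allBits r)) (map (sucF 0F ∷_) (allBits r)) ⟨
  sumᶻ G (allBits (suc r)) ∎
  where
  open ≡-Reasoning
  Q : Series Poly
  Q = foldr _*ˢ_ 1ˢ (map 1+q^_XY (applyUpTo (f ∘ suc) r))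
  G : Bits (suc r) → ℤ
  G a = guard (∣ a ∣ᵇ ≟ m) (guard (∣ a ∣ᵇ ≟ n) (φ (2 * weightedSum f a)))
  ones : ∀ m n → lowerTerm Q (2 * f 0) m n φ ≡
    sumᶻ (λ a → guard (suc ∣ a ∣ᵇ ≟ m) (guard (suc ∣ a ∣ᵇ ≟ n) (φ (2 * weightedSum f (sucF 0F ∷ a))))) (allBits r)
  ones zero n = sym (sumᶻ-zero (allBits r) λ _ _ → refl)
  ones (suc m) zero = sym (sumᶻ-zero (allBits r) λ a _ →
    guard-0 (suc ∣ a ∣ᵇ ≟ suc m))
  ones (suc m) (suc n) = trans (pair-∏ (f ∘ suc) r m n (λ l → φ (2 * f 0 + l))) (sumᶻ-cong (allBits r) λ a →
    trans (guard-⇔ (∣ a ∣ᵇ ≟ m) (suc ∣ a ∣ᵇ ≟ suc m) (cong suc) suc-injective)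
      (guard-cong (suc ∣ a ∣ᵇ ≟ suc m) (trans (guard-⇔ (∣ a ∣ᵇ ≟ n) (suc ∣ a ∣ᵇ ≟ suc n) (cong suc) suc-injective)
        (guard-cong (suc ∣ a ∣ᵇ ≟ suc n) (cong φ (identity (f 0) (weightedSum (f ∘ suc) a)))))))
    where
    identity : ∀ x y → 2 * x + 2 * y ≡ 2 * (x * 1 + y)
    identity = solve-∀

integrate-convolve : ∀ {A B : Set} (_⊛_ : A → B → End) (F : Series A) (G : Series B) m n μ Φ →
  integrate (convolve _+ᴱ_ 0ᴱ _⊛_ F G m n μ) Φ ≡
  sumᶻ (λ i → sumᶻ (λ j → integrate ((F i j ⊛ G (m ∸ i) (n ∸ j)) μ) Φ) (upTo (suc n))) (upTo (suc m))
integrate-convolve _⊛_ F G m n μ Φ =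
  trans (integrate-foldr (concatMap (λ i → map (λ j → F i j ⊛ G (m ∸ i) (n ∸ j)) (upTo (suc n))) (upTo (suc m))) μ Φ)
        (sumᶻ-double (λ E → integrate (E μ) Φ) (λ i j → F i j ⊛ G (m ∸ i) (n ∸ j)) (upTo (suc m)) (upTo (suc n)))

-- Both sides of the commutation relation as sums over strips

module Operators (r′ : ℕ) where

  private
    r : ℕ
    r = suc r′

  integrate-U : ∀ m λ′ Φ → integrate (U r m 0 λ′) Φ ≡
    sumᶻ (λ μ → guard (skewSize/ r μ λ′ ≟ m) (overStrip (hstrip? r λ′ μ) (λ k → Φ k μ))) (partitionsIn (size λ′ + r * m))
  integrate-U m λ′ Φ =
    trans (sumᶻ-map _ (λ μ → q^spin (hstrip? r λ′ μ) , μ) (filter (λ μ → skewSize/ r μ λ′ ≟ m) (partitionsIn (size λ′ + r * m))))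
          (sumᶻ-filter (λ μ → skewSize/ r μ λ′ ≟ m) _ (partitionsIn (size λ′ + r * m)))

  integrate-D̃ : ∀ n λ′ Φ → integrate (D̃ r 0 n λ′) Φ ≡
    sumᶻ (λ μ → guard (skewSize/ r λ′ μ ≟ n) (overStrip (vstrip? r μ λ′) (λ k → Φ k μ))) (partitionsIn (size λ′))
  integrate-D̃ n λ′ Φ =
    trans (sumᶻ-map _ (λ μ → q^spin (vstrip? r μ λ′) , μ) (filter (λ μ → skewSize/ r λ′ μ ≟ n) (partitionsIn (size λ′))))
          (sumᶻ-filter (λ μ → skewSize/ r λ′ μ ≟ n) _ (partitionsIn (size λ′)))

  private
    extend-[] : ∀ f v → (∀ κ → f κ ≡ []) → extend f v ≡ []
    extend-[] f []            e = refl
    extend-[] f ((p , κ) ∷ v) e rewrite e κ = extend-[] f v e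

  -- `U` involves powers of X only and `D̃` powers of Y only, so a single term of the convolution
  -- survives.
  integrate-D̃∘U : ∀ m n ν Φ → integrate ((D̃ r ∘ˢ U r) m n ν) Φ ≡
    integrate (U r m 0 ν) (λ k κ → integrate (D̃ r 0 n κ) (λ l μ → Φ (k + l) μ))
  integrate-D̃∘U m n ν Φ = trans (integrate-convolve _∘ᴱ_ (D̃ r) (U r) m n ν Φ)
    (trans (sumᶻ-upTo-first m (λ i → sumᶻ (term i) (upTo (suc n))) λ i → sumᶻ-zero (upTo (suc n)) λ j _ →
              cong (λ v → integrate v Φ) (extend-[] (D̃ r (suc i) j) (U r (m ∸ suc i) (n ∸ j) ν) λ _ → refl))
    (trans (sumᶻ-upTo-last n (term 0) early)
    (trans (cong (λ x → integrate (extend (D̃ r 0 n) (U r m x ν)) Φ) (n∸n≡0 n))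
           (integrate-extend (D̃ r 0 n) (U r m 0 ν) Φ))))
    where
    term : ℕ → ℕ → ℤ
    term i j = integrate (extend (D̃ r i j) (U r (m ∸ i) (n ∸ j) ν)) Φ
    early : ∀ j → j < n → integrate (extend (D̃ r 0 j) (U r m (n ∸ j) ν)) Φ ≡ pos 0
    early j j<n with n ∸ j | m<n⇒0<n∸m j<n
    ... | suc _ | _ = refl

  integrate-U∘D̃ : ∀ m n ν Φ → integrate ((U r ∘ˢ D̃ r) m n ν) Φ ≡
    integrate (D̃ r 0 n ν) (λ k λ′ → integrate (U r m 0 λ′) (λ l μ → Φ (k + l) μ))
  integrate-U∘D̃ m n ν Φ = trans (integrate-convolve _∘ᴱ_ (U r) (D̃ r) m n ν Φ)
    (trans (sumᶻ-upTo-last m (λ i → sumᶻ (term i) (upTo (suc n))) λ i i<m → sumᶻ-zero (upTo (suc n)) λ j _ → early i i<m j)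
    (trans (sumᶻ-upTo-first n (term m) λ j →
              cong (λ v → integrate v Φ) (extend-[] (U r m (suc j)) (D̃ r (m ∸ m) (n ∸ suc j) ν) λ _ → refl))
    (trans (cong (λ x → integrate (extend (U r m 0) (D̃ r x n ν)) Φ) (n∸n≡0 m))
           (integrate-extend (U r m 0) (D̃ r 0 n ν) Φ))))
    where
    term : ℕ → ℕ → ℤ
    term i j = integrate (extend (U r i j) (D̃ r (m ∸ i) (n ∸ j) ν)) Φ
    early : ∀ i → i < m → ∀ j → integrate (extend (U r i j) (D̃ r (m ∸ i) (n ∸ j) ν)) Φ ≡ pos 0
    early i i<m j with m ∸ i | m<n⇒0<n∸m i<m
    ... | suc _ | _ = refl

  hstrip-size : ∀ {λ′ μ i} → HStrip r λ′ μ → skewSize/ r μ λ′ ≡ i → size μ ≡ size λ′ + r * i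
  hstrip-size {λ′} {μ} {i} s e = trans sizes (cong (λ x → size λ′ + r * x) (trans (sym (skewSize r′ {μ} {λ′} sizes)) e))
    where
    n = List.length (parts μ)
    measured = Strips.hstrip-measured r′ n (edges-encodes n λ′ (chain-length (proj₁ s))) (edges-encodes n μ ≤-refl) s
    sizes : size μ ≡ size λ′ + r * ∑ (HConfig.P (proj₁ measured)) (HConfig.moved (proj₁ measured))
    sizes = proj₂ (proj₂ measured)

  -- Evaluating both sides at ν and extracting the coefficient of (q^½)^t μ, the left
  -- hand side counts the partitions κ above μ and ν, the right hand side the pairs (a, λ).
  module _ (m n t : ℕ) (μ ν : Partition) where

    aboveTerm : Partition → ℤ
    aboveTerm κ = guard (skewSize/ r κ ν ≟ m) (overStrip (hstrip? r ν κ) λ k →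
                    guard (skewSize/ r κ μ ≟ n) (overStrip (vstrip? r μ κ) λ l → pos (δ t (k + l))))

    -- i and j are the exponents of X and Y supplied by `U` and `D̃`; the product supplies the
    -- remaining m - i and n - j through the bit vector.
    Index : Set
    Index = ℕ × ℕ × Bits r × Partition

    belowTerm : Index → ℤ
    belowTerm (i , j , a , λ′) =
      guard (∣ a ∣ᵇ ≟ m ∸ i) (guard (∣ a ∣ᵇ ≟ n ∸ j) (guard (skewSize/ r ν λ′ ≟ j)
        (overStrip (vstrip? r λ′ ν) λ k → guard (skewSize/ r μ λ′ ≟ i)
          (overStrip (hstrip? r λ′ μ) λ l → pos (δ t (2 * n⟨ a ⟩ + (k + l)))))))

    aboves : List Partition
    aboves = partitionsIn (size ν + r * m)

    belows : List Index
    belows = cartesianProduct (upTo (suc m)) (cartesianProduct (upTo (suc n))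
               (cartesianProduct (allBits r) (partitionsIn (size ν))))

    integrate-left : integrate ((D̃ r ∘ˢ U r) m n ν) (probe μ t) ≡ sumᶻ aboveTerm aboves
    integrate-left = trans (integrate-D̃∘U m n ν (probe μ t)) (trans (integrate-U m ν _)
      (sumᶻ-cong aboves λ κ → guard-cong (skewSize/ r κ ν ≟ m) (overStrip-cong (hstrip? r ν κ) λ k → inner κ k)))
      where
      inner : ∀ κ k → integrate (D̃ r 0 n κ) (λ l μ′ → probe μ t (k + l) μ′) ≡
              guard (skewSize/ r κ μ ≟ n) (overStrip (vstrip? r μ κ) λ l → pos (δ t (k + l)))
      inner κ k = trans (integrate-D̃ n κ _) (trans
        -- Only μ′ = μ survives the probe, and if μ were missing from the enumeration there would be
        -- no strip from μ to κ.
        (sumᶻ-single μ _≟ᴾ_ (partitionsIn-unique (size κ))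
          (λ μ′ μ′≢μ → trans (guard-cong (skewSize/ r κ μ′ ≟ n) (overStrip-0 (vstrip? r μ′ κ) λ l → probe-≢ t (k + l) μ′≢μ))
                             (guard-0 (skewSize/ r κ μ′ ≟ n)))
          (λ μ∉ → trans (guard-cong (skewSize/ r κ μ ≟ n) (overStrip-no (vstrip? r μ κ) λ s →
                    μ∉ (partitionsIn-complete μ (chain-size (proj₁ s))))) (guard-0 (skewSize/ r κ μ ≟ n))))
        (guard-cong (skewSize/ r κ μ ≟ n) (overStrip-cong (vstrip? r μ κ) λ l → probe-refl μ t (k + l))))

    integrate-right : integrate (((U r ∘ˢ D̃ r) ·ˢ ∏[i< r ]1+q^iXY) m n ν) (probe μ t) ≡ sumᶻ belowTerm belows
    integrate-right = begin
      integrate (((U r ∘ˢ D̃ r) ·ˢ ∏[i< r ]1+q^iXY) m n ν) (probe μ t)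
        ≡⟨ integrate-convolve (λ f p → p •ᴱ f) (U r ∘ˢ D̃ r) ∏[i< r ]1+q^iXY m n ν (probe μ t) ⟩
      sumᶻ (λ i → sumᶻ (λ j → integrate (∏[i< r ]1+q^iXY (m ∸ i) (n ∸ j) • (U r ∘ˢ D̃ r) i j ν) (probe μ t)) (upTo (suc n))) (upTo (suc m))
        ≡⟨ sumᶻ-cong (upTo (suc m)) (λ i → trans (sumᶻ-cong (upTo (suc n)) (λ j → inner i j))
             (sym (sumᶻ-cartesianProduct (λ y → belowTerm (i , y)) (upTo (suc n)) (cartesianProduct (allBits r) (partitionsIn (size ν)))))) ⟩
      sumᶻ (λ i → sumᶻ (λ y → belowTerm (i , y)) (cartesianProduct (upTo (suc n)) (cartesianProduct (allBits r) (partitionsIn (size ν))))) (upTo (suc m))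
        ≡⟨ sumᶻ-cartesianProduct belowTerm (upTo (suc m)) (cartesianProduct (upTo (suc n)) (cartesianProduct (allBits r) (partitionsIn (size ν)))) ⟨
      sumᶻ belowTerm belows ∎
      where
      open ≡-Reasoning
      inmost : ∀ w λ′ i k → integrate (U r i 0 λ′) (λ l μ′ → probe μ t (w + (k + l)) μ′) ≡
               guard (skewSize/ r μ λ′ ≟ i) (overStrip (hstrip? r λ′ μ) λ l → pos (δ t (w + (k + l))))
      inmost w λ′ i k = trans (integrate-U i λ′ _) (trans
        (sumᶻ-single μ _≟ᴾ_ (partitionsIn-unique (size λ′ + r * i))
          (λ μ′ μ′≢μ → trans (guard-cong (skewSize/ r μ′ λ′ ≟ i) (overStrip-0 (hstrip? r λ′ μ′) λ l → probe-≢ t (w + (k + l)) μ′≢μ))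
                             (guard-0 (skewSize/ r μ′ λ′ ≟ i)))
          (λ μ∉ → outside μ∉ (skewSize/ r μ λ′ ≟ i)))
        (guard-cong (skewSize/ r μ λ′ ≟ i) (overStrip-cong (hstrip? r λ′ μ) λ l → probe-refl μ t (w + (k + l)))))
        where
        -- The guard matters here: a strip from λ to μ puts μ into this enumeration once it is known
        -- to consist of i ribbons.
        outside : μ ∉ˡ partitionsIn (size λ′ + r * i) → ∀ d → guard d (overStrip (hstrip? r λ′ μ) (λ l → probe μ t (w + (k + l)) μ)) ≡ pos 0
        outside μ∉ (no _)  = refl
        outside μ∉ (yes e) = overStrip-no (hstrip? r λ′ μ) λ s → μ∉ (partitionsIn-complete μ (≤-reflexive (hstrip-size s e)))
      inner : ∀ i j → integrate (∏[i< r ]1+q^iXY (m ∸ i) (n ∸ j) • (U r ∘ˢ D̃ r) i j ν) (probe μ t) ≡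
              sumᶻ (λ y → belowTerm (i , j , y)) (cartesianProduct (allBits r) (partitionsIn (size ν)))
      inner i j = begin
        integrate (P • (U r ∘ˢ D̃ r) i j ν) (probe μ t)
          ≡⟨ integrate-• P ((U r ∘ˢ D̃ r) i j ν) (probe μ t) ⟩
        pair P (λ w → integrate ((U r ∘ˢ D̃ r) i j ν) (λ k μ′ → probe μ t (w + k) μ′))
          ≡⟨ pair-cong P (λ w → trans (integrate-U∘D̃ i j ν _) (trans (integrate-D̃ j ν _)
               (sumᶻ-cong (partitionsIn (size ν)) λ λ′ → guard-cong (skewSize/ r ν λ′ ≟ j)
                 (overStrip-cong (vstrip? r λ′ ν) λ k → inmost w λ′ i k)))) ⟩
        pair P (λ w → sumᶻ (value w) (partitionsIn (size ν)))
          ≡⟨ pair-∏ (λ x → x) r (m ∸ i) (n ∸ j) (λ w → sumᶻ (value w) (partitionsIn (size ν))) ⟩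
        sumᶻ (λ a → guard (∣ a ∣ᵇ ≟ m ∸ i) (guard (∣ a ∣ᵇ ≟ n ∸ j) (sumᶻ (value (2 * n⟨ a ⟩)) (partitionsIn (size ν))))) (allBits r)
          ≡⟨ sumᶻ-cong (allBits r) (λ a → trans (guard-cong (∣ a ∣ᵇ ≟ m ∸ i) (guard-sumᶻ (∣ a ∣ᵇ ≟ n ∸ j) (value (2 * n⟨ a ⟩)) (partitionsIn (size ν))))
               (guard-sumᶻ (∣ a ∣ᵇ ≟ m ∸ i) _ (partitionsIn (size ν)))) ⟩
        sumᶻ (λ a → sumᶻ (λ λ′ → belowTerm (i , j , a , λ′)) (partitionsIn (size ν))) (allBits r)
          ≡⟨ sumᶻ-cartesianProduct (λ y → belowTerm (i , j , y)) (allBits r) (partitionsIn (size ν)) ⟨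
        sumᶻ (λ y → belowTerm (i , j , y)) (cartesianProduct (allBits r) (partitionsIn (size ν))) ∎
        where
        P : Poly
        P = ∏[i< r ]1+q^iXY (m ∸ i) (n ∸ j)
        value : ℕ → Partition → ℤ
        value w λ′ = guard (skewSize/ r ν λ′ ≟ j) (overStrip (vstrip? r λ′ ν) λ k →
          guard (skewSize/ r μ λ′ ≟ i) (overStrip (hstrip? r λ′ μ) λ l → pos (δ t (w + (k + l)))))

    linked-terms : ∀ {κ a λ′} (X : Correspondence r′ μ ν κ a λ′) → m ≡ Correspondence.#κ/ν X → n ≡ Correspondence.#κ/μ X →
      aboveTerm κ ≡ belowTerm (Correspondence.#μ/λ X , Correspondence.#ν/λ X , a , λ′)
    linked-terms {κ} {a} {λ′} X m≡ n≡ = trans above (sym below)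
      where
      module X = Correspondence X
      h : ℕ
      -- The common exponent of q^½: both terms reduce to testing whether it equals t.
      h = heightSum (proj₁ X.μ/λ) + heightSum (proj₁ X.ν/λ) + 2 * n⟨ a ⟩
      above : aboveTerm κ ≡ pos (δ t h)
      above = trans (guard-yes (skewSize/ r κ ν ≟ m) (trans (skewSize r′ {κ} {ν} X.size-κ/ν) (sym m≡)))
        (overStrip-any (hstrip? r ν κ) X.κ/ν λ s →
          trans (guard-yes (skewSize/ r κ μ ≟ n) (trans (skewSize r′ {κ} {μ} X.size-κ/μ) (sym n≡)))
          (overStrip-any (vstrip? r μ κ) X.κ/μ λ s′ → cong (pos ∘ δ t)
            (trans (+-comm (heightSum (proj₁ s)) (heightSum (proj₁ s′))) (X.heights s′ s X.μ/λ X.ν/λ))))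
      below : belowTerm (X.#μ/λ , X.#ν/λ , a , λ′) ≡ pos (δ t h)
      below = trans (guard-yes (∣ a ∣ᵇ ≟ m ∸ X.#μ/λ) (sym (trans (cong (_∸ X.#μ/λ) (trans m≡ X.#κ/ν≡)) (m+n∸n≡m ∣ a ∣ᵇ X.#μ/λ))))
        (trans (guard-yes (∣ a ∣ᵇ ≟ n ∸ X.#ν/λ) (sym (trans (cong (_∸ X.#ν/λ) (trans n≡ X.#κ/μ≡)) (m+n∸n≡m ∣ a ∣ᵇ X.#ν/λ))))
        (trans (guard-yes (skewSize/ r ν λ′ ≟ X.#ν/λ) (skewSize r′ {ν} {λ′} X.size-ν/λ))
        (overStrip-any (vstrip? r λ′ ν) X.ν/λ λ s →
          trans (guard-yes (skewSize/ r μ λ′ ≟ X.#μ/λ) (skewSize r′ {μ} {λ′} X.size-μ/λ))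
          (overStrip-any (hstrip? r λ′ μ) X.μ/λ λ s′ → cong (pos ∘ δ t)
            (trans (x∙yz≈zy∙x (2 * n⟨ a ⟩) (heightSum (proj₁ s)) (heightSum (proj₁ s′)))
              (trans (sym (X.heights X.κ/μ X.κ/ν s′ s)) (X.heights X.κ/μ X.κ/ν X.μ/λ X.ν/λ)))))))

    -- i and j are pinned to expressions in `λ′` rather than to counts taken from the
    -- correspondence, so uniqueness of (a, λ) immediately gives uniqueness of the whole index.
    Related : Partition → Index → Set
    Related κ (i , j , a , λ′) = Correspondence r′ μ ν κ a λ′ × i ≡ skewSize/ r μ λ′ × j ≡ skewSize/ r ν λ′

    related-below : ∀ {κ y y′} → Related κ y → Related κ y′ → y ≡ y′
    related-below (X , i≡ , j≡) (Y , i′≡ , j′≡) = match (linked-below r′ μ ν X Y) i≡ j≡ i′≡ j′≡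
      where
      match : ∀ {i j i′ j′ a λ′ a′ ρ} → (a , λ′) ≡ (a′ , ρ) → i ≡ skewSize/ r μ λ′ → j ≡ skewSize/ r ν λ′ →
              i′ ≡ skewSize/ r μ ρ → j′ ≡ skewSize/ r ν ρ → (i , j , a , λ′) ≡ (i′ , j′ , a′ , ρ)
      match refl refl refl refl refl = refl

    related-above : ∀ {κ κ′ y} → Related κ y → Related κ′ y → κ ≡ κ′
    related-above (X , _) (Y , _) = linked-above r′ μ ν X Y

    related : ∀ {κ a λ′} (X : Correspondence r′ μ ν κ a λ′) → Related κ (Correspondence.#μ/λ X , Correspondence.#ν/λ X , a , λ′)
    related {λ′ = λ′} X = X , sym (skewSize r′ {μ} {λ′} (Correspondence.size-μ/λ X)) , sym (skewSize r′ {ν} {λ′} (Correspondence.size-ν/λ X))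

    above-support : ∀ κ → aboveTerm κ ≢ pos 0 →
      (skewSize/ r κ ν ≡ m × HStrip r ν κ) × (skewSize/ r κ μ ≡ n × VStrip r μ κ)
    above-support κ ≢0 = first (guard-overStrip-≢0 (skewSize/ r κ ν ≟ m) (hstrip? r ν κ) ≢0)
      where
      second : ∀ {k} → _ × Σ[ s ∈ VStrip r μ κ ] pos (δ t (k + heightSum (proj₁ s))) ≢ pos 0 → _ × VStrip r μ κ
      second (e , s , _) = e , s
      first : _ × Σ[ s ∈ HStrip r ν κ ] guard (skewSize/ r κ μ ≟ n) (overStrip (vstrip? r μ κ) λ l → pos (δ t (heightSum (proj₁ s) + l))) ≢ pos 0 → _
      first (e , s , ≢0) = (e , s) , second {heightSum (proj₁ s)} (guard-overStrip-≢0 (skewSize/ r κ μ ≟ n) (vstrip? r μ κ) ≢0)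

    below-support : ∀ i j a λ′ → belowTerm (i , j , a , λ′) ≢ pos 0 →
      ∣ a ∣ᵇ ≡ m ∸ i × ∣ a ∣ᵇ ≡ n ∸ j × (skewSize/ r ν λ′ ≡ j × VStrip r λ′ ν) × (skewSize/ r μ λ′ ≡ i × HStrip r λ′ μ)
    below-support i j a λ′ ≢0 = first (guard-≢0 (∣ a ∣ᵇ ≟ m ∸ i) ≢0)
      where
      inner : ℕ → ℤ
      inner k = guard (skewSize/ r μ λ′ ≟ i) (overStrip (hstrip? r λ′ μ) λ l → pos (δ t (2 * n⟨ a ⟩ + (k + l))))
      middle : ℤ
      middle = guard (skewSize/ r ν λ′ ≟ j) (overStrip (vstrip? r λ′ ν) inner)
      fourth : ∀ {k} → _ × Σ[ s ∈ HStrip r λ′ μ ] pos (δ t (2 * n⟨ a ⟩ + (k + heightSum (proj₁ s)))) ≢ pos 0 → _ × HStrip r λ′ μ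
      fourth (e , s , _) = e , s
      third : _ × Σ[ s ∈ VStrip r λ′ ν ] inner (heightSum (proj₁ s)) ≢ pos 0 → (_ × VStrip r λ′ ν) × (_ × HStrip r λ′ μ)
      third (e , s , ≢0) = (e , s) , fourth {heightSum (proj₁ s)} (guard-overStrip-≢0 (skewSize/ r μ λ′ ≟ i) (hstrip? r λ′ μ) ≢0)
      second : _ × middle ≢ pos 0 → _
      second (e , ≢0) = e , third (guard-overStrip-≢0 (skewSize/ r ν λ′ ≟ j) (vstrip? r λ′ ν) ≢0)
      first : _ × guard (∣ a ∣ᵇ ≟ n ∸ j) middle ≢ pos 0 → _
      first (e , ≢0) = e , second (guard-≢0 (∣ a ∣ᵇ ≟ n ∸ j) ≢0)

    to : ∀ κ → κ ∈ˡ aboves → aboveTerm κ ≢ pos 0 → ∃[ y ] y ∈ˡ belows × Related κ y × aboveTerm κ ≡ belowTerm y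
    to κ κ∈ ≢0 = strips (above-support κ ≢0)
      where
      Target : Set
      Target = ∃[ y ] y ∈ˡ belows × Related κ y × aboveTerm κ ≡ belowTerm y
      found : ∀ {a λ′} (X : Correspondence r′ μ ν κ a λ′) → m ≡ Correspondence.#κ/ν X → n ≡ Correspondence.#κ/μ X → Target
      found {a} {λ′} X m≡ n≡ = (X.#μ/λ , X.#ν/λ , a , λ′) ,
        Mem.∈-cartesianProduct⁺ (Mem.∈-upTo⁺ (s≤s (≤-trans (m≤n+m X.#μ/λ ∣ a ∣ᵇ) (≤-reflexive (sym (trans m≡ X.#κ/ν≡))))))
          (Mem.∈-cartesianProduct⁺ (Mem.∈-upTo⁺ (s≤s (≤-trans (m≤n+m X.#ν/λ ∣ a ∣ᵇ) (≤-reflexive (sym (trans n≡ X.#κ/μ≡))))))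
            (Mem.∈-cartesianProduct⁺ (allBits-complete a) (partitionsIn-complete λ′ (chain-size (proj₁ X.ν/λ))))) ,
        related X , linked-terms X m≡ n≡
        where module X = Correspondence X
      strips : (skewSize/ r κ ν ≡ m × HStrip r ν κ) × (skewSize/ r κ μ ≡ n × VStrip r μ κ) → Target
      strips ((m≡ , s) , (n≡ , s′)) = link (descend r′ μ ν κ s′ s)
        where
        link : ∃[ a ] ∃[ λ′ ] Correspondence r′ μ ν κ a λ′ → Target
        link (a , λ′ , X) = found X (trans (sym m≡) (skewSize r′ {κ} {ν} (Correspondence.size-κ/ν X)))
                                    (trans (sym n≡) (skewSize r′ {κ} {μ} (Correspondence.size-κ/μ X)))

    from : ∀ y → y ∈ˡ belows → belowTerm y ≢ pos 0 → ∃[ κ ] κ ∈ˡ aboves × Related κ y × aboveTerm κ ≡ belowTerm y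
    from (i , j , a , λ′) y∈ ≢0 = strips (below-support i j a λ′ ≢0)
      where
      Target : Set
      Target = ∃[ κ ] κ ∈ˡ aboves × Related κ (i , j , a , λ′) × aboveTerm κ ≡ belowTerm (i , j , a , λ′)
      found : ∀ {κ} (X : Correspondence r′ μ ν κ a λ′) → i ≡ Correspondence.#μ/λ X → j ≡ Correspondence.#ν/λ X → m ≡ ∣ a ∣ᵇ + i → n ≡ ∣ a ∣ᵇ + j → Target
      found {κ} X refl refl m≡ n≡ = κ ,
        partitionsIn-complete κ (≤-reflexive (trans X.size-κ/ν (cong (λ x → size ν + r * x) (trans X.#κ/ν≡ (sym m≡))))) ,
        related X , linked-terms X (trans m≡ (sym X.#κ/ν≡)) (trans n≡ (sym X.#κ/μ≡))
        where module X = Correspondence X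
      i≤m : i ≤ m
      i≤m = s≤s⁻¹ (Mem.∈-upTo⁻ (proj₁ (Mem.∈-cartesianProduct⁻ (upTo (suc m)) _ y∈)))
      j≤n : j ≤ n
      j≤n = s≤s⁻¹ (Mem.∈-upTo⁻ (proj₁ (Mem.∈-cartesianProduct⁻ (upTo (suc n)) _
              (proj₂ (Mem.∈-cartesianProduct⁻ (upTo (suc m)) _ y∈)))))
      strips : ∣ a ∣ᵇ ≡ m ∸ i × ∣ a ∣ᵇ ≡ n ∸ j × (skewSize/ r ν λ′ ≡ j × VStrip r λ′ ν) × (skewSize/ r μ λ′ ≡ i × HStrip r λ′ μ) → Target
      strips (a≡m , a≡n , (j≡ , s) , (i≡ , s′)) = link (ascend r′ μ ν a λ′ s′ s)
        where
        link : ∃[ κ ] Correspondence r′ μ ν κ a λ′ → Target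
        link (κ , X) = found X (trans (sym i≡) (skewSize r′ {μ} {λ′} (Correspondence.size-μ/λ X))) (trans (sym j≡) (skewSize r′ {ν} {λ′} (Correspondence.size-ν/λ X)))
          (trans (sym (m∸n+n≡m i≤m)) (cong (_+ i) (sym a≡m))) (trans (sym (m∸n+n≡m j≤n)) (cong (_+ j) (sym a≡n)))

    sides-agree : sumᶻ aboveTerm aboves ≡ sumᶻ belowTerm belows
    sides-agree = sumᶻ-bijection Related (partitionsIn-unique (size ν + r * m))
      (Unique.cartesianProduct⁺ (Unique.upTo⁺ (suc m)) (Unique.cartesianProduct⁺ (Unique.upTo⁺ (suc n))
        (Unique.cartesianProduct⁺ (allBits-unique r) (partitionsIn-unique (size ν)))))
      to from (λ {κ} {y} {y′} → related-below {κ} {y} {y′}) (λ {κ} {κ′} {y} → related-above {κ} {κ′} {y})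

  commutation : D̃ r ∘ˢ U r ≈ˢ (U r ∘ˢ D̃ r) ·ˢ ∏[i< r ]1+q^iXY
  commutation m n ν μ t = begin
    coeff (coefficient μ ((D̃ r ∘ˢ U r) m n ν)) t                           ≡⟨ coeff-coefficient μ ((D̃ r ∘ˢ U r) m n ν) t ⟩
    integrate ((D̃ r ∘ˢ U r) m n ν) (probe μ t)                             ≡⟨ integrate-left m n t μ ν ⟩
    sumᶻ (aboveTerm m n t μ ν) (aboves m n t μ ν)                          ≡⟨ sides-agree m n t μ ν ⟩
    sumᶻ (belowTerm m n t μ ν) (belows m n t μ ν)                          ≡⟨ integrate-right m n t μ ν ⟨
    integrate (((U r ∘ˢ D̃ r) ·ˢ ∏[i< r ]1+q^iXY) m n ν) (probe μ t)        ≡⟨ coeff-coefficient μ (((U r ∘ˢ D̃ r) ·ˢ ∏[i< r ]1+q^iXY) m n ν) t ⟨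
    coeff (coefficient μ (((U r ∘ˢ D̃ r) ·ˢ ∏[i< r ]1+q^iXY) m n ν)) t      ∎
    where open ≡-Reasoning

theorem6p3 : (r : ℕ) .{{_ : NonZero r}} →
    (Σ[ bᴬ ∈ AsymmetricShapeDatum r ] SpinPreserving bᴬ)
    × (D̃ r ∘ˢ U r ≈ˢ (U r ∘ˢ D̃ r) ·ˢ ∏[i< r ]1+q^iXY)
theorem6p3 (suc r′) = (asymmetricShapeDatum r′ , spinPreserving r′) , Operators.commutation r′
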